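{- The following are equivalent: (1) ${\rm UP}={\rm coUP}$. (2) ${\rm CLU\#P_{free}}={\rm CLU\#P}$. (3) ${\rm CLU\#P_{free}}\subseteq{\rm CLU\#P_{circular}}$.
   Context: Alphabet $\Sigma=\{0,1\}$; NPTM = nondeterministic polynomial-time Turing machine. ${\rm UP}$: languages accepted by NPTMs with at most one accepting path on every input; ${\rm coUP}$: their complements. For a polynomial $p$, an NPTM $M$ is $p$-balanced if on every input $x$ its computation paths correspond exactly to the guess strings in $\{0,1\}^{p(|x|)}$; paths are identified with guess strings. $\mathrm{acc}_M(x)$ is the set of accepting paths, $\#\mathrm{acc}_M(x)$ its size. ${\rm FP}_{\rm t}$: total polynomial-time computable functions. For same-length strings, $a\prec_{\rm lex}b$ means $b$ is the immediate lexicographic successor of $a$; $\le_{\rm lex}$ is lexicographic order. ${\rm CLU\#P}$: total $f:\Sigma^*\to\mathbb{N}$ such that there exist a polynomial $p$, a $p$-balanced NPTM $M$, $b,t\in{\rm FP}_{\rm t}$ and a polynomial-time 3-argument predicate $\prec$ such that for every $x$ there is a bijection $h_x$ of $\Sigma^{p(|x|)}$ with: $|b(x)|=|t(x)|=p(|x|)$; $h_x(b(x))=0^{p(|x|)}$, $h_x(t(x))=1^{p(|x|)}$; (adjacency) for $y,z\in\{0,1\}^{p(|x|)}$, $\prec(x,y,z)$ iff $h_x(y)\prec_{\rm lex}h_x(z)$; (cluster) if $f(x)\neq0$ there exist $\ell,u$ with $\mathrm{acc}_M(x)=\{w\in\{0,1\}^{p(|x|)}: h_x(\ell)\le_{\rm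 lex}h_x(w)\le_{\rm lex}h_x(u)\}$; $f(x)=\#\mathrm{acc}_M(x)$. ${\rm CLU\#P_{free}}$: defined like ${\rm CLU\#P}$ but with no functions $b,t$ and no conditions on them. ${\rm CLU\#P_{circular}}$: defined like ${\rm CLU\#P_{free}}$ except that the adjacency condition is: $\prec(x,y,z)$ iff $h_x(y)\prec_{\rm lex}h_x(z)$ or ($h_x(y)=1^{p(|x|)}$ and $h_x(z)=0^{p(|x|)}$). -}

module Defs where

open import Data.Bool using (Bool; true; false; not)
open import Data.Nat using (ℕ; zero; suc; _+_; _*_; _^_; _≤_; _<_)
open import Data.Fin using (Fin)
open import Data.List using (List; []; _∷_; length)
open import Data.Maybe using (Maybe; just; nothing)
import Data.Maybe as Maybe
open import Data.Product using (Σ; ∃; _×_; _,_)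
open import Data.Sum using (_⊎_)
open import Data.Vec using (Vec; []; _∷_; toList; replicate)
open import Function.Bundles using (_⤖_; _⇔_; Bijection)
open import Relation.Binary.PropositionalEquality using (_≡_)
open import Relation.Nullary using (¬_)

Word : Set
Word = List Bool

data Sym : Set where
  blank zero₁ one₁ sep : Sym

data Move : Set where
  left right stay : Move

record TM : Set where
  field
    Q     : ℕ
    start : Fin Q
    -- nothing = halt
    δ     : Fin Q → Sym → Maybe (Fin Q × Sym × Move)

record Tape : Set where
  constructor tape
  field
    leftPart  : List Sym   -- cells left of the head, nearest first
    headSym   : Sym
    rightPart : List Sym   -- cells right of the head, nearest first

write : Sym → Tape → Tape
write s (tape l _ r) = tape l s r

moveT : Move → Tape → Tape
moveT left  (tape []      h r)       = tape [] blank (h ∷ r)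
moveT left  (tape (a ∷ l) h r)       = tape l a (h ∷ r)
moveT right (tape l       h [])      = tape (h ∷ l) blank []
moveT right (tape l       h (a ∷ r)) = tape (h ∷ l) a r
moveT stay  t                        = t

run : (M : TM) → ℕ → Fin (TM.Q M) → Tape → Maybe Tape
run M fuel q t with TM.δ M q (Tape.headSym t)
... | nothing = just t
run M zero q t | just _ = nothing
run M (suc fuel) q t | just (q′ , s , m) = run M fuel q′ (moveT m (write s t))

readSyms : List Sym → Word
readSyms (zero₁ ∷ s) = false ∷ readSyms s
readSyms (one₁ ∷ s)  = true ∷ readSyms s
readSyms _           = []

readOut : Tape → Word
readOut (tape _ h r) = readSyms (h ∷ r)

bitSym : Bool → Sym
bitSym false = zero₁
bitSym true  = one₁

encWord : Word → List Sym
encWord [] = []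
encWord (b ∷ w) = bitSym b ∷ encWord w

encode : List Word → List Sym
encode []           = []
encode (w ∷ [])     = encWord w
encode (w ∷ v ∷ ws) = encWord w Data.List.++ (sep ∷ encode (v ∷ ws))

initTape : List Word → Tape
initTape ws with encode ws
... | []    = tape [] blank []
... | a ∷ s = tape [] a s

result : TM → ℕ → List Word → Maybe Word
result M fuel ws = Maybe.map readOut (run M fuel (TM.start M) (initTape ws))

timeBound : ℕ → ℕ → ℕ → ℕ
timeBound c k n = c * n ^ k + c

PolyTimeComputable : {A : Set} → (A → List Word) → (A → Word) → Set
PolyTimeComputable {A} args F =
  Σ TM λ M → Σ ℕ λ c → Σ ℕ λ k →
    ∀ (a : A) → result M (timeBound c k (length (encode (args a)))) (args a) ≡ just (F a)

boolWord : Bool → Word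
boolWord b = b ∷ []

FPt : (Word → Word) → Set
FPt f = PolyTimeComputable (λ x → x ∷ []) f

PTimePred₂ : (Word → Word → Bool) → Set
PTimePred₂ V = PolyTimeComputable {Word × Word} (λ { (x , y) → x ∷ y ∷ [] })
                                                (λ { (x , y) → boolWord (V x y) })

PTimePred₃ : (Word → Word → Word → Bool) → Set
PTimePred₃ P = PolyTimeComputable {Word × Word × Word}
                 (λ { (x , y , z) → x ∷ y ∷ z ∷ [] })
                 (λ { (x , y , z) → boolWord (P x y z) })

-- Polynomials with natural coefficients (constant term first)

Poly : Set
Poly = List ℕ

evalPoly : Poly → ℕ → ℕ
evalPoly []       n = 0
evalPoly (a ∷ as) n = a + n * evalPoly as n

-- p-balanced NPTMs, modelled by their path behaviour: a polynomial p and a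
-- polynomial-time predicate V, where the computation path with guess string
-- y ∈ {0,1}^p(|x|) accepts iff V x y = true.

record BalancedNPTM : Set where
  field
    p      : Poly
    V      : Word → Word → Bool
    V-poly : PTimePred₂ V

guessLen : BalancedNPTM → Word → ℕ
guessLen M x = evalPoly (BalancedNPTM.p M) (length x)

Accepts : (M : BalancedNPTM) (x : Word) → Vec Bool (guessLen M x) → Set
Accepts M x w = BalancedNPTM.V M x (toList w) ≡ true

countVec : ∀ n → (Vec Bool n → Bool) → ℕ
countVec zero    P = Data.Bool.if P [] then 1 else 0
countVec (suc n) P = countVec n (λ w → P (false ∷ w)) + countVec n (λ w → P (true ∷ w))

#acc : (M : BalancedNPTM) (x : Word) → ℕ
#acc M x = countVec (guessLen M x) (λ w → BalancedNPTM.V M x (toList w))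

Language : Set
Language = Word → Bool

InUP : Language → Set
InUP L = Σ BalancedNPTM λ M →
           (∀ x → #acc M x ≤ 1) ×
           (∀ x → L x ≡ true ⇔ 1 ≤ #acc M x)

InCoUP : Language → Set
InCoUP L = InUP (λ x → not (L x))

UP≡coUP : Set
UP≡coUP = ∀ (L : Language) → InUP L ⇔ InCoUP L

data _<lex_ : ∀ {n} → Vec Bool n → Vec Bool n → Set where
  here  : ∀ {n} {xs ys : Vec Bool n} → (false ∷ xs) <lex (true ∷ ys)
  there : ∀ {n} {b} {xs ys : Vec Bool n} → xs <lex ys → (b ∷ xs) <lex (b ∷ ys)

_≤lex_ : ∀ {n} → Vec Bool n → Vec Bool n → Set
a ≤lex b = a ≡ b ⊎ a <lex b

_≺lex_ : ∀ {n} → Vec Bool n → Vec Bool n → Set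
_≺lex_ {n} a b = a <lex b × (∀ (c : Vec Bool n) → ¬ (a <lex c × c <lex b))

AdjRel : Set₁
AdjRel = ∀ {n} → Vec Bool n → Vec Bool n → Set

circSucc : AdjRel
circSucc {n} a b = a ≺lex b ⊎ (a ≡ replicate n true × b ≡ replicate n false)

ClusterConds : AdjRel → (f : Word → ℕ) (M : BalancedNPTM)
               (prec : Word → Word → Word → Bool) (x : Word)
               (h : Vec Bool (guessLen M x) ⤖ Vec Bool (guessLen M x)) → Set
ClusterConds adj f M prec x h =
    (∀ y z → prec x (toList y) (toList z) ≡ true ⇔ adj (H y) (H z))
  × (¬ (f x ≡ 0) → Σ (Vec Bool n) λ ℓ → Σ (Vec Bool n) λ u →
        ∀ w → Accepts M x w ⇔ (H ℓ ≤lex H w × H w ≤lex H u))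
  × (f x ≡ #acc M x)
  where
    n = guessLen M x
    H = Bijection.to h

CLU#P-free : (Word → ℕ) → Set
CLU#P-free f = Σ BalancedNPTM λ M → Σ (Word → Word → Word → Bool) λ prec →
  PTimePred₃ prec ×
  (∀ x → Σ (Vec Bool (guessLen M x) ⤖ Vec Bool (guessLen M x)) λ h →
     ClusterConds _≺lex_ f M prec x h)

CLU#P-circular : (Word → ℕ) → Set
CLU#P-circular f = Σ BalancedNPTM λ M → Σ (Word → Word → Word → Bool) λ prec →
  PTimePred₃ prec ×
  (∀ x → Σ (Vec Bool (guessLen M x) ⤖ Vec Bool (guessLen M x)) λ h →
     ClusterConds circSucc f M prec x h)

CLU#P : (Word → ℕ) → Set
CLU#P f = Σ BalancedNPTM λ M → Σ (Word → Word → Word → Bool) λ prec →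
  PTimePred₃ prec ×
  Σ (Word → Word) λ b → FPt b × Σ (Word → Word) λ t → FPt t ×
  (∀ x → Σ (Vec Bool (guessLen M x) ⤖ Vec Bool (guessLen M x)) λ h →
     -- |b(x)| = p(|x|) and h_x(b(x)) = 0^p(|x|)
     (Σ (Vec Bool (guessLen M x)) λ bv →
        toList bv ≡ b x × Bijection.to h bv ≡ replicate (guessLen M x) false) ×
     -- |t(x)| = p(|x|) and h_x(t(x)) = 1^p(|x|)
     (Σ (Vec Bool (guessLen M x)) λ tv →
        toList tv ≡ t x × Bijection.to h tv ≡ replicate (guessLen M x) true) ×
     ClusterConds _≺lex_ f M prec x h)

CLU#P-free≡CLU#P : Set
CLU#P-free≡CLU#P = ∀ (f : Word → ℕ) → CLU#P-free f ⇔ CLU#P f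

CLU#P-free⊆CLU#P-circular : Set
CLU#P-free⊆CLU#P-circular = ∀ (f : Word → ℕ) → CLU#P-free f → CLU#P-circular f

{-# OPTIONS --safe #-}
module Submission where

-- (1)⇒(2).  The bottom of a cluster order is the word without a predecessor.  "w has a predecessor" is a UP predicate, so under
-- UP = coUP the bottom has a unique certificate.  Lengthening all paths makes room for an auxiliary path that consists of the bottom
-- and its certificate and links a known chain of rejecting paths to the old order; the new bottom is 0…0.  Reversing the order and
-- repeating the construction provides a known top.
-- (2)⇒(3).  With known ends, closing the order to a circle is a polynomial-time modification.
-- (3)⇒(1).  For an unambiguous machine the function 1 + #acc is in CLU#P-free.  In a circular order the value 1 is certified by the
-- accepting path together with its two rejecting neighbours, which puts the complement of the language into UP.
-- Polynomial-time computability is shown for a small functional language with loops whose programs are compiled, through a tape that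
-- holds a stack of words, to Turing machines; Turing machines are in turn simulated in that language.
open import Defs
open import Data.Bool using (Bool; true; false; not; _∧_; _∨_; if_then_else_)
open import Data.Bool.Properties using (∧-identityʳ; ∨-identityʳ; not-involutive)
open import Data.Empty using (⊥-elim)
open import Data.Fin using (Fin; zero; suc; toℕ; fromℕ<; punchOut; splitAt; _↑ˡ_; _↑ʳ_)
open import Data.Fin.Properties using (toℕ<n; any?; toℕ-fromℕ<; toℕ-injective; punchOut-injective; injective⇒≤; splitAt-↑ˡ; splitAt-↑ʳ) renaming (_≟_ to _≟F_)
open import Data.List using (List; []; _∷_; length; _++_; _ʳ++_; reverse; replicate; take; drop)
open import Data.List.Properties using (++-assoc; ++-identityʳ; length-++; ++-ʳ++; ʳ++-ʳ++; length-ʳ++; length-replicate; length-take; length-drop; take++drop≡id; ∷-injectiveʳ)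
open import Data.List.Relation.Unary.All using (All; []; _∷_)
open import Data.List.Relation.Unary.All.Properties using (++⁺; ++⁻ˡ)
open import Data.Maybe using (Maybe; just; nothing)
import Data.Maybe as Maybe
open import Data.Maybe.Properties using (just-injective)
open import Data.Nat
open import Data.Nat.Properties
open import Data.Nat.Solver using (module +-*-Solver)
open import Data.Product using (Σ; _×_; _,_; proj₁; proj₂)
open import Data.Sum using (_⊎_; inj₁; inj₂)
open import Data.Unit using (⊤; tt)
open import Data.Vec using (Vec; []; _∷_; toList; lookup)
import Data.Vec as Vec
open import Data.Vec.Properties using (toList-++; length-toList; map-lookup-allFin)
open import Data.Vec.Relation.Binary.Pointwise.Inductive using (Pointwise; []; _∷_)
open import Function.Bundles using (_⤖_; _⇔_; Bijection; mk⤖; mk⇔; Equivalence)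
open import Relation.Binary.Definitions using (tri<; tri≈; tri>)
open import Relation.Binary.PropositionalEquality
open import Relation.Nullary

open +-*-Solver using (solve; _:*_; _:+_; _:=_; con)
open Equivalence using () renaming (to to fwd; from to bwd)

-- The obstacle in both hard directions is that an adjacency predicate confirms a guessed neighbour
-- of a path, but never that a path has none. For (1)⇒(2) the certificate of absence has to be part
-- of a path itself, because adjacency is decided deterministically and must recognise the link into
-- the old order. The number of paths remains a power of two, so all other longer words have to be
-- ordered as well: they form the known chain, in the order of their values. The single word with
-- the certificate lies somewhere among these values; it is skipped there and moved to the end of
-- the chain. Skipping is a local test, since it looks at one or two increments only. The same
-- rotation puts the accepting path next to 1...1 in (3)⇒(1). There the circle helps because every
-- path has both neighbours, so that they can always be guessed, and adding 1 to the number of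
-- accepting paths provides an accepting path whose neighbours can be inspected even if the original
-- machine rejects.

infixl 6 _⊕_
infixl 7 _⊗_
infixr 9 _⊚_

-- Composition is a constructor because the cost of a subprogram is a polynomial in a size that is
-- itself only known up to a polynomial. There is no subtraction, so every expression is monotone
-- and bounds on sizes can be substituted.
data PolyExp : Set where
  X       : PolyExp
  K       : ℕ → PolyExp
  _⊕_ _⊗_ : PolyExp → PolyExp → PolyExp
  _⊚_     : PolyExp → PolyExp → PolyExp

⟦_⟧ : PolyExp → ℕ → ℕ
⟦ X ⟧ n = n
⟦ K c ⟧ n = c
⟦ d ⊕ e ⟧ n = ⟦ d ⟧ n + ⟦ e ⟧ n
⟦ d ⊗ e ⟧ n = ⟦ d ⟧ n * ⟦ e ⟧ n
⟦ d ⊚ e ⟧ n = ⟦ d ⟧ (⟦ e ⟧ n)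

⟦⟧-mono : ∀ e {m n} → m ≤ n → ⟦ e ⟧ m ≤ ⟦ e ⟧ n
⟦⟧-mono X le = le
⟦⟧-mono (K c) le = ≤-refl
⟦⟧-mono (d ⊕ e) le = +-mono-≤ (⟦⟧-mono d le) (⟦⟧-mono e le)
⟦⟧-mono (d ⊗ e) le = *-mono-≤ (⟦⟧-mono d le) (⟦⟧-mono e le)
⟦⟧-mono (d ⊚ e) le = ⟦⟧-mono d (⟦⟧-mono e le)

1≤suc^ : ∀ n k → 1 ≤ suc n ^ k
1≤suc^ n k = m^n>0 (suc n) k

^-distribʳ-* : ∀ a b k → (a * b) ^ k ≡ a ^ k * b ^ k
^-distribʳ-* a b zero = refl
^-distribʳ-* a b (suc k) = trans (cong (a * b *_) (^-distribʳ-* a b k))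
  (solve 4 (λ a b x y → a :* b :* (x :* y) := a :* x :* (b :* y)) refl a b (a ^ k) (b ^ k))

-- Powers of `suc n` instead of `n` are at least 1 even at `n = 0`, so exponents can be raised and
-- constants absorbed without exception.
⟦⟧-≤-monomial : ∀ e → Σ ℕ λ c → Σ ℕ λ k → ∀ n → ⟦ e ⟧ n ≤ c * suc n ^ k
⟦⟧-≤-monomial X = 1 , 1 , λ n → ≤-trans (n≤1+n n)
  (≤-reflexive (sym (trans (*-identityˡ _) (*-identityʳ (suc n)))))
⟦⟧-≤-monomial (K c) = c , 0 , λ n → ≤-reflexive (sym (*-identityʳ c))
⟦⟧-≤-monomial (d ⊕ e) with ⟦⟧-≤-monomial d | ⟦⟧-≤-monomial e
... | c₁ , k₁ , p | c₂ , k₂ , q = c₁ + c₂ , k₁ + k₂ , λ n → begin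
  ⟦ d ⟧ n + ⟦ e ⟧ n                                   ≤⟨ +-mono-≤ (p n) (q n) ⟩
  c₁ * suc n ^ k₁ + c₂ * suc n ^ k₂
    ≤⟨ +-mono-≤ (*-monoʳ-≤ c₁ (^-monoʳ-≤ (suc n) (m≤m+n k₁ k₂)))
                (*-monoʳ-≤ c₂ (^-monoʳ-≤ (suc n) (m≤n+m k₂ k₁))) ⟩
  c₁ * suc n ^ (k₁ + k₂) + c₂ * suc n ^ (k₁ + k₂)
    ≡⟨ *-distribʳ-+ (suc n ^ (k₁ + k₂)) c₁ c₂ ⟨
  (c₁ + c₂) * suc n ^ (k₁ + k₂) ∎
  where open ≤-Reasoning
⟦⟧-≤-monomial (d ⊗ e) with ⟦⟧-≤-monomial d | ⟦⟧-≤-monomial e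
... | c₁ , k₁ , p | c₂ , k₂ , q = c₁ * c₂ , k₁ + k₂ , λ n → begin
  ⟦ d ⟧ n * ⟦ e ⟧ n                                   ≤⟨ *-mono-≤ (p n) (q n) ⟩
  (c₁ * suc n ^ k₁) * (c₂ * suc n ^ k₂)
    ≡⟨ solve 4 (λ a b x y → (a :* x) :* (b :* y) := (a :* b) :* (x :* y)) refl c₁ c₂ (suc n ^ k₁) (suc n ^ k₂) ⟩
  (c₁ * c₂) * (suc n ^ k₁ * suc n ^ k₂)
    ≡⟨ cong (c₁ * c₂ *_) (sym (^-distribˡ-+-* (suc n) k₁ k₂)) ⟩
  (c₁ * c₂) * suc n ^ (k₁ + k₂) ∎
  where open ≤-Reasoning
⟦⟧-≤-monomial (d ⊚ e) with ⟦⟧-≤-monomial d | ⟦⟧-≤-monomial e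
... | c₁ , k₁ , p | c₂ , k₂ , q = c₁ * suc c₂ ^ k₁ , k₂ * k₁ , λ n → begin
  ⟦ d ⟧ (⟦ e ⟧ n)                       ≤⟨ p (⟦ e ⟧ n) ⟩
  c₁ * suc (⟦ e ⟧ n) ^ k₁
    ≤⟨ *-monoʳ-≤ c₁ (^-monoˡ-≤ k₁ (+-mono-≤ (1≤suc^ n k₂) (q n))) ⟩
  c₁ * (suc c₂ * suc n ^ k₂) ^ k₁       ≡⟨ cong (c₁ *_) (^-distribʳ-* (suc c₂) (suc n ^ k₂) k₁) ⟩
  c₁ * (suc c₂ ^ k₁ * (suc n ^ k₂) ^ k₁) ≡⟨ cong (λ z → c₁ * (suc c₂ ^ k₁ * z)) (^-*-assoc (suc n) k₂ k₁) ⟩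
  c₁ * (suc c₂ ^ k₁ * suc n ^ (k₂ * k₁)) ≡⟨ *-assoc c₁ (suc c₂ ^ k₁) _ ⟨
  c₁ * suc c₂ ^ k₁ * suc n ^ (k₂ * k₁) ∎
  where open ≤-Reasoning

-- For positive `n` the base at most doubles; the summand `2 ^ k` pays for `n = 0`, as the additive
-- `c` does in `timeBound`.
suc^≤ : ∀ n k → suc n ^ k ≤ 2 ^ k * n ^ k + 2 ^ k
suc^≤ zero k = ≤-trans (≤-trans (≤-reflexive (^-zeroˡ k)) (m^n>0 2 k)) (m≤n+m (2 ^ k) _)
suc^≤ (suc n) k = ≤-trans (^-monoˡ-≤ k (s≤s (≤-trans (m≤n+m (suc n) n) (≤-reflexive (cong (n +_) (sym (+-identityʳ _)))))))
  (≤-trans (≤-reflexive (^-distribʳ-* 2 (suc n) k)) (m≤m+n _ _))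

⟦⟧-≤-timeBound : ∀ e → Σ ℕ λ c → Σ ℕ λ k → ∀ n → ⟦ e ⟧ n ≤ timeBound c k n
⟦⟧-≤-timeBound e with ⟦⟧-≤-monomial e
... | c , k , p = c * 2 ^ k , k , λ n → ≤-trans (p n) (≤-trans (*-monoʳ-≤ c (suc^≤ n k))
  (≤-reflexive (trans (*-distribˡ-+ c (2 ^ k * n ^ k) (2 ^ k)) (cong (_+ c * 2 ^ k) (sym (*-assoc c (2 ^ k) (n ^ k)))))))

-- Structured Turing machine programs

infixr 5 _⨾_

data Prog : Set where
  act  : (Sym → Sym × Move) → Prog
  _⨾_  : Prog → Prog → Prog
  sw   : (Sym → Prog) → Prog
  loop : (Sym → Maybe Prog) → Prog

infix 4 _⊢_⇓[_]_

-- The index is an upper bound on the number of steps: `wk` allows costs to be rounded up to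
-- polynomials in the middle of a derivation.
data _⊢_⇓[_]_ : Prog → Tape → ℕ → Tape → Set where
  act⇓ : ∀ {f t t′} → moveT (proj₂ (f (Tape.headSym t))) (write (proj₁ (f (Tape.headSym t))) t) ≡ t′ →
         act f ⊢ t ⇓[ 1 ] t′
  seq⇓ : ∀ {p q t t′ t″ m n} → p ⊢ t ⇓[ m ] t′ → q ⊢ t′ ⇓[ n ] t″ → p ⨾ q ⊢ t ⇓[ m + n ] t″
  sw⇓  : ∀ {f t t′ n} → f (Tape.headSym t) ⊢ t ⇓[ n ] t′ → sw f ⊢ t ⇓[ suc n ] t′
  done : ∀ {f t} → f (Tape.headSym t) ≡ nothing → loop f ⊢ t ⇓[ 1 ] t
  more : ∀ {f p t t′ t″ m n} → f (Tape.headSym t) ≡ just p → p ⊢ t ⇓[ m ] t′ → loop f ⊢ t′ ⇓[ n ] t″ →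
         loop f ⊢ t ⇓[ suc (m + n) ] t″
  wk   : ∀ {p t t′ m n} → m ≤ n → p ⊢ t ⇓[ m ] t′ → p ⊢ t ⇓[ n ] t′

-- A retract of `Fin card` suffices for the states of a machine: codes outside the image of `to` are
-- never entered by a run that starts in a proper state.
record Finite (A : Set) : Set where
  field
    card    : ℕ
    to      : A → Fin card
    from    : Fin card → A
    from∘to : ∀ a → from (to a) ≡ a

open Finite

⊤-finite : Finite ⊤
⊤-finite = record { card = 1 ; to = λ _ → zero ; from = λ _ → tt ; from∘to = λ _ → refl }

⊎-finite : ∀ {A B} → Finite A → Finite B → Finite (A ⊎ B)
⊎-finite {A} {B} FA FB = record { card = card FA + card FB ; to = t ; from = λ i → g (splitAt (card FA) i) ; from∘to = ft }
  where
  t : A ⊎ B → Fin (card FA + card FB)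
  t (inj₁ a) = to FA a ↑ˡ card FB
  t (inj₂ b) = card FA ↑ʳ to FB b
  g : Fin (card FA) ⊎ Fin (card FB) → A ⊎ B
  g (inj₁ i) = inj₁ (from FA i)
  g (inj₂ j) = inj₂ (from FB j)
  ft : ∀ a → g (splitAt (card FA) (t a)) ≡ a
  ft (inj₁ a) rewrite splitAt-↑ˡ (card FA) (to FA a) (card FB) = cong inj₁ (from∘to FA a)
  ft (inj₂ b) rewrite splitAt-↑ʳ (card FA) (card FB) (to FB b) = cong inj₂ (from∘to FB b)

ΣSym-finite : ∀ {A : Sym → Set} → (∀ a → Finite (A a)) → Finite (Σ Sym A)
ΣSym-finite {A} F = record
  { card = card F4 ; to = λ x → to F4 (t x) ; from = λ i → g (from F4 i)
  ; from∘to = λ x → trans (cong g (from∘to F4 (t x))) (gt x) }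
  where
  F4 = ⊎-finite (⊎-finite (F blank) (F zero₁)) (⊎-finite (F one₁) (F sep))
  t : Σ Sym A → (A blank ⊎ A zero₁) ⊎ (A one₁ ⊎ A sep)
  t (blank , x) = inj₁ (inj₁ x)
  t (zero₁ , x) = inj₁ (inj₂ x)
  t (one₁ , x)  = inj₂ (inj₁ x)
  t (sep , x)   = inj₂ (inj₂ x)
  g : (A blank ⊎ A zero₁) ⊎ (A one₁ ⊎ A sep) → Σ Sym A
  g (inj₁ (inj₁ x)) = blank , x
  g (inj₁ (inj₂ x)) = zero₁ , x
  g (inj₂ (inj₁ x)) = one₁ , x
  g (inj₂ (inj₂ x)) = sep , x
  gt : ∀ x → g (t x) ≡ x
  gt (blank , x) = refl
  gt (zero₁ , x) = refl
  gt (one₁ , x)  = refl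
  gt (sep , x)   = refl

mutual
  St : Prog → Set
  St (act f)  = ⊤
  St (p ⨾ q)  = St p ⊎ St q
  St (sw f)   = ⊤ ⊎ Σ Sym λ a → St (f a)
  St (loop f) = ⊤ ⊎ Σ Sym λ a → St? (f a)

  St? : Maybe Prog → Set
  St? nothing  = ⊤
  St? (just p) = St p

mutual
  St-finite : ∀ p → Finite (St p)
  St-finite (act f)  = ⊤-finite
  St-finite (p ⨾ q)  = ⊎-finite (St-finite p) (St-finite q)
  St-finite (sw f)   = ⊎-finite ⊤-finite (ΣSym-finite λ a → St-finite (f a))
  St-finite (loop f) = ⊎-finite ⊤-finite (ΣSym-finite λ a → St?-finite (f a))

  St?-finite : ∀ m → Finite (St? m)
  St?-finite nothing  = ⊤-finite
  St?-finite (just p) = St-finite p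

entry : ∀ p → St p
entry (act f)  = tt
entry (p ⨾ q)  = inj₁ (entry p)
entry (sw f)   = inj₁ tt
entry (loop f) = inj₁ tt

orElse : ∀ {A B : Set} → (A → B) → B → Maybe A → B
orElse f b (just a) = f a
orElse f b nothing  = b

-- Successor state nothing: the program is left after this step.
mutual
  δ : ∀ p → St p → Sym → Maybe (St p) × Sym × Move
  δ (act f) _ a = nothing , f a
  δ (p ⨾ q) (inj₁ s) a with δ p s a
  ... | s? , am = just (orElse inj₁ (inj₂ (entry q)) s?) , am
  δ (p ⨾ q) (inj₂ s) a with δ q s a
  ... | s? , am = Maybe.map inj₂ s? , am
  δ (sw f) (inj₁ _) a = just (inj₂ (a , entry (f a))) , a , stay
  δ (sw f) (inj₂ (b , s)) a with δ (f b) s a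
  ... | s? , am = Maybe.map (λ s′ → inj₂ (b , s′)) s? , am
  δ (loop f) (inj₁ _) a = δ-test f a (f a) refl , a , stay
  δ (loop f) (inj₂ (b , s)) a with δ? (f b) s a
  ... | s? , am = just (orElse (λ s′ → inj₂ (b , s′)) (inj₁ tt) s?) , am

  -- The equation is carried along so that the entry state of `p` can be transported into
  -- `St? (f a)`.
  δ-test : ∀ (f : Sym → Maybe Prog) a m → f a ≡ m → Maybe (⊤ ⊎ Σ Sym λ a → St? (f a))
  δ-test f a nothing  eq = nothing
  δ-test f a (just p) eq = just (inj₂ (a , subst St? (sym eq) (entry p)))

  δ? : ∀ m → St? m → Sym → Maybe (St? m) × Sym × Move
  δ? nothing  s a = nothing , a , stay
  δ? (just p) s a = δ p s a

module _ {S : Set} (d : S → Sym → Maybe S × Sym × Move) where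
  step-tape : S → Tape → Tape
  step-tape s t = moveT (proj₂ (proj₂ (d s (Tape.headSym t)))) (write (proj₁ (proj₂ (d s (Tape.headSym t)))) t)

  -- A program is left through a missing successor state, so its run can be glued to any state
  -- chosen as continuation. The index is again a budget: `exit` accepts every nonzero number.
  data Exits : S → Tape → ℕ → Tape → Set where
    exit : ∀ {s t t′ n} → proj₁ (d s (Tape.headSym t)) ≡ nothing → step-tape s t ≡ t′ → Exits s t (suc n) t′
    next : ∀ {s s′ t t′ n} → proj₁ (d s (Tape.headSym t)) ≡ just s′ → Exits s′ (step-tape s t) n t′ → Exits s t (suc n) t′

  Exits-wk : ∀ {s t t′ m n} → m ≤ n → Exits s t m t′ → Exits s t n t′
  Exits-wk (s≤s le) (exit e₁ e₂) = exit e₁ e₂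
  Exits-wk (s≤s le) (next e r) = next e (Exits-wk le r)

module _ {S T : Set} {d : S → Sym → Maybe S × Sym × Move} {e : T → Sym → Maybe T × Sym × Move} (ι : S → T) where
  Exits-map : (∀ s a → e (ι s) a ≡ (Maybe.map ι (proj₁ (d s a)) , proj₂ (d s a))) →
              ∀ {s t t′ n} → Exits d s t n t′ → Exits e (ι s) t n t′
  Exits-map sim {s} {t} (exit e₁ refl) =
    exit (trans (cong proj₁ (sim s _)) (cong (Maybe.map ι) e₁))
         (cong (λ z → moveT (proj₂ (proj₂ z)) (write (proj₁ (proj₂ z)) t)) (sim s _))
  Exits-map sim {s} {t} (next e₁ r) =
    next (trans (cong proj₁ (sim s _)) (cong (Maybe.map ι) e₁))
         (subst (λ z → Exits e _ z _ _)
           (sym (cong (λ z → moveT (proj₂ (proj₂ z)) (write (proj₁ (proj₂ z)) t)) (sim s _)))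
           (Exits-map sim r))

  Exits-then : ∀ {k} → (∀ s a → e (ι s) a ≡ (just (orElse ι k (proj₁ (d s a))) , proj₂ (d s a))) →
               ∀ {s t t′ t″ m n} → Exits d s t m t′ → Exits e k t′ n t″ → Exits e (ι s) t (m + n) t″
  Exits-then {k} sim {s} {t} {n = n} (exit {n = m} e₁ refl) r =
    next (trans (cong proj₁ (sim s _)) (cong (λ z → just (orElse ι k z)) e₁))
         (Exits-wk e (m≤n+m n m) (subst (λ z → Exits e _ z _ _)
           (sym (cong (λ z → moveT (proj₂ (proj₂ z)) (write (proj₁ (proj₂ z)) t)) (sim s _))) r))
  Exits-then {k} sim {s} {t} (next e₁ r′) r =
    next (trans (cong proj₁ (sim s _)) (cong (λ z → just (orElse ι k z)) e₁))
         (subst (λ z → Exits e _ z _ _)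
           (sym (cong (λ z → moveT (proj₂ (proj₂ z)) (write (proj₁ (proj₂ z)) t)) (sim s _)))
           (Exits-then sim r′ r))

compile-correct : ∀ {p t n t′} → p ⊢ t ⇓[ n ] t′ → Exits (δ p) (entry p) t n t′
compile-correct (act⇓ eq) = exit refl eq
compile-correct (seq⇓ {p} {q} r₁ r₂) =
  Exits-then inj₁ (λ s a → refl) (compile-correct r₁) (Exits-map inj₂ (λ s a → refl) (compile-correct r₂))
compile-correct (sw⇓ {f} {t} r) = next refl (Exits-map (λ s → inj₂ (Tape.headSym t , s)) (λ s a → refl) (compile-correct r))
compile-correct (done {f} {t} eq) = exit (lem (f (Tape.headSym t)) refl eq) refl
  where
  lem : ∀ m (e : f (Tape.headSym t) ≡ m) → m ≡ nothing → δ-test f (Tape.headSym t) m e ≡ nothing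
  lem nothing e refl = refl
compile-correct (more {f} {p} {t} {t′} {t″} {m} {n} eq r₁ r₂) = next (lem (f a) refl eq) body
  where
  a = Tape.headSym t
  lem : ∀ m (e : f a ≡ m) (e′ : m ≡ just p) →
        δ-test f a m e ≡ just (inj₂ (a , subst St? (sym (subst (f a ≡_) e′ e)) (entry p)))
  lem .(just p) e refl = refl
  body : Exits (δ (loop f)) (inj₂ (a , subst St? (sym (subst (f a ≡_) eq refl)) (entry p))) t (m + n) t″
  body = Exits-then (λ s → inj₂ (a , s)) (λ s a → refl) (aux (f a) (subst (f a ≡_) eq refl)) (compile-correct r₂)
    where
    aux : ∀ m? (e : m? ≡ just p) → Exits (δ? m?) (subst St? (sym e) (entry p)) t m t′
    aux .(just p) refl = compile-correct r₁
compile-correct (wk {p} le r) = Exits-wk (δ p) le (compile-correct r)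

-- the additional state (inj₂ tt) halts
toTM : Prog → TM
toTM p = record { Q = card F ; start = to F (inj₁ (entry p)) ; δ = λ q a → d (from F q) a }
  where
  F = ⊎-finite (St-finite p) ⊤-finite
  d : St p ⊎ ⊤ → Sym → Maybe (Fin (card F) × Sym × Move)
  d (inj₂ _) a = nothing
  d (inj₁ s) a with δ p s a
  ... | s? , am = just (to F (orElse inj₁ (inj₂ tt) s?) , am)

run-step : ∀ M {fuel q t q′ s m} → TM.δ M q (Tape.headSym t) ≡ just (q′ , s , m) →
           run M (suc fuel) q t ≡ run M fuel q′ (moveT m (write s t))
run-step M eq rewrite eq = refl

run-halted : ∀ M {fuel q t} → TM.δ M q (Tape.headSym t) ≡ nothing → run M fuel q t ≡ just t
run-halted M {zero} eq rewrite eq = refl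
run-halted M {suc _} eq rewrite eq = refl

toTM-correct : ∀ p {t n t′} → p ⊢ t ⇓[ n ] t′ → run (toTM p) n (TM.start (toTM p)) t ≡ just t′
toTM-correct p r = go (compile-correct r)
  where
  M = toTM p
  F = ⊎-finite (St-finite p) ⊤-finite
  go : ∀ {s t n t′} → Exits (δ p) s t n t′ → run M n (to F (inj₁ s)) t ≡ just t′
  go {s} {t} (exit {n = n} e₁ refl) = trans (run-step M {n} {to F (inj₁ s)} {t} lem) (run-halted M {n} (lem′ {_}))
    where
    lem : TM.δ M (to F (inj₁ s)) (Tape.headSym t) ≡ just (to F (inj₂ tt) , proj₂ (δ p s (Tape.headSym t)))
    lem rewrite from∘to F (inj₁ s) | e₁ = refl
    lem′ : ∀ {a} → TM.δ M (to F (inj₂ tt)) a ≡ nothing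
    lem′ rewrite from∘to F (inj₂ tt) = refl
  go {s} {t} (next {s′ = s′} {n = n} e₁ r) = trans (run-step M {n} {to F (inj₁ s)} {t} lem) (go r)
    where
    lem : TM.δ M (to F (inj₁ s)) (Tape.headSym t) ≡ just (to F (inj₁ s′) , proj₂ (δ p s (Tape.headSym t)))
    lem rewrite from∘to F (inj₁ s) | e₁ = refl

-- Tape layout, scanning, and skipping words

rev-split : ∀ {A : Set} (xs : List A) {ys zs} → (xs ʳ++ ys) ++ zs ≡ xs ʳ++ (ys ++ zs)
rev-split [] = refl
rev-split (x ∷ xs) = rev-split xs

-- They absorb the case distinction of `moveT` at the two ends of the tape, so that `moveR` and
-- `moveL` each state one rule.
mk lk : List Sym → List Sym → Tape
mk l []      = tape l blank []
mk l (a ∷ r) = tape l a r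
lk [] r      = tape [] blank r
lk (a ∷ l) r = tape l a r

moveR : ∀ l h r → moveT right (tape l h r) ≡ mk (h ∷ l) r
moveR l h []      = refl
moveR l h (_ ∷ _) = refl

moveL : ∀ l h r → moveT left (tape l h r) ≡ lk l (h ∷ r)
moveL [] h r      = refl
moveL (_ ∷ _) h r = refl

-- Erased cells remain on the tape as explicit blanks left of the stack; their number varies and
-- carries no information.
bl : ℕ → List Sym
bl j = replicate j blank

lk-bl : ∀ j r → lk (bl j) r ≡ tape (bl (pred j)) blank r
lk-bl zero r = refl
lk-bl (suc j) r = refl

cast⇓ : ∀ {p n t t′ u u′} → t ≡ t′ → u ≡ u′ → p ⊢ t′ ⇓[ n ] u′ → p ⊢ t ⇓[ n ] u
cast⇓ refl refl r = r

data Solid : Sym → Set where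
  bit0 : Solid zero₁
  bit1 : Solid one₁
  seps : Solid sep

Solid-ʳ++ : ∀ {xs ys} → All Solid xs → All Solid ys → All Solid (xs ʳ++ ys)
Solid-ʳ++ [] qs = qs
Solid-ʳ++ (p ∷ ps) qs = Solid-ʳ++ ps (p ∷ qs)

-- Words are terminated, not merely separated as in `encode`; pushing, skipping and deleting then
-- treat the last word like all others.
encS : List Word → List Sym
encS []       = []
encS (w ∷ st) = encWord w ++ sep ∷ encS st

encS-++ : ∀ st st′ → encS (st ++ st′) ≡ encS st ++ encS st′
encS-++ [] st′ = refl
encS-++ (w ∷ st) st′ = trans (cong (λ z → encWord w ++ sep ∷ z) (encS-++ st st′)) (sym (++-assoc (encWord w) _ _))

encWord-solid : ∀ w → All Solid (encWord w)
encWord-solid [] = []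
encWord-solid (false ∷ w) = bit0 ∷ encWord-solid w
encWord-solid (true ∷ w)  = bit1 ∷ encWord-solid w

encS-solid : ∀ st → All Solid (encS st)
encS-solid [] = []
encS-solid (w ∷ st) = ++⁺ (encWord-solid w) (seps ∷ encS-solid st)

encWord-ʳ++ : ∀ w v → encWord (w ʳ++ v) ≡ encWord w ʳ++ encWord v
encWord-ʳ++ [] v = refl
encWord-ʳ++ (b ∷ w) v = encWord-ʳ++ w (b ∷ v)

length-encWord : ∀ w → length (encWord w) ≡ length w
length-encWord [] = refl
length-encWord (b ∷ w) = cong suc (length-encWord w)

size : List Word → ℕ
size st = length (encS st)

size-∷ : ∀ w st → size (w ∷ st) ≡ suc (length w) + size st
size-∷ w st = trans (length-++ (encWord w)) (trans (+-suc _ _) (cong (λ z → suc (z + size st)) (length-encWord w)))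

size-++ : ∀ st st′ → size (st ++ st′) ≡ size st + size st′
size-++ st st′ = trans (cong length (encS-++ st st′)) (length-++ (encS st))

goL goR erase : Prog
goL   = act λ a → a , left
goR   = act λ a → a , right
erase = act λ _ → blank , right

goL⇓ : ∀ {l h r} → goL ⊢ tape l h r ⇓[ 1 ] lk l (h ∷ r)
goL⇓ = act⇓ (moveL _ _ _)

goR⇓ : ∀ {l h r} → goR ⊢ tape l h r ⇓[ 1 ] mk (h ∷ l) r
goR⇓ = act⇓ (moveR _ _ _)

erase⇓ : ∀ {l h r} → erase ⊢ tape l h r ⇓[ 1 ] mk (blank ∷ l) r
erase⇓ = act⇓ (moveR _ _ _)

unlessBlank : Prog → Sym → Maybe Prog
unlessBlank p blank = nothing
unlessBlank p _     = just p

unlessBlank-solid : ∀ {a} p → Solid a → unlessBlank p a ≡ just p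
unlessBlank-solid p bit0 = refl
unlessBlank-solid p bit1 = refl
unlessBlank-solid p seps = refl

scanL scanR : Prog
scanL = loop (unlessBlank goL)
scanR = loop (unlessBlank goR)

walkCost : PolyExp
walkCost = K 2 ⊗ X ⊕ K 1

scanR⇓ : ∀ {xs} → All Solid xs → ∀ {l r} → (∀ l → Tape.headSym (mk l r) ≡ blank) → ∀ {N} → length xs ≤ N →
         scanR ⊢ mk l (xs ++ r) ⇓[ ⟦ walkCost ⟧ N ] mk (xs ʳ++ l) r
scanR⇓ {xs} solid hb le = wk (⟦⟧-mono walkCost le) (go solid)
  where
  go : ∀ {xs} → All Solid xs → ∀ {l} → scanR ⊢ mk l (xs ++ _) ⇓[ ⟦ walkCost ⟧ (length xs) ] mk (xs ʳ++ l) _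
  go [] = done (cong (unlessBlank goR) (hb _))
  go {x ∷ xs} (s ∷ ss) = wk (≤-reflexive (solve 1 (λ n → con 2 :+ (con 2 :* n :+ con 1) := con 2 :* (con 1 :+ n) :+ con 1) refl (length xs)))
    (more (unlessBlank-solid goR s) goR⇓ (go ss))

scanL⇓ : ∀ {xs} → All Solid xs → ∀ {j r N} → length xs ≤ N →
         scanL ⊢ lk (xs ++ bl j) r ⇓[ ⟦ walkCost ⟧ N ] lk (bl j) (xs ʳ++ r)
scanL⇓ {xs} solid {j} le = wk (⟦⟧-mono walkCost le) (go solid)
  where
  go : ∀ {xs} → All Solid xs → ∀ {r} → scanL ⊢ lk (xs ++ bl j) r ⇓[ ⟦ walkCost ⟧ (length xs) ] lk (bl j) (xs ʳ++ r)
  go [] = done (cong (λ t → unlessBlank goL (Tape.headSym t)) (lk-bl j _))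
  go {x ∷ xs} (s ∷ ss) = wk (≤-reflexive (solve 1 (λ n → con 2 :+ (con 2 :* n :+ con 1) := con 2 :* (con 1 :+ n) :+ con 1) refl (length xs)))
    (more (unlessBlank-solid goL s) goL⇓ (go ss))

home : Prog
home = scanL ⨾ erase

homeCost : PolyExp
homeCost = walkCost ⊕ K 1

home⇓ : ∀ {xs} → All Solid xs → ∀ {j r N} → length xs ≤ N →
        home ⊢ lk (xs ++ bl j) r ⇓[ ⟦ homeCost ⟧ N ] mk (bl (suc (pred j))) (xs ʳ++ r)
home⇓ solid {j} le = seq⇓ (scanL⇓ solid le) (cast⇓ (lk-bl j _) refl erase⇓)

ifBit : Prog → Sym → Maybe Prog
ifBit p zero₁ = just p
ifBit p one₁  = just p
ifBit p _     = nothing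

ifBit-bit : ∀ p b → ifBit p (bitSym b) ≡ just p
ifBit-bit p false = refl
ifBit-bit p true  = refl

skipBits : Prog
skipBits = loop (ifBit goR)

skipBits⇓ : ∀ w {l r N} → length w ≤ N →
            skipBits ⊢ mk l (encWord w ++ sep ∷ r) ⇓[ ⟦ walkCost ⟧ N ] mk (encWord w ʳ++ l) (sep ∷ r)
skipBits⇓ w {r = r} le = wk (⟦⟧-mono walkCost le) (go w)
  where
  go : ∀ w {l} → skipBits ⊢ mk l (encWord w ++ sep ∷ r) ⇓[ ⟦ walkCost ⟧ (length w) ] mk (encWord w ʳ++ l) (sep ∷ r)
  go [] = done refl
  go (b ∷ w) = wk (≤-reflexive (solve 1 (λ n → con 2 :+ (con 2 :* n :+ con 1) := con 2 :* (con 1 :+ n) :+ con 1) refl (length w)))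
    (more (ifBit-bit goR b) goR⇓ (go w))

skip : Prog
skip = act λ a → a , stay

seek : ℕ → Prog
seek zero    = skip
seek (suc k) = skipBits ⨾ goR ⨾ seek k

seekCost : ℕ → PolyExp
seekCost zero    = K 1
seekCost (suc k) = walkCost ⊕ (K 1 ⊕ seekCost k)

skip⇓ : ∀ {t} → skip ⊢ t ⇓[ 1 ] t
skip⇓ = act⇓ refl

length≤size : ∀ w st → length w ≤ size (w ∷ st)
length≤size w st = ≤-trans (n≤1+n _) (≤-trans (m≤m+n _ (size st)) (≤-reflexive (sym (size-∷ w st))))

size-tail : ∀ w st → size st ≤ size (w ∷ st)
size-tail w st = ≤-trans (m≤n+m (size st) (suc (length w))) (≤-reflexive (sym (size-∷ w st)))

seek⇓ : ∀ st {l r N} → size st ≤ N → seek (length st) ⊢ mk l (encS st ++ r) ⇓[ ⟦ seekCost (length st) ⟧ N ] mk (encS st ʳ++ l) r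
seek⇓ [] le = skip⇓
seek⇓ (w ∷ st) {l} {r} le = cast⇓ (cong (mk l) (++-assoc (encWord w) _ _))
  (cong (λ z → mk z r) (++-ʳ++ (encWord w)))
  (seq⇓ (skipBits⇓ w (≤-trans (length≤size w st) le)) (seq⇓ goR⇓ (seek⇓ st (≤-trans (size-tail w st) le))))

-- Programs on a tape holding a stack of words

infix 4 _⊢ˢ_⇓[_]_

-- The number of blanks on the left may change, the tape right of the stack may not. That tape is
-- nonempty so that a left move off an empty stack creates no new cell.
record _⊢ˢ_⇓[_]_ (p : Prog) (st : List Word) (n : ℕ) (st′ : List Word) : Set where
  constructor stk
  field
    onTape : ∀ j a r → Σ ℕ λ j′ → p ⊢ mk (bl j) (encS st ++ a ∷ r) ⇓[ n ] mk (bl j′) (encS st′ ++ a ∷ r)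

open _⊢ˢ_⇓[_]_ public

seqˢ : ∀ {p q st st′ st″ m n} → p ⊢ˢ st ⇓[ m ] st′ → q ⊢ˢ st′ ⇓[ n ] st″ → p ⨾ q ⊢ˢ st ⇓[ m + n ] st″
seqˢ {p} {q} {st} {st′} {st″} {m} {n} (stk P) (stk Q) = stk go
  where
  go : ∀ j a r → Σ ℕ λ j′ → p ⨾ q ⊢ mk (bl j) (encS st ++ a ∷ r) ⇓[ m + n ] mk (bl j′) (encS st″ ++ a ∷ r)
  go j a r with P j a r
  ... | j′ , c with Q j′ a r
  ... | j″ , d = j″ , seq⇓ c d

wkˢ : ∀ {p st st′ m n} → m ≤ n → p ⊢ˢ st ⇓[ m ] st′ → p ⊢ˢ st ⇓[ n ] st′
wkˢ le (stk P) = stk λ j a r → proj₁ (P j a r) , wk le (proj₂ (P j a r))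

skipˢ : ∀ {st} → skip ⊢ˢ st ⇓[ 1 ] st
skipˢ = stk λ j a r → j , skip⇓

mk-∷ : ∀ xs (a : Sym) r → Σ Sym λ b → Σ (List Sym) λ s → xs ++ a ∷ r ≡ b ∷ s
mk-∷ [] a r = a , r , refl
mk-∷ (x ∷ xs) a r = x , xs ++ a ∷ r , refl

putL : Sym → Prog
putL s = goL ⨾ act λ _ → s , stay

putL⇓ : ∀ s {j} xs {a r} → putL s ⊢ mk (bl j) (xs ++ a ∷ r) ⇓[ 2 ] mk (bl (pred j)) (s ∷ xs ++ a ∷ r)
putL⇓ s {j} xs {a} {r} with mk-∷ xs a r
... | b , z , eq rewrite eq = seq⇓ goL⇓ (cast⇓ (lk-bl j _) refl (act⇓ refl))

newP : Prog
newP = putL sep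

newˢ : ∀ {st} → newP ⊢ˢ st ⇓[ 2 ] [] ∷ st
newˢ {st} = stk λ j a r → pred j , putL⇓ sep (encS st)

pushP : Bool → Prog
pushP b = putL (bitSym b)

pushˢ : ∀ b {w st} → pushP b ⊢ˢ w ∷ st ⇓[ 2 ] (b ∷ w) ∷ st
pushˢ b {w} {st} = stk λ j a r → pred j , putL⇓ (bitSym b) (encS (w ∷ st))

popCase : Prog → Prog → Prog → Prog
popCase p p₀ p₁ = sw λ { zero₁ → erase ⨾ p₀ ; one₁ → erase ⨾ p₁ ; _ → p }

popCase-[]ˢ : ∀ {p p₀ p₁ st st′ n} → p ⊢ˢ [] ∷ st ⇓[ n ] st′ → popCase p p₀ p₁ ⊢ˢ [] ∷ st ⇓[ 2 + n ] st′
popCase-[]ˢ (stk P) = stk λ j a r → proj₁ (P j a r) , wk (n≤1+n _) (sw⇓ (proj₂ (P j a r)))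

popCase-∷ˢ : ∀ {p p₀ p₁ st st′ n} b {w} → (if b then p₁ else p₀) ⊢ˢ w ∷ st ⇓[ n ] st′ →
             popCase p p₀ p₁ ⊢ˢ (b ∷ w) ∷ st ⇓[ 2 + n ] st′
popCase-∷ˢ false (stk P) = stk λ j a r → proj₁ (P (suc j) a r) , sw⇓ (seq⇓ erase⇓ (proj₂ (P (suc j) a r)))
popCase-∷ˢ true (stk P) = stk λ j a r → proj₁ (P (suc j) a r) , sw⇓ (seq⇓ erase⇓ (proj₂ (P (suc j) a r)))

whileP : Prog → Prog → Prog
whileP p₀ p₁ = loop λ { zero₁ → just (erase ⨾ p₀) ; one₁ → just (erase ⨾ p₁) ; _ → nothing }

while-[]ˢ : ∀ {p₀ p₁ st} → whileP p₀ p₁ ⊢ˢ [] ∷ st ⇓[ 1 ] [] ∷ st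
while-[]ˢ = stk λ j a r → j , done refl

while-∷ˢ : ∀ {p₀ p₁ st st′ st″ m n} b {w} → (if b then p₁ else p₀) ⊢ˢ w ∷ st ⇓[ m ] st′ →
           whileP p₀ p₁ ⊢ˢ st′ ⇓[ n ] st″ → whileP p₀ p₁ ⊢ˢ (b ∷ w) ∷ st ⇓[ 2 + m + n ] st″
while-∷ˢ {p₀} {p₁} {st} {st′} {st″} {m} {n} b {w} (stk P) (stk W) = stk (go b P)
  where
  go : ∀ b → (∀ j a r → Σ ℕ λ j′ → (if b then p₁ else p₀) ⊢ mk (bl j) (encS (w ∷ st) ++ a ∷ r) ⇓[ m ] mk (bl j′) (encS st′ ++ a ∷ r)) →
       ∀ j a r → Σ ℕ λ j′ → whileP p₀ p₁ ⊢ mk (bl j) (encS ((b ∷ w) ∷ st) ++ a ∷ r) ⇓[ 2 + m + n ] mk (bl j′) (encS st″ ++ a ∷ r)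
  go false P j a r with P (suc j) a r
  ... | j′ , c with W j′ a r
  ... | j″ , d = j″ , more refl (seq⇓ erase⇓ c) d
  go true P j a r with P (suc j) a r
  ... | j′ , c with W j′ a r
  ... | j″ , d = j″ , more refl (seq⇓ erase⇓ c) d

moveCell : Sym → Maybe Prog
moveCell a = unlessBlank (goR ⨾ act (λ _ → a , left) ⨾ goL) a

-- Closes the gap of one deleted cell. On the way left every symbol is copied onto its right
-- neighbour, up to the blank before the block; the stale symbol in the first cell is then blanked.
shift : Prog
shift = goL ⨾ loop moveCell ⨾ goR ⨾ erase

shiftCost : PolyExp
shiftCost = K 1 ⊕ ((K 4 ⊗ X ⊕ K 1) ⊕ K 2)

shift⇓ : ∀ {xs} → All Solid xs → ∀ {j e r N} → length xs ≤ N →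
         shift ⊢ tape (xs ++ bl j) e r ⇓[ ⟦ shiftCost ⟧ N ] mk (bl (suc (suc (pred j)))) (xs ʳ++ r)
shift⇓ solid {j} {e} {r} {N} le with go solid e r
  where
  go : ∀ {xs} → All Solid xs → ∀ e r → Σ Sym λ y →
       loop moveCell ⊢ lk (xs ++ bl j) (e ∷ r) ⇓[ 4 * length xs + 1 ] tape (bl (pred j)) blank (y ∷ xs ʳ++ r)
  go [] e r = e , cast⇓ (lk-bl j _) refl (done refl)
  go {x ∷ xs} (s ∷ ss) e r with go ss x (x ∷ r)
  ... | y , c = y , wk (≤-reflexive (solve 1 (λ n → con 4 :+ (con 4 :* n :+ con 1) := con 4 :* (con 1 :+ n) :+ con 1) refl (length xs)))
                      (more (unlessBlank-solid _ s) (seq⇓ goR⇓ (seq⇓ (act⇓ refl) goL⇓)) c)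
... | y , c = wk (⟦⟧-mono shiftCost le) (seq⇓ goL⇓ (seq⇓ c (seq⇓ goR⇓ erase⇓)))

-- One `shift` removes one bit, the final one the separator. Each `shift` ends at the left end of
-- the stack, hence the repeated `seek k`.
delP : ℕ → Prog
delP k = seek k ⨾ loop (ifBit (shift ⨾ seek k)) ⨾ shift

delCost : ℕ → PolyExp
delCost k = seekCost k ⊕ ((X ⊗ (K 1 ⊕ (shiftCost ⊕ seekCost k)) ⊕ K 1) ⊕ shiftCost)

del⇓ : ∀ pre {w post N} → size (pre ++ w ∷ post) ≤ N → ∀ j a r → Σ ℕ λ j′ →
       delP (length pre) ⊢ mk (bl j) (encS (pre ++ w ∷ post) ++ a ∷ r) ⇓[ ⟦ delCost (length pre) ⟧ N ] mk (bl j′) (encS (pre ++ post) ++ a ∷ r)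
del⇓ pre {w} {post} {N} le j a r = suc (suc (pred (proj₁ L))) ,
  cast⇓ (cong (mk (bl j)) (trans (cong (_++ _) (encS-++ pre (w ∷ post)))
          (trans (++-assoc (encS pre) _ _) (cong (encS pre ++_) (++-assoc (encWord w) _ _)))))
        (cong (mk _) (trans (cong (_++ _) (encS-++ pre post)) (trans (++-assoc (encS pre) _ _) (sym (ʳ++-ʳ++ (encS pre))))))
    (seq⇓ (seek⇓ pre lepre)
      (seq⇓ (wk (+-monoˡ-≤ 1 (*-monoˡ-≤ (suc C) lew)) (proj₂ L))
        (cast⇓ (cong (λ z → tape z sep _) (split (proj₁ L))) refl (shift⇓ solid lerev))))
  where
  R = encS post ++ a ∷ r
  C = ⟦ shiftCost ⟧ N + ⟦ seekCost (length pre) ⟧ N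
  lepre : size pre ≤ N
  lepre = ≤-trans (≤-trans (m≤m+n _ _) (≤-reflexive (sym (size-++ pre (w ∷ post))))) le
  lew : length w ≤ N
  lew = ≤-trans (length≤size w post) (≤-trans (≤-trans (m≤n+m _ (size pre)) (≤-reflexive (sym (size-++ pre (w ∷ post))))) le)
  rev = encS pre ʳ++ []
  split : ∀ j → encS pre ʳ++ bl j ≡ rev ++ bl j
  split j = sym (rev-split (encS pre))
  solid : All Solid rev
  solid = Solid-ʳ++ (encS-solid pre) []
  lerev : length rev ≤ N
  lerev = ≤-trans (≤-reflexive (trans (length-ʳ++ (encS pre)) (+-identityʳ _))) lepre
  L : Σ ℕ λ j′ → loop (ifBit (shift ⨾ seek (length pre))) ⊢ mk (encS pre ʳ++ bl j) (encWord w ++ sep ∷ R)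
                   ⇓[ length w * suc C + 1 ] mk (encS pre ʳ++ bl j′) (sep ∷ R)
  L = go w j
    where
    go : ∀ w j → Σ ℕ λ j′ → loop (ifBit (shift ⨾ seek (length pre))) ⊢ mk (encS pre ʳ++ bl j) (encWord w ++ sep ∷ R)
                   ⇓[ length w * suc C + 1 ] mk (encS pre ʳ++ bl j′) (sep ∷ R)
    go [] j = j , done refl
    go (b ∷ w) j with go w (suc (suc (pred j)))
    ... | j′ , c = j′ , wk (≤-reflexive (cong suc (sym (+-assoc C _ 1))))
      (more (ifBit-bit _ b)
        (seq⇓ (cast⇓ (cong (λ z → tape z (bitSym b) _) (split j)) refl (shift⇓ solid lerev))
              (cast⇓ (cong (mk _) (ʳ++-ʳ++ (encS pre))) refl (seek⇓ pre lepre))) c)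

delˢ : ∀ pre {w post N} → size (pre ++ w ∷ post) ≤ N →
       delP (length pre) ⊢ˢ pre ++ w ∷ post ⇓[ ⟦ delCost (length pre) ⟧ N ] pre ++ post
delˢ pre le = stk (del⇓ pre le)

dropˢ : ∀ {w st N} → size (w ∷ st) ≤ N → delP 0 ⊢ˢ w ∷ st ⇓[ ⟦ delCost 0 ⟧ N ] st
dropˢ {w} {st} = delˢ [] {w} {st}

-- A bit is copied by overwriting it with a blank, which marks its cell, carrying it to the left end and returning.
carryBit : Bool → Prog
carryBit b = act (λ _ → blank , left) ⨾ scanL ⨾ act (λ _ → bitSym b , right) ⨾ scanR ⨾ act (λ _ → bitSym b , left)

carryBits : Sym → Maybe Prog
carryBits zero₁ = just (carryBit false)
carryBits one₁  = just (carryBit true)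
carryBits _     = nothing

carryBits-bit : ∀ b → carryBits (bitSym b) ≡ just (carryBit b)
carryBits-bit false = refl
carryBits-bit true  = refl

carryCost : PolyExp
carryCost = K 1 ⊕ (walkCost ⊕ (K 1 ⊕ (walkCost ⊕ K 1)))

bit-solid : ∀ b → Solid (bitSym b)
bit-solid false = bit0
bit-solid true  = bit1

carryBit⇓ : ∀ b {xs} → All Solid xs → ∀ {j h r N} → length xs ≤ N →
            carryBit b ⊢ tape (xs ++ bl j) h r ⇓[ ⟦ carryCost ⟧ N ] lk (xs ++ bitSym b ∷ bl (pred j)) (bitSym b ∷ r)
carryBit⇓ b {xs} solid {j} {h} {r} le =
  seq⇓ (act⇓ (moveL _ _ _)) (seq⇓ (scanL⇓ solid le) (seq⇓ (cast⇓ (lk-bl j _) refl (act⇓ (moveR _ _ _)))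
    (seq⇓ (cast⇓ (cong (mk _) (sym (rev-split xs))) (cong (λ z → mk z (blank ∷ r)) (sym (ʳ++-ʳ++ xs)))
            (scanR⇓ (Solid-ʳ++ solid []) (λ _ → refl) (≤-trans (≤-reflexive (trans (length-ʳ++ xs) (+-identityʳ _))) le)))
          (act⇓ (moveL _ _ _)))))

-- The lists left of the head are read leftwards, so `v` is the word in reverse. Its bits are taken
-- from last to first and put in front of the stack, which makes the copy grow at the far end of `D`
-- in the right order.
carryBits⇓ : ∀ v D → All Solid D → ∀ j r {N} → length v + length (sep ∷ D) ≤ N → Σ ℕ λ j′ →
             loop carryBits ⊢ lk (encWord v ++ (sep ∷ D) ++ bl j) r ⇓[ length v * suc (⟦ carryCost ⟧ N) + 1 ]
             lk (((sep ∷ D) ++ encWord v) ++ bl j′) (encWord v ʳ++ r)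
carryBits⇓ [] D solid j r le = j , cast⇓ refl (cong (λ z → lk (z ++ bl j) r) (++-identityʳ (sep ∷ D))) (done refl)
carryBits⇓ (b ∷ v) D solid j r {N} le
  with carryBits⇓ v (D ++ bitSym b ∷ []) (++⁺ solid (bit-solid b ∷ [])) (pred j) (bitSym b ∷ r) {N}
         (≤-trans (≤-reflexive (trans (cong (λ z → length v + suc z) (trans (length-++ D) (+-comm _ 1))) (+-suc _ _))) le)
... | j′ , c = j′ , wk (≤-reflexive (cong suc (sym (+-assoc (⟦ carryCost ⟧ N) _ 1))))
  (more (carryBits-bit b)
    (cast⇓ (cong (λ z → tape z _ _) (sym (++-assoc (encWord v) _ _)))
           (cong (λ z → lk z (bitSym b ∷ r)) (trans (cong (λ z → encWord v ++ sep ∷ z) (++-assoc D _ _)) (sym (++-assoc (encWord v) _ _))))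
           (carryBit⇓ b (++⁺ (encWord-solid v) (seps ∷ solid))
             (≤-trans (≤-reflexive (trans (length-++ (encWord v)) (cong (_+ length (sep ∷ D)) (length-encWord v)))) (≤-trans (n≤1+n _) le))))
    (cast⇓ refl (cong (λ z → lk (z ++ bl j′) (encWord v ʳ++ bitSym b ∷ r)) (cong (sep ∷_) (sym (++-assoc D _ _)))) c))

copyP : ℕ → Prog
copyP k = newP ⨾ seek (suc k) ⨾ skipBits ⨾ goL ⨾ loop carryBits ⨾ home

copyCost : ℕ → PolyExp
copyCost k = (K 2 ⊕ (seekCost (suc k) ⊕ (walkCost ⊕ (K 1 ⊕ ((X ⊗ (K 1 ⊕ carryCost) ⊕ K 1) ⊕ homeCost))))) ⊚ (K 1 ⊕ X)

-- The cell before the copied word holds a separator, even for an empty `pre`, because `newP` has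
-- put one there; the carrying loop stops on it.
ends-with-sep : ∀ w pre → Σ (List Sym) λ D → encS (w ∷ pre) ʳ++ [] ≡ sep ∷ D
ends-with-sep w pre = go w pre []
  where
  go : ∀ w pre l → Σ (List Sym) λ D → encS (w ∷ pre) ʳ++ l ≡ sep ∷ D
  go w [] l = encWord w ʳ++ l , ++-ʳ++ (encWord w)
  go w (v ∷ pre) l with go v pre (sep ∷ encWord w ʳ++ l)
  ... | D , eq = D , trans (++-ʳ++ (encWord w)) eq

tail-solid : ∀ {x xs} → All Solid (x ∷ xs) → All Solid xs
tail-solid (_ ∷ ss) = ss

copy⇓ : ∀ pre {w post N} → size (pre ++ w ∷ post) ≤ N → ∀ j a r → Σ ℕ λ j′ →
        copyP (length pre) ⊢ mk (bl j) (encS (pre ++ w ∷ post) ++ a ∷ r) ⇓[ ⟦ copyCost (length pre) ⟧ N ]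
          mk (bl j′) (encS (w ∷ pre ++ w ∷ post) ++ a ∷ r)
copy⇓ pre {w} {post} {N} le j a r with ends-with-sep [] pre
... | D , eqD with carryBits⇓ (reverse w) D (tail-solid (subst (All Solid) eqD (Solid-ʳ++ (encS-solid ([] ∷ pre)) []))) (pred j) (sep ∷ encS post ++ a ∷ r) {suc N} leD
  where
  leD : length (reverse w) + length (sep ∷ D) ≤ suc N
  leD = ≤-trans (≤-reflexive (trans (cong₂ _+_ (trans (length-ʳ++ w) (+-identityʳ _))
            (trans (cong length (sym eqD)) (trans (length-ʳ++ (encS ([] ∷ pre))) (+-identityʳ _)))) (+-suc _ _)))
          (s≤s (≤-trans (≤-trans (≤-reflexive (+-comm (length w) (size pre))) (+-monoʳ-≤ (size pre) (length≤size w post))) (≤-trans (≤-reflexive (sym (size-++ pre (w ∷ post)))) le)))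
... | j′ , c = suc (pred j′) ,
  seq⇓ (onTape (newˢ {pre ++ w ∷ post}) j a r .proj₂)
   (seq⇓ (cast⇓ (cong (mk (bl (pred j))) (trans (cong (λ z → sep ∷ z ++ a ∷ r) (encS-++ pre (w ∷ post))) (cong (sep ∷_) (++-assoc (encS pre) _ _)))) refl
           (seek⇓ ([] ∷ pre) {N = suc N} (s≤s lepre)))
    (seq⇓ (cast⇓ (cong (mk _) (++-assoc (encWord w) _ _)) refl (skipBits⇓ w (≤-trans lew (n≤1+n N))))
     (seq⇓ goL⇓
      (seq⇓ (cast⇓ (cong (λ z → lk z _) eqL) refl (wk (+-monoˡ-≤ 1 (*-monoˡ-≤ (suc (⟦ carryCost ⟧ (suc N))) (≤-trans (≤-reflexive (trans (length-ʳ++ w) (+-identityʳ _))) (≤-trans lew (n≤1+n N))))) c))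
        (cast⇓ refl (cong (mk _) eqR) (home⇓ solid′ leH))))))
  where
  lepre : size pre ≤ N
  lepre = ≤-trans (≤-trans (m≤m+n _ _) (≤-reflexive (sym (size-++ pre (w ∷ post))))) le
  lew : length w ≤ N
  lew = ≤-trans (length≤size w post) (≤-trans (≤-trans (m≤n+m _ (size pre)) (≤-reflexive (sym (size-++ pre (w ∷ post))))) le)
  eqL : encWord w ʳ++ encS ([] ∷ pre) ʳ++ bl (pred j) ≡ encWord (reverse w) ++ (sep ∷ D) ++ bl (pred j)
  eqL = trans (sym (rev-split (encWord w) {[]})) (cong₂ _++_ (sym (encWord-ʳ++ w []))
          (trans (sym (rev-split (encS ([] ∷ pre)) {[]})) (cong (_++ bl (pred j)) eqD)))
  solidD : All Solid (sep ∷ D)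
  solidD = subst (All Solid) eqD (Solid-ʳ++ (encS-solid ([] ∷ pre)) [])
  solid′ : All Solid ((sep ∷ D) ++ encWord (reverse w))
  solid′ = ++⁺ solidD (encWord-solid (reverse w))
  leH : length ((sep ∷ D) ++ encWord (reverse w)) ≤ suc N
  leH = ≤-trans (≤-reflexive (trans (length-++ (sep ∷ D)) (cong₂ _+_
           (trans (cong length (sym eqD)) (trans (length-ʳ++ (encS ([] ∷ pre))) (+-identityʳ _)))
           (trans (length-encWord (reverse w)) (trans (length-ʳ++ w) (+-identityʳ _))))))
         (s≤s (≤-trans (+-monoʳ-≤ (size pre) (length≤size w post)) (≤-trans (≤-reflexive (sym (size-++ pre (w ∷ post)))) le)))
  unrev : ∀ z → encWord (reverse w) ʳ++ z ≡ encWord w ++ z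
  unrev z = trans (cong (_ʳ++ z) (encWord-ʳ++ w [])) (ʳ++-ʳ++ (encWord w))
  eqR : encS (w ∷ pre ++ w ∷ post) ++ a ∷ r ≡
        ((sep ∷ D) ++ encWord (reverse w)) ʳ++ (encWord (reverse w) ʳ++ sep ∷ encS post ++ a ∷ r)
  eqR = sym (trans (++-ʳ++ (sep ∷ D)) (trans (unrev _) (trans (cong (λ z → encWord w ++ z ʳ++ (encWord (reverse w) ʳ++ sep ∷ encS post ++ a ∷ r)) (sym eqD))
          (trans (cong (encWord w ++_) (ʳ++-ʳ++ (encS ([] ∷ pre))))
          (trans (cong (λ z → encWord w ++ sep ∷ encS pre ++ z) (unrev _))
          (trans (sym (++-assoc (encWord w) _ _)) (trans (cong (λ z → (encWord w ++ sep ∷ []) ++ z) (trans (cong (encS pre ++_) (sym (++-assoc (encWord w) _ _))) (trans (sym (++-assoc (encS pre) _ _)) (cong (_++ a ∷ r) (sym (encS-++ pre (w ∷ post)))))))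
           (trans (++-assoc (encWord w) _ _) (sym (++-assoc (encWord w) _ _))))))))))

copyˢ : ∀ pre {w post N} → size (pre ++ w ∷ post) ≤ N →
        copyP (length pre) ⊢ˢ pre ++ w ∷ post ⇓[ ⟦ copyCost (length pre) ⟧ N ] w ∷ pre ++ w ∷ post
copyˢ pre le = stk (copy⇓ pre le)

castˢ : ∀ {p n st st′ u u′} → st ≡ st′ → u ≡ u′ → p ⊢ˢ st′ ⇓[ n ] u′ → p ⊢ˢ st ⇓[ n ] u
castˢ refl refl r = r

delsP : ℕ → ℕ → Prog
delsP k zero    = skip
delsP k (suc m) = delP k ⨾ delsP k m

delsCost : ℕ → ℕ → PolyExp
delsCost k zero    = K 1
delsCost k (suc m) = delCost k ⊕ delsCost k m

size-++-monoʳ : ∀ st {u v} → size u ≤ size v → size (st ++ u) ≤ size (st ++ v)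
size-++-monoʳ st {u} {v} le = subst₂ _≤_ (sym (size-++ st u)) (sym (size-++ st v)) (+-monoʳ-≤ (size st) le)

delsˢ : ∀ pre mid {post N} → size (pre ++ mid ++ post) ≤ N →
        delsP (length pre) (length mid) ⊢ˢ pre ++ mid ++ post ⇓[ ⟦ delsCost (length pre) (length mid) ⟧ N ] pre ++ post
delsˢ pre [] le = skipˢ
delsˢ pre (w ∷ mid) {post} le = seqˢ (delˢ pre {w} le) (delsˢ pre mid (≤-trans (size-++-monoʳ pre {mid ++ post} {w ∷ mid ++ post} (size-tail w (mid ++ post))) le))

-- A functional language with bounded loops and its compilation

record PT (m : ℕ) : Set where
  field
    fn       : Vec Word m → Word
    prog     : Prog
    time     : PolyExp
    space    : PolyExp
    prog-ok  : ∀ v fr {N} → size (toList v ++ fr) ≤ N →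
               prog ⊢ˢ toList v ++ fr ⇓[ ⟦ time ⟧ N ] fn v ∷ toList v ++ fr
    -- The result is bounded through the arguments alone, whereas `time` is taken at the size of the
    -- whole stack: the words below the arguments have no influence on the result, so nested calls
    -- keep polynomial bounds.
    space-ok : ∀ v {N} → size (toList v) ≤ N → suc (length (fn v)) ≤ ⟦ space ⟧ N

iteW : Word → Word → Word → Word → Word
iteW []          a b c = a
iteW (false ∷ _) a b c = b
iteW (true ∷ _)  a b c = c

tailW : Word → Word
tailW []      = []
tailW (_ ∷ w) = w

-- Terms are free of recursion; iteration enters only through `call`, as a `PT` obtained from a
-- `Loop`. Cost bounds can thus be read off the syntax.
data Tm (n : ℕ) : Set where
  var  : Fin n → Tm n
  nil  : Tm n
  cons : Bool → Tm n → Tm n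
  tail : Tm n → Tm n
  ite  : Tm n → Tm n → Tm n → Tm n → Tm n
  call : ∀ {m} → PT m → Vec (Tm n) m → Tm n

module _ {n : ℕ} where mutual
  eval : Tm n → Vec Word n → Word
  eval (var i) e       = lookup e i
  eval nil e           = []
  eval (cons b t) e    = b ∷ eval t e
  eval (tail t) e      = tailW (eval t e)
  eval (ite t a b c) e = iteW (eval t e) (eval a e) (eval b e) (eval c e)
  eval (call F ts) e   = PT.fn F (evals ts e)

  evals : ∀ {m} → Vec (Tm n) m → Vec Word n → Vec Word m
  evals [] e       = []
  evals (t ∷ ts) e = eval t e ∷ evals ts e

module _ {n : ℕ} where mutual
  tspace : Tm n → PolyExp
  tspace (var i)       = X
  tspace nil           = K 1
  tspace (cons b t)    = K 1 ⊕ tspace t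
  tspace (tail t)      = tspace t
  tspace (ite t a b c) = tspace a ⊕ tspace b ⊕ tspace c
  tspace (call F ts)   = PT.space F ⊚ sspace ts

  sspace : ∀ {m} → Vec (Tm n) m → PolyExp
  sspace []       = K 0
  sspace (t ∷ ts) = tspace t ⊕ sspace ts

lookup-split : ∀ {n} (e : Vec Word n) i → Σ (List Word) λ pre → Σ (List Word) λ post →
               toList e ≡ pre ++ lookup e i ∷ post × length pre ≡ toℕ i
lookup-split (w ∷ e) zero = [] , toList e , refl , refl
lookup-split (w ∷ e) (suc i) with lookup-split e i
... | pre , post , eq , len = w ∷ pre , post , cong (w ∷_) eq , cong suc len

size-≤-++ʳ : ∀ u v → size v ≤ size (u ++ v)
size-≤-++ʳ u v = ≤-trans (m≤n+m _ (size u)) (≤-reflexive (sym (size-++ u v)))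

size-≤-++ˡ : ∀ u v → size u ≤ size (u ++ v)
size-≤-++ˡ u v = ≤-trans (m≤m+n _ (size v)) (≤-reflexive (sym (size-++ u v)))

size-mid : ∀ u v w → size v ≤ size (u ++ v ++ w)
size-mid u v w = ≤-trans (size-≤-++ˡ v w) (size-≤-++ʳ u (v ++ w))

size-++-≤ : ∀ u v {a b} → size u ≤ a → size v ≤ b → size (u ++ v) ≤ b + a
size-++-≤ u v {a} {b} p q = ≤-trans (≤-reflexive (trans (size-++ u v) (+-comm (size u) (size v)))) (+-mono-≤ q p)

size-∷-≤ : ∀ u v {a b} → suc (length u) ≤ a → size v ≤ b → size (u ∷ v) ≤ b + a
size-∷-≤ u v {a} {b} p q = ≤-trans (≤-reflexive (trans (size-∷ u v) (+-comm (suc (length u)) (size v)))) (+-mono-≤ q p)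

module _ {n : ℕ} where mutual
  tspace-ok : ∀ (t : Tm n) e {N} → size (toList e) ≤ N → suc (length (eval t e)) ≤ ⟦ tspace t ⟧ N
  tspace-ok (var i) e le with lookup-split e i
  ... | pre , post , eq , _ = ≤-trans (≤-trans (≤-trans (m≤m+n _ (size post)) (≤-reflexive (sym (size-∷ (lookup e i) post))))
          (≤-trans (size-≤-++ʳ pre (lookup e i ∷ post)) (≤-reflexive (cong size (sym eq))))) le
  tspace-ok nil e le = ≤-refl
  tspace-ok (cons b t) e le = s≤s (tspace-ok t e le)
  tspace-ok (tail t) e le = ≤-trans (lem (eval t e)) (tspace-ok t e le)
    where
    lem : ∀ w → suc (length (tailW w)) ≤ suc (length w)
    lem [] = ≤-refl
    lem (_ ∷ w) = n≤1+n _
  tspace-ok (ite t a b c) e {N} le with eval t e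
  ... | [] = ≤-trans (tspace-ok a e le) (≤-trans (m≤m+n _ (⟦ tspace b ⟧ N)) (m≤m+n _ (⟦ tspace c ⟧ N)))
  ... | false ∷ _ = ≤-trans (tspace-ok b e le) (≤-trans (m≤n+m _ (⟦ tspace a ⟧ N)) (m≤m+n _ (⟦ tspace c ⟧ N)))
  ... | true ∷ _  = ≤-trans (tspace-ok c e le) (m≤n+m _ _)
  tspace-ok (call F ts) e le = PT.space-ok F (evals ts e) (sspace-ok ts e le)

  sspace-ok : ∀ {m} (ts : Vec (Tm n) m) e {N} → size (toList e) ≤ N → size (toList (evals ts e)) ≤ ⟦ sspace ts ⟧ N
  sspace-ok [] e le = ≤-refl
  sspace-ok (t ∷ ts) e le = ≤-trans (≤-reflexive (size-∷ (eval t e) (toList (evals ts e)))) (+-mono-≤ (tspace-ok t e le) (sspace-ok ts e le))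

-- comp t k evaluates t in the environment found below the top k words of the stack.
module _ {n : ℕ} where mutual
  comp : Tm n → ℕ → Prog
  comp (var i) k       = copyP (k + toℕ i)
  comp nil k           = newP
  comp (cons b t) k    = comp t k ⨾ pushP b
  comp (tail t) k      = comp t k ⨾ popCase skip skip skip
  comp (ite t a b c) k = comp t k ⨾ popCase (delP 0 ⨾ comp a k) (delP 0 ⨾ comp b k) (delP 0 ⨾ comp c k)
  comp (call {m} F ts) k = comps ts k ⨾ PT.prog F ⨾ delsP 1 m

  comps : ∀ {m} → Vec (Tm n) m → ℕ → Prog
  comps [] k               = skip
  -- The last argument is evaluated first, so that the first one ends on top; `m` results then lie
  -- above the environment already.
  comps {suc m} (t ∷ ts) k = comps ts k ⨾ comp t (m + k)

module _ {n : ℕ} where mutual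
  tcost : Tm n → ℕ → PolyExp
  tcost (var i) k       = copyCost (k + toℕ i)
  tcost nil k           = K 2
  tcost (cons b t) k    = tcost t k ⊕ K 2
  tcost (tail t) k      = tcost t k ⊕ K 3
  tcost (ite t a b c) k = tcost t k ⊕ (K 2 ⊕ (delCost 0 ⊚ (X ⊕ tspace t) ⊕ (tcost a k ⊕ tcost b k ⊕ tcost c k)))
  tcost (call {m} F ts) k = scost ts k ⊕ (PT.time F ⊚ (X ⊕ sspace ts) ⊕
                              delsCost 1 m ⊚ ((X ⊕ sspace ts) ⊕ PT.space F ⊚ sspace ts))

  scost : ∀ {m} → Vec (Tm n) m → ℕ → PolyExp
  scost [] k               = K 1
  scost {suc m} (t ∷ ts) k = scost ts k ⊕ (tcost t (m + k) ⊚ (X ⊕ sspace ts))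

module _ {n : ℕ} where mutual
  comp-ok : ∀ (t : Tm n) {k} e pre fr {N} → length pre ≡ k → size (pre ++ toList e ++ fr) ≤ N →
            comp t k ⊢ˢ pre ++ toList e ++ fr ⇓[ ⟦ tcost t k ⟧ N ] eval t e ∷ pre ++ toList e ++ fr
  comp-ok (var i) {k} e pre fr {N} refl le with lookup-split e i
  ... | pre′ , post , eq , len = castˢ eq′ (cong (lookup e i ∷_) eq′)
    (subst (λ l → copyP l ⊢ˢ (pre ++ pre′) ++ lookup e i ∷ post ++ fr ⇓[ ⟦ copyCost l ⟧ N ] lookup e i ∷ (pre ++ pre′) ++ lookup e i ∷ post ++ fr) (trans (length-++ pre) (cong (length pre +_) len))
      (copyˢ (pre ++ pre′) {lookup e i} {post ++ fr} (≤-trans (≤-reflexive (cong size (sym eq′))) le)))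
    where
    eq′ : pre ++ toList e ++ fr ≡ (pre ++ pre′) ++ lookup e i ∷ post ++ fr
    eq′ = trans (cong (λ z → pre ++ z ++ fr) eq) (trans (cong (pre ++_) (++-assoc pre′ _ fr)) (sym (++-assoc pre pre′ _)))
  comp-ok nil e pre fr len le = newˢ {pre ++ toList e ++ fr}
  comp-ok (cons b t) e pre fr len le = seqˢ (comp-ok t e pre fr len le) (pushˢ b {eval t e})
  comp-ok (tail t) e pre fr len le = seqˢ (comp-ok t e pre fr len le) (lem (eval t e))
    where
    lem : ∀ w → popCase skip skip skip ⊢ˢ w ∷ pre ++ toList e ++ fr ⇓[ 3 ] tailW w ∷ pre ++ toList e ++ fr
    lem [] = popCase-[]ˢ {skip} {skip} {skip} {pre ++ toList e ++ fr} (skipˢ {[] ∷ pre ++ toList e ++ fr})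
    lem (false ∷ w) = popCase-∷ˢ {skip} {skip} {skip} {pre ++ toList e ++ fr} false {w} (skipˢ {w ∷ pre ++ toList e ++ fr})
    lem (true ∷ w) = popCase-∷ˢ {skip} {skip} {skip} {pre ++ toList e ++ fr} true {w} (skipˢ {w ∷ pre ++ toList e ++ fr})
  comp-ok (ite t a b c) {k} e pre fr {N} len le = seqˢ (comp-ok t e pre fr len le) (lem (eval t e) (tspace-ok t e leE))
    where
    st = pre ++ toList e ++ fr
    leE : size (toList e) ≤ N
    leE = ≤-trans (size-mid pre (toList e) fr) le
    D = ⟦ delCost 0 ⟧ (N + ⟦ tspace t ⟧ N)
    A = ⟦ tcost a k ⟧ N
    B = ⟦ tcost b k ⟧ N
    C = ⟦ tcost c k ⟧ N
    branch : ∀ (t′ : Tm n) w → suc (length w) ≤ ⟦ tspace t ⟧ N → ⟦ tcost t′ k ⟧ N ≤ A + B + C →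
             delP 0 ⨾ comp t′ k ⊢ˢ w ∷ st ⇓[ D + (A + B + C) ] eval t′ e ∷ st
    branch t′ w lw lc = seqˢ (dropˢ {w} {st} (size-∷-≤ w st lw le)) (wkˢ lc (comp-ok t′ e pre fr len le))
    lem : ∀ w → suc (length w) ≤ ⟦ tspace t ⟧ N → popCase (delP 0 ⨾ comp a k) (delP 0 ⨾ comp b k) (delP 0 ⨾ comp c k) ⊢ˢ w ∷ st
            ⇓[ 2 + (D + (A + B + C)) ] iteW w (eval a e) (eval b e) (eval c e) ∷ st
    lem [] lw = popCase-[]ˢ {st = st} (branch a [] lw (≤-trans (m≤m+n A B) (m≤m+n _ C)))
    lem (false ∷ w) lw = popCase-∷ˢ {st = st} false {w} (branch b w (≤-trans (n≤1+n _) lw) (≤-trans (m≤n+m B A) (m≤m+n _ C)))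
    lem (true ∷ w) lw  = popCase-∷ˢ {st = st} true {w} (branch c w (≤-trans (n≤1+n _) lw) (m≤n+m C _))
  comp-ok (call {m} F ts) {k} e pre fr {N} len le =
    seqˢ (comps-ok ts e pre fr len le)
      (seqˢ (PT.prog-ok F v st leV)
        (subst (λ l → delsP 1 l ⊢ˢ r ∷ toList v ++ st ⇓[ ⟦ delsCost 1 l ⟧ _ ] r ∷ st) (length-toList v)
          (delsˢ (r ∷ []) (toList v) {st} (size-∷-≤ r (toList v ++ st) (PT.space-ok F v leS) leV))))
    where
    st = pre ++ toList e ++ fr
    v = evals ts e
    r = PT.fn F v
    leS : size (toList v) ≤ ⟦ sspace ts ⟧ N
    leS = sspace-ok ts e (≤-trans (size-mid pre (toList e) fr) le)
    leV : size (toList v ++ st) ≤ N + ⟦ sspace ts ⟧ N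
    leV = size-++-≤ (toList v) st leS le

  comps-ok : ∀ {m} (ts : Vec (Tm n) m) {k} e pre fr {N} → length pre ≡ k → size (pre ++ toList e ++ fr) ≤ N →
             comps ts k ⊢ˢ pre ++ toList e ++ fr ⇓[ ⟦ scost ts k ⟧ N ] toList (evals ts e) ++ pre ++ toList e ++ fr
  comps-ok [] e pre fr len le = skipˢ {pre ++ toList e ++ fr}
  comps-ok (t ∷ ts) {k} e pre fr {N} len le =
    seqˢ (comps-ok ts e pre fr len le)
      (castˢ (sym assoc) (cong (eval t e ∷_) (sym assoc))
        (comp-ok t e (toList (evals ts e) ++ pre) fr
          (trans (length-++ (toList (evals ts e))) (cong₂ _+_ (length-toList (evals ts e)) len))
          (≤-trans (≤-reflexive (cong size assoc))
            (size-++-≤ (toList (evals ts e)) (pre ++ toList e ++ fr) (sspace-ok ts e (≤-trans (size-mid pre (toList e) fr) le)) le))))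
    where
    assoc = ++-assoc (toList (evals ts e)) pre (toList e ++ fr)

ptime : ∀ {n} → Tm n → PT n
ptime t = record
  { fn = eval t ; prog = comp t 0 ; time = tcost t 0 ; space = tspace t
  ; prog-ok = λ v fr le → comp-ok t v [] fr refl le ; space-ok = tspace-ok t }

respec : ∀ {n} (F : PT n) (g : Vec Word n → Word) → (∀ v → PT.fn F v ≡ g v) → PT n
respec F g eq = record
  { fn = g ; prog = PT.prog F ; time = PT.time F ; space = PT.space F
  ; prog-ok = λ v fr le → castˢ refl (cong (_∷ toList v ++ fr) (sym (eq v))) (PT.prog-ok F v fr le)
  ; space-ok = λ v le → ≤-trans (≤-reflexive (cong (λ z → suc (length z)) (sym (eq v)))) (PT.space-ok F v le) }

size-Pointwise : ∀ {m G} {s s′ : Vec Word m} → Pointwise (λ w w′ → length w′ ≤ length w + G) s s′ →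
                 size (toList s′) ≤ size (toList s) + m * G
size-Pointwise [] = z≤n
size-Pointwise {suc m} {G} {w ∷ s} {w′ ∷ s′} (p ∷ ps) = begin
  size (w′ ∷ toList s′)                        ≡⟨ size-∷ w′ (toList s′) ⟩
  suc (length w′) + size (toList s′)           ≤⟨ s≤s (+-mono-≤ p (size-Pointwise ps)) ⟩
  suc (length w + G + (size (toList s) + m * G))
    ≡⟨ cong suc (solve 4 (λ a c b d → (a :+ c) :+ (b :+ d) := (a :+ b) :+ (c :+ d)) refl (length w) G (size (toList s)) (m * G)) ⟩
  suc (length w) + size (toList s) + (G + m * G) ≡⟨ cong (_+ (G + m * G)) (sym (size-∷ w (toList s))) ⟩
  size (w ∷ toList s) + (G + m * G)            ∎
  where open ≤-Reasoning

-- Iteration over the bits of the first parameter. A step may lengthen each state word by an amount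
-- that depends on the parameters but not on the state, so the state remains polynomial after a
-- linear number of steps. Growth by a factor would permit repeated doubling.
record Loop (m n : ℕ) : Set where
  field
    init      : Vec (Tm (suc n)) m
    step      : Bool → Vec (Tm (m + suc n)) m
    out       : Tm (m + suc n)
    growth₁   : PolyExp
    growth₁-ok : ∀ b s (e : Vec Word (suc n)) {N} → size (toList e) ≤ N →
                Pointwise (λ w w′ → length w′ ≤ length w + ⟦ growth₁ ⟧ N) s (evals (step b) (s Vec.++ e))

  growth : PolyExp
  growth = K m ⊗ growth₁

  growth-ok : ∀ b s (e : Vec Word (suc n)) {N} → size (toList e) ≤ N →
              size (toList (evals (step b) (s Vec.++ e))) ≤ size (toList s) + ⟦ growth ⟧ N
  growth-ok b s e le = size-Pointwise (growth₁-ok b s e le)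

  iter : Word → Vec Word m → Vec Word (suc n) → Vec Word m
  iter [] s e      = s
  iter (b ∷ w) s e = iter w (evals (step b) (s Vec.++ e)) e

module _ {m n : ℕ} (L : Loop m n) where
  open Loop L

  -- The new state is built above the old one, the rest of the counter is copied on top of it, and
  -- the old counter and state, `suc m` words together, are deleted underneath.
  body : Bool → Prog
  body b = comps (step b) 1 ⨾ copyP m ⨾ delsP (suc m) (suc m)

  stateSize bodySize : PolyExp
  stateSize = sspace init ⊕ X ⊗ growth
  bodySize  = (X ⊕ stateSize) ⊕ X

  bodyCost : Bool → PolyExp
  bodyCost b = scost (step b) 1 ⊚ bodySize ⊕ (copyCost m ⊚ (bodySize ⊕ stateSize) ⊕
                 delsCost (suc m) (suc m) ⊚ ((bodySize ⊕ stateSize) ⊕ X))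

  body-ok : ∀ b {w} s e fr {N} → size (toList e ++ fr) ≤ N → suc (length w) ≤ N → size (toList s) ≤ ⟦ stateSize ⟧ N →
            size (toList (evals (step b) (s Vec.++ e))) ≤ ⟦ stateSize ⟧ N →
            body b ⊢ˢ w ∷ toList s ++ toList e ++ fr ⇓[ ⟦ bodyCost b ⟧ N ]
              w ∷ toList (evals (step b) (s Vec.++ e)) ++ toList e ++ fr
  body-ok b {w} s e fr {N} leE leW leS leS′ =
    seqˢ (castˢ stEq (cong (toList s′ ++_) stEq)
           (comps-ok (step b) (s Vec.++ e) (w ∷ []) fr refl (≤-trans (≤-reflexive (cong size (sym stEq))) le₁)))
      (seqˢ (subst (λ l → copyP l ⊢ˢ toList s′ ++ st ⇓[ ⟦ copyCost l ⟧ _ ] w ∷ toList s′ ++ st) (length-toList s′)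
              (copyˢ (toList s′) {w} le₂))
        (subst₂ (λ l l′ → delsP (suc l) (suc l′) ⊢ˢ w ∷ toList s′ ++ st ⇓[ ⟦ delsCost (suc l) (suc l′) ⟧ _ ] w ∷ toList s′ ++ toList e ++ fr)
           (length-toList s′) (length-toList s)
           (delsˢ (w ∷ toList s′) (w ∷ toList s) (size-∷-≤ w (toList s′ ++ st) leW le₂))))
    where
    s′ = evals (step b) (s Vec.++ e)
    st = w ∷ toList s ++ toList e ++ fr
    stEq : st ≡ w ∷ toList (s Vec.++ e) ++ fr
    stEq = cong (w ∷_) (trans (sym (++-assoc (toList s) _ fr)) (cong (_++ fr) (sym (toList-++ s e))))
    le₁ : size st ≤ ⟦ bodySize ⟧ N
    le₁ = size-∷-≤ w (toList s ++ toList e ++ fr) leW (size-++-≤ (toList s) (toList e ++ fr) leS leE)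
    le₂ : size (toList s′ ++ st) ≤ ⟦ bodySize ⊕ stateSize ⟧ N
    le₂ = size-++-≤ (toList s′) st leS′ le₁

  loopCost : PolyExp
  loopCost = X ⊗ (K 2 ⊕ (bodyCost false ⊕ bodyCost true)) ⊕ K 1

  -- The last hypothesis is a budget, preserved by each iteration: the present size of the state
  -- plus all that the remaining iterations may add.
  loop-ok : ∀ w s e fr {N} → size (toList e ++ fr) ≤ N → length w < N →
            size (toList s) + length w * ⟦ growth ⟧ N ≤ ⟦ stateSize ⟧ N →
            whileP (body false) (body true) ⊢ˢ w ∷ toList s ++ toList e ++ fr
              ⇓[ length w * (2 + (⟦ bodyCost false ⟧ N + ⟦ bodyCost true ⟧ N)) + 1 ] [] ∷ toList (iter w s e) ++ toList e ++ fr
  loop-ok [] s e fr leE leW leS = while-[]ˢ {body false} {body true} {toList s ++ toList e ++ fr}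
  loop-ok (b ∷ w) s e fr {N} leE leW leS =
    wkˢ (≤-trans (+-monoˡ-≤ _ (s≤s (s≤s (le-cost b)))) (≤-reflexive (sym (+-assoc _ (length w * _) 1))))
      (while-∷ˢ {body false} {body true} {toList s ++ toList e ++ fr} b {w} (sel b {w ∷ toList s ++ toList e ++ fr} {⟦ bodyCost b ⟧ N} {w ∷ toList s′ ++ toList e ++ fr} (body-ok b {w} s e fr leE (≤-trans (n≤1+n _) leW)
                     (≤-trans (m≤m+n _ _) leS) (≤-trans (m≤m+n _ _) leS′)))
        (loop-ok w s′ e fr leE (≤-trans (n≤1+n _) leW) leS′))
    where
    s′ = evals (step b) (s Vec.++ e)
    sel : ∀ b {st n st′} → body b ⊢ˢ st ⇓[ n ] st′ → (if b then body true else body false) ⊢ˢ st ⇓[ n ] st′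
    sel false r = r
    sel true r  = r
    le-cost : ∀ b → ⟦ bodyCost b ⟧ N ≤ ⟦ bodyCost false ⟧ N + ⟦ bodyCost true ⟧ N
    le-cost false = m≤m+n (⟦ bodyCost false ⟧ N) (⟦ bodyCost true ⟧ N)
    le-cost true  = m≤n+m (⟦ bodyCost true ⟧ N) (⟦ bodyCost false ⟧ N)
    leS′ : size (toList s′) + length w * ⟦ growth ⟧ N ≤ ⟦ stateSize ⟧ N
    leS′ = ≤-trans (+-monoˡ-≤ _ (growth-ok b s e (≤-trans (size-≤-++ˡ (toList e) fr) leE)))
             (≤-trans (≤-reflexive (+-assoc (size (toList s)) _ _)) leS)

  loopProg : Prog
  loopProg = comps init 0 ⨾ copyP m ⨾ whileP (body false) (body true) ⨾ delP 0 ⨾ comp out 0 ⨾ delsP 1 m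

  loopTime : PolyExp
  loopTime = scost init 0 ⊕ (copyCost m ⊚ (X ⊕ stateSize) ⊕ (loopCost ⊕ (delCost 0 ⊚ bodySize ⊕
               (tcost out 0 ⊚ (X ⊕ stateSize) ⊕ delsCost 1 m ⊚ ((X ⊕ stateSize) ⊕ tspace out ⊚ (X ⊕ stateSize))))))

  loopFn : Vec Word (suc n) → Word
  loopFn e = eval out (iter (Vec.head e) (evals init e) e Vec.++ e)

  iter-size : ∀ w s e {N S} → size (toList e) ≤ N → size (toList s) + length w * ⟦ growth ⟧ N ≤ S → size (toList (iter w s e)) ≤ S
  iter-size [] s e le leS = ≤-trans (m≤m+n _ _) leS
  iter-size (b ∷ w) s e le leS = iter-size w (evals (step b) (s Vec.++ e)) e le (≤-trans (+-monoˡ-≤ _ (growth-ok b s e le))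
           (≤-trans (≤-reflexive (+-assoc (size (toList s)) _ _)) leS))

  module _ (w : Word) (ps : Vec Word n) where
    private
      e : Vec Word (suc n)
      e = w ∷ ps
      E : List Word
      E = w ∷ toList ps
      s₀ s₁ : Vec Word m
      s₀ = evals init e
      s₁ = iter w s₀ e
      r : Word
      r = loopFn e

    module _ {N : ℕ} (le : size E ≤ N) where
      le-head : suc (length w) ≤ N
      le-head = ≤-trans (≤-trans (m≤m+n _ (size (toList ps))) (≤-reflexive (sym (size-∷ w (toList ps))))) le
      le-init : size (toList s₀) + length w * ⟦ growth ⟧ N ≤ ⟦ stateSize ⟧ N
      le-init = +-mono-≤ (sspace-ok init e le) (*-monoˡ-≤ (⟦ growth ⟧ N) (≤-trans (n≤1+n _) le-head))
      le-fin : size (toList s₁) ≤ ⟦ stateSize ⟧ N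
      le-fin = iter-size w s₀ e le le-init
      le-out : size (toList (s₁ Vec.++ e)) ≤ ⟦ X ⊕ stateSize ⟧ N
      le-out = ≤-trans (≤-reflexive (cong size (toList-++ s₁ e))) (size-++-≤ (toList s₁) E le-fin le)
      le-res : suc (length r) ≤ ⟦ tspace out ⊚ (X ⊕ stateSize) ⟧ N
      le-res = tspace-ok out (s₁ Vec.++ e) le-out

    module _ (fr : List Word) {N : ℕ} (le : size (E ++ fr) ≤ N) where
      private
        leE : size E ≤ N
        leE = ≤-trans (size-≤-++ˡ E fr) le
        leF : size (toList s₁ ++ E ++ fr) ≤ ⟦ X ⊕ stateSize ⟧ N
        leF = size-++-≤ (toList s₁) (E ++ fr) (le-fin leE) le

      phase₁ : comps init 0 ⊢ˢ E ++ fr ⇓[ ⟦ scost init 0 ⟧ N ] toList s₀ ++ E ++ fr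
      phase₁ = comps-ok init e [] fr refl le

      phase₂ : copyP m ⊢ˢ toList s₀ ++ E ++ fr ⇓[ ⟦ copyCost m ⊚ (X ⊕ stateSize) ⟧ N ] w ∷ toList s₀ ++ E ++ fr
      phase₂ = subst (λ l → copyP l ⊢ˢ toList s₀ ++ E ++ fr ⇓[ ⟦ copyCost l ⟧ (⟦ X ⊕ stateSize ⟧ N) ] w ∷ toList s₀ ++ E ++ fr) (length-toList s₀)
              (copyˢ (toList s₀) {w} {toList ps ++ fr} (size-++-≤ (toList s₀) (E ++ fr) (≤-trans (m≤m+n _ _) (le-init leE)) le))

      phase₃ : whileP (body false) (body true) ⊢ˢ w ∷ toList s₀ ++ E ++ fr ⇓[ ⟦ loopCost ⟧ N ] [] ∷ toList s₁ ++ E ++ fr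
      phase₃ = wkˢ (+-monoˡ-≤ 1 (*-monoˡ-≤ (⟦ K 2 ⊕ (bodyCost false ⊕ bodyCost true) ⟧ N) (≤-trans (n≤1+n (length w)) (le-head leE))))
                 (loop-ok w s₀ e fr le (le-head leE) (le-init leE))

      phase₄ : delP 0 ⊢ˢ [] ∷ toList s₁ ++ E ++ fr ⇓[ ⟦ delCost 0 ⊚ bodySize ⟧ N ] toList s₁ ++ E ++ fr
      phase₄ = dropˢ {[]} {toList s₁ ++ E ++ fr} (size-∷-≤ [] (toList s₁ ++ E ++ fr) (≤-trans (s≤s z≤n) (le-head leE)) leF)

      phase₅ : comp out 0 ⊢ˢ toList s₁ ++ E ++ fr ⇓[ ⟦ tcost out 0 ⊚ (X ⊕ stateSize) ⟧ N ] r ∷ toList s₁ ++ E ++ fr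
      phase₅ = castˢ outEq (cong (r ∷_) outEq) (comp-ok out (s₁ Vec.++ e) [] fr refl (≤-trans (≤-reflexive (cong size (sym outEq))) leF))
        where
        outEq : toList s₁ ++ E ++ fr ≡ toList (s₁ Vec.++ e) ++ fr
        outEq = trans (sym (++-assoc (toList s₁) E fr)) (cong (_++ fr) (sym (toList-++ s₁ e)))

      phase₆ : delsP 1 m ⊢ˢ r ∷ toList s₁ ++ E ++ fr ⇓[ ⟦ delsCost 1 m ⊚ ((X ⊕ stateSize) ⊕ tspace out ⊚ (X ⊕ stateSize)) ⟧ N ] r ∷ E ++ fr
      phase₆ = subst (λ l → delsP 1 l ⊢ˢ r ∷ toList s₁ ++ E ++ fr ⇓[ ⟦ delsCost 1 l ⊚ ((X ⊕ stateSize) ⊕ tspace out ⊚ (X ⊕ stateSize)) ⟧ N ] r ∷ E ++ fr)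
                 (length-toList s₁)
                 (delsˢ (r ∷ []) (toList s₁) {E ++ fr} (size-∷-≤ r (toList s₁ ++ E ++ fr) (le-res leE) leF))

      loopProg-ok : loopProg ⊢ˢ E ++ fr ⇓[ ⟦ loopTime ⟧ N ] r ∷ E ++ fr
      loopProg-ok = seqˢ phase₁ (seqˢ phase₂ (seqˢ phase₃ (seqˢ phase₄ (seqˢ phase₅ phase₆))))

  loopPT : PT (suc n)
  loopPT = record
    { fn       = loopFn
    ; prog     = loopProg
    ; time     = loopTime
    ; space    = tspace out ⊚ (X ⊕ stateSize)
    ; prog-ok  = λ { (w ∷ ps) fr le → loopProg-ok w ps fr le }
    ; space-ok = λ { (w ∷ ps) le → le-res w ps le }
    }

-- From stack programs to Turing machines

-- The input lacks the separator that terminates the last word of a stack. The step to the right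
-- after writing it creates the blank cell that serves as the tape beyond the stack.
initP : Prog
initP = scanR ⨾ act (λ _ → sep , right) ⨾ goL ⨾ home

initCost : PolyExp
initCost = walkCost ⊕ (K 1 ⊕ (K 1 ⊕ homeCost ⊚ (K 1 ⊕ X)))

encode-solid : ∀ w ws → encode (w ∷ ws) ++ sep ∷ [] ≡ encS (w ∷ ws)
encode-solid w [] = refl
encode-solid w (v ∷ ws) = trans (++-assoc (encWord w) _ _) (cong (λ z → encWord w ++ sep ∷ z) (encode-solid v ws))

initTape-mk : ∀ ws → initTape ws ≡ mk [] (encode ws)
initTape-mk ws with encode ws
... | []    = refl
... | _ ∷ _ = refl

readOut-mk : ∀ w {l r} → readOut (mk l (encWord w ++ sep ∷ r)) ≡ w
readOut-mk [] = refl
readOut-mk (b ∷ w) = go (b ∷ w)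
  where
  go : ∀ w {r} → readSyms (encWord w ++ sep ∷ r) ≡ w
  go [] = refl
  go (false ∷ w) = cong (false ∷_) (go w)
  go (true ∷ w)  = cong (true ∷_) (go w)

init⇓ : ∀ w ws → initP ⊢ initTape (w ∷ ws) ⇓[ ⟦ initCost ⟧ (length (encode (w ∷ ws))) ] mk (bl 1) (encS (w ∷ ws) ++ blank ∷ [])
init⇓ w ws = cast⇓ (trans (initTape-mk (w ∷ ws)) (cong (mk []) (sym (++-identityʳ _)))) (cong (mk (bl 1)) eq)
  (seq⇓ (scanR⇓ solid (λ _ → refl) ≤-refl) (seq⇓ (act⇓ refl) (seq⇓ goL⇓
    (cast⇓ (cong (λ z → lk (sep ∷ z) (blank ∷ [])) (sym (++-identityʳ _))) refl
      (home⇓ {sep ∷ xs ʳ++ []} (seps ∷ Solid-ʳ++ solid []) {0} (s≤s (≤-reflexive (trans (length-ʳ++ xs) (+-identityʳ _)))))))))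
  where
  xs = encode (w ∷ ws)
  solid : All Solid xs
  solid = ++⁻ˡ xs (subst (All Solid) (sym (encode-solid w ws)) (encS-solid (w ∷ ws)))
  eq : encS (w ∷ ws) ++ blank ∷ [] ≡ (xs ʳ++ []) ʳ++ sep ∷ blank ∷ []
  eq = trans (cong (_++ blank ∷ []) (sym (encode-solid w ws))) (trans (++-assoc xs _ _) (sym (ʳ++-ʳ++ xs)))

PT-result : ∀ {m} (F : PT (suc m)) (v : Vec Word (suc m)) {fuel} →
            ⟦ initCost ⊕ PT.time F ⊚ (K 1 ⊕ X) ⟧ (length (encode (toList v))) ≤ fuel →
            result (toTM (initP ⨾ PT.prog F)) fuel (toList v) ≡ just (PT.fn F v)
PT-result F (w ∷ ws) {fuel} bound = trans
  (cong (Maybe.map readOut) (toTM-correct (initP ⨾ PT.prog F) (wk bound (seq⇓ (init⇓ w (toList ws)) F⇓))))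
  (cong just (trans (cong (λ z → readOut (mk (bl j) z)) (++-assoc (encWord r) _ _)) (readOut-mk r)))
  where
  r = PT.fn F (w ∷ ws)
  N = suc (length (encode (w ∷ toList ws)))
  leN : size ((w ∷ toList ws) ++ []) ≤ N
  leN = ≤-reflexive (trans (cong size (++-identityʳ (w ∷ toList ws))) (trans (cong length (sym (encode-solid w (toList ws))))
          (trans (length-++ (encode (w ∷ toList ws))) (+-comm _ 1))))
  run-F = onTape (PT.prog-ok F (w ∷ ws) [] leN) 1 blank []
  j = proj₁ run-F
  F⇓ : PT.prog F ⊢ mk (bl 1) (encS (w ∷ toList ws) ++ blank ∷ []) ⇓[ ⟦ PT.time F ⟧ N ]
         mk (bl j) (encS (r ∷ (w ∷ toList ws) ++ []) ++ blank ∷ [])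
  F⇓ = cast⇓ (cong (λ z → mk (bl 1) (encS z ++ blank ∷ [])) (sym (++-identityʳ (w ∷ toList ws)))) refl (proj₂ run-F)

PT⇒PolyTime : ∀ {m} (F : PT (suc m)) {A : Set} {args : A → List Word} {g : A → Word} (v : A → Vec Word (suc m)) →
              (∀ a → toList (v a) ≡ args a) → (∀ a → PT.fn F (v a) ≡ g a) → PolyTimeComputable args g
PT⇒PolyTime F v argsEq gEq =
  toTM (initP ⨾ PT.prog F) , proj₁ B , proj₁ (proj₂ B) , λ a →
    trans (cong (λ ws → result (toTM (initP ⨾ PT.prog F)) (timeBound (proj₁ B) (proj₁ (proj₂ B)) (length (encode ws))) ws) (sym (argsEq a)))
      (trans (PT-result F (v a) (proj₂ (proj₂ B) (length (encode (toList (v a)))))) (cong just (gEq a)))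
  where
  B = ⟦⟧-≤-timeBound (initCost ⊕ PT.time F ⊚ (K 1 ⊕ X))

-- Basic functions on words, written in the language

x₀ : ∀ {n} → Tm (1 + n)
x₀ = var zero
x₁ : ∀ {n} → Tm (2 + n)
x₁ = var (suc zero)
x₂ : ∀ {n} → Tm (3 + n)
x₂ = var (suc (suc zero))

trueT falseT : ∀ {n} → Tm n
trueT  = cons true nil
falseT = cons false nil

+0-≤ : ∀ n → n ≤ n + 0
+0-≤ n = m≤m+n n 0

suc-≤ : ∀ n → suc n ≤ n + 1
suc-≤ n = ≤-reflexive (+-comm 1 n)

length-tailW : ∀ w → length (tailW w) ≤ length w
length-tailW []      = z≤n
length-tailW (_ ∷ w) = n≤1+n _

iteW-length : ∀ w {a b c B} → length a ≤ B → length b ≤ B → length c ≤ B → length (iteW w a b c) ≤ B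
iteW-length []          p q r = p
iteW-length (false ∷ _) p q r = q
iteW-length (true ∷ _)  p q r = r

-- Loops read words from the front and extend their results at the front, so results come out
-- reversed. This loop is the remedy in the later definitions.
revAppLoop : Loop 1 1
revAppLoop = record
  { init = x₁ ∷ [] ; step = λ b → cons b x₀ ∷ [] ; out = x₀ ; growth₁ = K 1
  ; growth₁-ok = λ { b (s ∷ []) e le → suc-≤ (length s) ∷ [] } }

revAppF : Vec Word 2 → Word
revAppF (u ∷ v ∷ []) = u ʳ++ v

revApp : PT 2
revApp = respec (loopPT revAppLoop) revAppF λ { e@(u ∷ v ∷ []) → go u v e }
  where
  go : ∀ u v e → eval {3} x₀ (Loop.iter revAppLoop u (v ∷ []) e Vec.++ e) ≡ u ʳ++ v
  go [] v e = refl
  go (b ∷ u) v e = go u (b ∷ v) e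

appendF : Vec Word 2 → Word
appendF (u ∷ v ∷ []) = u ++ v

append : PT 2
append = respec (ptime (call revApp (call revApp (x₀ ∷ nil ∷ []) ∷ x₁ ∷ []))) appendF λ { (u ∷ v ∷ []) → ʳ++-ʳ++ u }

dropLoop : Loop 1 1
dropLoop = record
  { init = x₁ ∷ [] ; step = λ b → tail x₀ ∷ [] ; out = x₀ ; growth₁ = K 0
  ; growth₁-ok = λ { b (s ∷ []) e le → ≤-trans (length-tailW s) (+0-≤ _) ∷ [] } }

dropF : Vec Word 2 → Word
dropF (k ∷ s ∷ []) = drop (length k) s

drop-[] : ∀ n → drop n [] ≡ ([] {A = Bool})
drop-[] zero    = refl
drop-[] (suc n) = refl

dropPT : PT 2
dropPT = respec (loopPT dropLoop) dropF λ { e@(k ∷ s ∷ []) → go k s e }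
  where
  go : ∀ k s e → eval {3} x₀ (Loop.iter dropLoop k (s ∷ []) e Vec.++ e) ≡ drop (length k) s
  go [] s e = refl
  go (b ∷ k) [] e = trans (go k [] e) (drop-[] (length k))
  go (b ∷ k) (c ∷ s) e = go k s e

takeLoop : Loop 2 1
takeLoop = record
  { init = nil ∷ x₁ ∷ [] ; step = λ b → ite x₁ x₀ (cons false x₀) (cons true x₀) ∷ tail x₁ ∷ []
  ; out = call revApp (x₀ ∷ nil ∷ []) ; growth₁ = K 1
  ; growth₁-ok = λ { b (a ∷ s ∷ []) e le → 
      iteW-length s (m≤m+n _ 1) (suc-≤ (length a)) (suc-≤ (length a)) ∷
      ≤-trans (length-tailW s) (m≤m+n _ 1) ∷ [] } }

takeF : Vec Word 2 → Word
takeF (k ∷ s ∷ []) = take (length k) s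

takePT : PT 2
takePT = respec (loopPT takeLoop) takeF λ { e@(k ∷ s ∷ []) → go k [] s e }
  where
  go : ∀ k a s e → eval (Loop.out takeLoop) (Loop.iter takeLoop k (a ∷ s ∷ []) e Vec.++ e) ≡ a ʳ++ take (length k) s
  go [] a s e = refl
  go (b ∷ k) a [] e = trans (go k a [] e) (cong (a ʳ++_) (take-[] (length k)))
    where
    take-[] : ∀ n → take n [] ≡ ([] {A = Bool})
    take-[] zero    = refl
    take-[] (suc n) = refl
  go (b ∷ k) a (false ∷ s) e = go k (false ∷ a) s e
  go (b ∷ k) a (true ∷ s) e  = go k (true ∷ a) s e

eqB : Bool → Bool → Bool
eqB false b = not b
eqB true  b = b

eqW : Word → Word → Bool
eqW []      []      = true
eqW []      (_ ∷ _) = false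
eqW (_ ∷ _) []      = false
eqW (a ∷ u) (b ∷ v) = eqB a b ∧ eqW u v

-- State: the rest of the second word, then the verdict so far. A second word that is too long is
-- noticed only by `out`, through a nonempty rest.
eqLoop : Loop 2 1
eqLoop = record
  { init = x₁ ∷ trueT ∷ []
  ; step = λ b → tail x₀ ∷ ite x₀ falseT (if b then falseT else x₁) (if b then x₁ else falseT) ∷ []
  ; out = ite x₀ x₁ falseT falseT ; growth₁ = K 1
  ; growth₁-ok = λ { b (v ∷ f ∷ []) e le → ≤-trans (length-tailW v) (m≤m+n _ 1) ∷ le-flag b v f e ∷ [] } }
  where
  le-flag : ∀ b v f (e : Vec Word 2) →
            length (iteW v (false ∷ []) (eval (if b then falseT else x₁) (v ∷ f ∷ e)) (eval (if b then x₁ else falseT) (v ∷ f ∷ e))) ≤ length f + 1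
  le-flag false v f e = iteW-length v (m≤n+m 1 _) (m≤m+n _ 1) (m≤n+m 1 _)
  le-flag true  v f e = iteW-length v (m≤n+m 1 _) (m≤n+m 1 _) (m≤m+n _ 1)

eqF : Vec Word 2 → Word
eqF (u ∷ v ∷ []) = boolWord (eqW u v)

eqPT : PT 2
eqPT = respec (loopPT eqLoop) eqF λ { e@(u ∷ v ∷ []) → go u v true e }
  where
  result-eq : ∀ u v f e → Word
  result-eq u v f e = eval (Loop.out eqLoop) (Loop.iter eqLoop u (v ∷ boolWord f ∷ []) e Vec.++ e)
  go-false : ∀ u v e → result-eq u v false e ≡ boolWord false
  go-false [] [] e = refl
  go-false [] (false ∷ v) e = refl
  go-false [] (true ∷ v) e = refl
  go-false (b ∷ u) [] e = go-false u [] e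
  go-false (false ∷ u) (false ∷ v) e = go-false u v e
  go-false (false ∷ u) (true ∷ v) e = go-false u v e
  go-false (true ∷ u) (false ∷ v) e = go-false u v e
  go-false (true ∷ u) (true ∷ v) e = go-false u v e
  go : ∀ u v f e → result-eq u v f e ≡ boolWord (f ∧ eqW u v)
  go u v false e = go-false u v e
  go [] [] true e = refl
  go [] (false ∷ v) true e = refl
  go [] (true ∷ v) true e = refl
  go (b ∷ u) [] true e = go-false u [] e
  go (false ∷ u) (false ∷ v) true e = go u v true e
  go (false ∷ u) (true ∷ v) true e = go-false u v e
  go (true ∷ u) (false ∷ v) true e = go-false u v e
  go (true ∷ u) (true ∷ v) true e = go u v true e

allOnes : Word → Bool
allOnes []      = true
allOnes (b ∷ w) = b ∧ allOnes w

onesLoop : Loop 1 0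
onesLoop = record
  { init = trueT ∷ [] ; step = λ b → (if b then x₀ else falseT) ∷ [] ; out = x₀ ; growth₁ = K 1
  ; growth₁-ok = λ { false (f ∷ []) e le → m≤n+m 1 _ ∷ []
                  ; true (f ∷ []) e le → m≤m+n _ 1 ∷ [] } }

allOnesF : Vec Word 1 → Word
allOnesF (w ∷ []) = boolWord (allOnes w)

allOnesPT : PT 1
allOnesPT = respec (loopPT onesLoop) allOnesF λ { e@(w ∷ []) → go w true e }
  where
  go-false : ∀ w e → eval {2} x₀ (Loop.iter onesLoop w (boolWord false ∷ []) e Vec.++ e) ≡ boolWord false
  go-false [] e = refl
  go-false (false ∷ w) e = go-false w e
  go-false (true ∷ w) e = go-false w e
  go : ∀ w f e → eval {2} x₀ (Loop.iter onesLoop w (boolWord f ∷ []) e Vec.++ e) ≡ boolWord (f ∧ allOnes w)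
  go w false e = go-false w e
  go [] true e = refl
  go (false ∷ w) true e = go-false w e
  go (true ∷ w) true e = go w true e

-- The least significant bit comes first, so the carry travels in the direction of a loop. The word
-- 1...1 wraps around to 0...0.
inc : Word → Word
inc []          = []
inc (false ∷ w) = true ∷ w
inc (true ∷ w)  = false ∷ inc w

-- state: the carry bit, then the bits output so far in reverse order
incLoop : Loop 2 0
incLoop = record
  { init = trueT ∷ nil ∷ []
  ; step = λ b → (if b then x₀ else falseT) ∷ ite x₀ (cons b x₁) (cons b x₁) (cons (not b) x₁) ∷ []
  ; out = call revApp (x₁ ∷ nil ∷ []) ; growth₁ = K 1
  ; growth₁-ok = λ { false (c ∷ a ∷ []) e le → m≤n+m 1 _ ∷ acc c a ∷ []
                  ; true (c ∷ a ∷ []) e le → m≤m+n _ 1 ∷ acc c a ∷ [] } }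
  where
  acc : ∀ c a {b b′} → length (iteW c (b ∷ a) (b ∷ a) (b′ ∷ a)) ≤ length a + 1
  acc c a = iteW-length c (suc-≤ (length a)) (suc-≤ (length a)) (suc-≤ (length a))

incF : Vec Word 1 → Word
incF (w ∷ []) = inc w

incPT : PT 1
incPT = respec (loopPT incLoop) incF λ { e@(w ∷ []) → go w true [] e }
  where
  go : ∀ w c a e → eval (Loop.out incLoop) (Loop.iter incLoop w (boolWord c ∷ a ∷ []) e Vec.++ e) ≡ a ʳ++ (if c then inc w else w)
  go [] false a e = refl
  go [] true a e = refl
  go (false ∷ w) false a e = go w false (false ∷ a) e
  go (false ∷ w) true a e = go w false (true ∷ a) e
  go (true ∷ w) false a e = go w false (true ∷ a) e
  go (true ∷ w) true a e = go w true (false ∷ a) e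

leadOnes : Word → Word
leadOnes []          = []
leadOnes (false ∷ w) = []
leadOnes (true ∷ w)  = true ∷ leadOnes w

-- State: the ones collected so far, then a flag that stays empty until a zero occurs.
leadLoop : Loop 2 0
leadLoop = record
  { init = nil ∷ nil ∷ []
  ; step = λ b → (if b then ite x₁ (cons true x₀) x₀ x₀ else x₀) ∷ (if b then x₁ else trueT) ∷ []
  ; out = call revApp (x₀ ∷ nil ∷ []) ; growth₁ = K 1
  ; growth₁-ok = λ { false (a ∷ s ∷ []) e le → m≤m+n _ 1 ∷ m≤n+m 1 _ ∷ []
                  ; true (a ∷ s ∷ []) e le → iteW-length s (suc-≤ (length a)) (m≤m+n _ 1) (m≤m+n _ 1) ∷ m≤m+n _ 1 ∷ [] } }

leadF : Vec Word 1 → Word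
leadF (w ∷ []) = leadOnes w

leadPT : PT 1
leadPT = respec (loopPT leadLoop) leadF λ { e@(w ∷ []) → go w [] e }
  where
  go-stop : ∀ w a e → eval (Loop.out leadLoop) (Loop.iter leadLoop w (a ∷ boolWord true ∷ []) e Vec.++ e) ≡ a ʳ++ []
  go-stop [] a e = refl
  go-stop (false ∷ w) a e = go-stop w a e
  go-stop (true ∷ w) a e = go-stop w a e
  go : ∀ w a e → eval (Loop.out leadLoop) (Loop.iter leadLoop w (a ∷ [] ∷ []) e Vec.++ e) ≡ a ʳ++ leadOnes w
  go [] a e = refl
  go (false ∷ w) a e = go-stop w a e
  go (true ∷ w) a e = go w (true ∷ a) e

-- Unary evaluation of polynomials

ones : ℕ → Word
ones n = replicate n true

ones-++ : ∀ m n → ones m ++ ones n ≡ ones (m + n)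
ones-++ zero n = refl
ones-++ (suc m) n = cong (true ∷_) (ones-++ m n)

lengthLoop : Loop 1 0
lengthLoop = record
  { init = nil ∷ [] ; step = λ b → cons true x₀ ∷ [] ; out = x₀ ; growth₁ = K 1
  ; growth₁-ok = λ { b (s ∷ []) e le → suc-≤ (length s) ∷ [] } }

timesLoop : Loop 1 1
timesLoop = record
  { init = nil ∷ [] ; step = λ b → call append (x₂ ∷ x₀ ∷ []) ∷ [] ; out = x₀ ; growth₁ = X
  ; growth₁-ok = λ { b (s ∷ []) (u ∷ v ∷ []) {N} le → 
      ≤-trans (≤-reflexive (trans (length-++ v) (+-comm (length v) _)))
              (+-monoʳ-≤ (length s) (≤-trans (length≤size v []) (≤-trans (size-tail u (v ∷ [])) le))) ∷ [] } }

constT : ∀ {n} → ℕ → Tm n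
constT zero    = nil
constT (suc c) = cons true (constT c)

eval-const : ∀ {n} c (e : Vec Word n) → eval (constT c) e ≡ ones c
eval-const zero e = refl
eval-const (suc c) e = cong (true ∷_) (eval-const c e)

unaryF : PolyExp → Vec Word 1 → Word
unaryF p (w ∷ []) = ones (⟦ p ⟧ (length w))

mutual
  unary : PolyExp → PT 1
  unary p = respec (ptime (unaryT p)) (unaryF p) λ { (w ∷ []) → eval-unary p w }

  unaryT : PolyExp → Tm 1
  unaryT X       = call (loopPT lengthLoop) (x₀ ∷ [])
  unaryT (K c)   = constT c
  unaryT (p ⊕ q) = call append (call (unary p) (x₀ ∷ []) ∷ call (unary q) (x₀ ∷ []) ∷ [])
  unaryT (p ⊗ q) = call (loopPT timesLoop) (call (unary p) (x₀ ∷ []) ∷ call (unary q) (x₀ ∷ []) ∷ [])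
  unaryT (p ⊚ q) = call (unary p) (call (unary q) (x₀ ∷ []) ∷ [])

  eval-unary : ∀ p w → eval (unaryT p) (w ∷ []) ≡ ones (⟦ p ⟧ (length w))
  eval-unary X w = trans (go w 0) (cong ones (+-identityʳ _))
    where
    go : ∀ v k → eval {2} x₀ (Loop.iter lengthLoop v (ones k ∷ []) (w ∷ []) Vec.++ (w ∷ [])) ≡ ones (length v + k)
    go [] k = refl
    go (b ∷ v) k = trans (go v (suc k)) (cong ones (+-suc (length v) k))
  eval-unary (K c) w = eval-const c (w ∷ [])
  eval-unary (p ⊕ q) w = ones-++ (⟦ p ⟧ (length w)) (⟦ q ⟧ (length w))
  eval-unary (p ⊗ q) w = trans (go (⟦ p ⟧ (length w)) 0) (cong ones (+-identityʳ _))
    where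
    u = ones (⟦ p ⟧ (length w))
    n = ⟦ q ⟧ (length w)
    fin : ℕ → Word → Word
    fin m s = eval {3} x₀ (Loop.iter timesLoop (ones m) (s ∷ []) (u ∷ ones n ∷ []) Vec.++ (u ∷ ones n ∷ []))
    go : ∀ m k → fin m (ones k) ≡ ones (m * n + k)
    go zero k = refl
    go (suc m) k = trans (cong (fin m) (ones-++ n k)) (trans (go m (n + k))
      (cong ones (trans (sym (+-assoc (m * n) n k)) (cong (_+ k) (+-comm (m * n) n)))))
  eval-unary (p ⊚ q) w = cong (λ z → ones (⟦ p ⟧ z)) (length-replicate (⟦ q ⟧ (length w)))

-- Simulation of Turing machines; a tape symbol is coded by two bits

c₁ c₂ : Sym → Bool
c₁ blank = false
c₁ sep   = false
c₁ zero₁ = true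
c₁ one₁  = true
c₂ blank = false
c₂ sep   = true
c₂ zero₁ = false
c₂ one₁  = true

codeS : List Sym → Word
codeS []      = []
codeS (a ∷ s) = c₁ a ∷ c₂ a ∷ codeS s

codeS-++ : ∀ s s′ → codeS (s ++ s′) ≡ codeS s ++ codeS s′
codeS-++ [] s′ = refl
codeS-++ (a ∷ s) s′ = cong (λ z → c₁ a ∷ c₂ a ∷ z) (codeS-++ s s′)

length-codeS : ∀ s → length s ≤ length (codeS s)
length-codeS [] = z≤n
length-codeS (a ∷ s) = s≤s (≤-trans (length-codeS s) (n≤1+n _))

consSym : ∀ {n} → Sym → Tm n → Tm n
consSym a t = cons (c₁ a) (cons (c₂ a) t)

-- An exhausted code counts as a blank, like the cells that `moveT` supplies beyond the stored part
-- of the tape.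
caseSym : ∀ {n} → Tm n → (Sym → Tm n) → Tm n
caseSym t k = ite t (k blank) (ite (tail t) (k blank) (k blank) (k sep)) (ite (tail t) (k zero₁) (k zero₁) (k one₁))

caseSym-∷ : ∀ {n} (t : Tm n) k e a s → eval t e ≡ codeS (a ∷ s) → eval (caseSym t k) e ≡ eval (k a) e
caseSym-∷ t k e blank s eq rewrite eq = refl
caseSym-∷ t k e zero₁ s eq rewrite eq = refl
caseSym-∷ t k e one₁  s eq rewrite eq = refl
caseSym-∷ t k e sep   s eq rewrite eq = refl

caseSym-length : ∀ {n} (t : Tm n) k e {B} → (∀ a → length (eval (k a) e) ≤ B) → length (eval (caseSym t k) e) ≤ B
caseSym-length t k e p = iteW-length (eval t e) (p blank)
  (iteW-length (tailW (eval t e)) (p blank) (p blank) (p sep)) (iteW-length (tailW (eval t e)) (p zero₁) (p zero₁) (p one₁))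

codeQ : ∀ {Q} → Fin Q → Word
codeQ i = ones (toℕ i)

caseFin : ∀ {n Q} → Tm n → (Fin Q → Tm n) → Tm n
caseFin {Q = zero} t k  = nil
caseFin {Q = suc Q} t k = ite t (k zero) (k zero) (caseFin (tail t) (λ i → k (suc i)))

caseFin-ok : ∀ {n Q} (t : Tm n) k e (i : Fin Q) → eval t e ≡ codeQ i → eval (caseFin t k) e ≡ eval (k i) e
caseFin-ok t k e zero eq rewrite eq = refl
caseFin-ok t k e (suc i) eq = trans (cong (λ z → iteW z (eval (k zero) e) (eval (k zero) e) (eval (caseFin (tail t) (λ j → k (suc j))) e)) eq) (caseFin-ok (tail t) (λ i → k (suc i)) e i (cong tailW eq))

caseFin-length : ∀ {n Q} (t : Tm n) (k : Fin Q → Tm n) e {B} → (∀ i → length (eval (k i) e) ≤ B) → length (eval (caseFin t k) e) ≤ B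
caseFin-length {Q = zero} t k e p = z≤n
caseFin-length {Q = suc Q} t k e p = iteW-length (eval t e) (p zero) (p zero) (caseFin-length (tail t) _ e (λ i → p (suc i)))

-- The input drives the loop only as a clock; the work is done on a second copy of it, two bits per
-- round. That copy is emptied at the first symbol that is not a bit, where `readSyms` stops.
decodeLoop : Loop 2 0
decodeLoop = record
  { init = x₀ ∷ nil ∷ []
  ; step = λ b → ite x₀ nil nil (tail (tail x₀)) ∷ ite x₀ x₁ x₁ (ite (tail x₀) x₁ (cons false x₁) (cons true x₁)) ∷ []
  ; out = call revApp (x₁ ∷ nil ∷ []) ; growth₁ = K 1
  ; growth₁-ok = λ { b (s ∷ a ∷ []) e le →
      iteW-length s z≤n z≤n (≤-trans (length-tailW (tailW s)) (≤-trans (length-tailW s) (m≤m+n _ 1))) ∷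
      iteW-length s (m≤m+n _ 1) (m≤m+n _ 1) (iteW-length (tailW s) (m≤m+n _ 1) (suc-≤ (length a)) (suc-≤ (length a))) ∷ [] } }

decodePT : PT 1
decodePT = loopPT decodeLoop

decode-codeS : ∀ s → PT.fn decodePT (codeS s ∷ []) ≡ readSyms s
decode-codeS s = go (codeS s) s [] (length-codeS s)
  where
  fin : Word → Word → Word → Word
  fin w r a = eval (Loop.out decodeLoop) (Loop.iter decodeLoop w (r ∷ a ∷ []) (codeS s ∷ []) Vec.++ (codeS s ∷ []))
  stop : ∀ w a → fin w [] a ≡ a ʳ++ []
  stop [] a = refl
  stop (b ∷ w) a = stop w a
  go : ∀ w s a → length s ≤ length w → fin w (codeS s) a ≡ a ʳ++ readSyms s
  go [] [] a le = refl
  go (b ∷ w) [] a le = stop w a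
  go (b ∷ w) (blank ∷ s) a le = stop w a
  go (b ∷ w) (sep ∷ s) a le = stop w a
  go (b ∷ w) (zero₁ ∷ s) a (s≤s le) = go w s (false ∷ a) le
  go (b ∷ w) (one₁ ∷ s) a (s≤s le) = go w s (true ∷ a) le

codeLoop : Loop 1 1
codeLoop = record
  { init = x₁ ∷ [] ; step = λ b → cons true (cons b x₀) ∷ [] ; out = x₀ ; growth₁ = K 2
  ; growth₁-ok = λ { b (s ∷ []) e le → ≤-reflexive (+-comm 2 (length s)) ∷ [] } }

codeAppF : Vec Word 2 → Word
codeAppF (w ∷ a ∷ []) = codeS (encWord w) ++ a

codeApp : PT 2
codeApp = respec (ptime (call (loopPT codeLoop) (call revApp (x₀ ∷ nil ∷ []) ∷ x₁ ∷ []))) codeAppF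
  λ { (w ∷ a ∷ []) → trans (go (w ʳ++ []) a _) (codeRev-ʳ++ w [] a) }
  where
  codeRev : Word → Word → Word
  codeRev [] a = a
  codeRev (b ∷ w) a = codeRev w (true ∷ b ∷ a)
  go : ∀ w a e → eval {3} x₀ (Loop.iter codeLoop w (a ∷ []) e Vec.++ e) ≡ codeRev w a
  go [] a e = refl
  go (b ∷ w) a e = go w (true ∷ b ∷ a) e
  codeRev-ʳ++ : ∀ w v a → codeRev (w ʳ++ v) a ≡ codeRev v (codeS (encWord w) ++ a)
  codeRev-ʳ++ [] v a = refl
  codeRev-ʳ++ (false ∷ w) v a = codeRev-ʳ++ w (false ∷ v) a
  codeRev-ʳ++ (true ∷ w) v a = codeRev-ʳ++ w (true ∷ v) a

codeArgs : ∀ {n m} → Vec (Tm n) m → Tm n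
codeArgs []           = nil
codeArgs (t ∷ [])     = call codeApp (t ∷ nil ∷ [])
codeArgs (t ∷ u ∷ ts) = call codeApp (t ∷ consSym sep (codeArgs (u ∷ ts)) ∷ [])

codeArgs-ok : ∀ {n m} (ts : Vec (Tm n) m) e → eval (codeArgs ts) e ≡ codeS (encode (toList (evals ts e)))
codeArgs-ok [] e = refl
codeArgs-ok (t ∷ []) e = ++-identityʳ _
codeArgs-ok (t ∷ u ∷ ts) e = trans (cong (λ z → codeS (encWord (eval t e)) ++ false ∷ true ∷ z) (codeArgs-ok (u ∷ ts) e))
  (sym (codeS-++ (encWord (eval t e)) (sep ∷ encode (toList (evals (u ∷ ts) e)))))

module Simulation (M : TM) where
  open TM M renaming (δ to δM)

  Action : Set
  Action = Maybe (Fin Q × Sym × Move)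

  rest : Tm 5
  rest = tail (tail x₁)

  actL actR actQ : Action → Tm 5
  actL nothing                = x₀
  actL (just (_ , s , stay))  = x₀
  actL (just (_ , s , right)) = consSym s x₀
  actL (just (_ , s , left))  = tail (tail x₀)
  actR nothing                = x₁
  actR (just (_ , s , stay))  = consSym s rest
  actR (just (_ , s , right)) = ite rest (consSym blank nil) rest rest
  actR (just (_ , s , left))  = caseSym x₀ λ a → consSym a (consSym s rest)
  actQ nothing                = x₂
  actQ (just (q , _))         = constT (toℕ q)

  dispatch : (Action → Tm 5) → Tm 5
  dispatch k = caseFin x₂ λ q → caseSym x₁ λ a → k (δM q a)

  config : Fin Q → Tape → Vec Word 3
  config q (tape l h r) = codeS l ∷ codeS (h ∷ r) ∷ codeQ q ∷ []

  dispatch-ok : ∀ k q t e → eval (dispatch k) (config q t Vec.++ e) ≡ eval (k (δM q (Tape.headSym t))) (config q t Vec.++ e)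
  dispatch-ok k q (tape l h r) e =
    trans (caseFin-ok x₂ _ (config q (tape l h r) Vec.++ e) q refl)
          (caseSym-∷ x₁ (λ a → k (δM q a)) (config q (tape l h r) Vec.++ e) h r refl)

  dispatch-length : ∀ k e {B} → (∀ act → length (eval (k act) e) ≤ B) → length (eval (dispatch k) e) ≤ B
  dispatch-length k e p = caseFin-length x₂ (λ q → caseSym x₁ λ a → k (δM q a)) e λ q → caseSym-length x₁ (λ a → k (δM q a)) e λ a → p (δM q a)

  simLoop : Loop 3 1
  simLoop = record
    { init = nil ∷ x₁ ∷ constT (toℕ start) ∷ []
    ; step = λ _ → dispatch actL ∷ dispatch actR ∷ dispatch actQ ∷ []
    ; out = call decodePT (x₁ ∷ [])
    -- A left move puts two symbols of two bits each before the old remainder; `Q` bounds the unary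
    -- code of the next state.
    ; growth₁ = K (4 + Q)
    ; growth₁-ok = λ { b (l ∷ r ∷ q ∷ []) e le →
        dispatch-length actL (l ∷ r ∷ q ∷ e) (lenL l r q e) ∷ dispatch-length actR (l ∷ r ∷ q ∷ e) (lenR l r q e) ∷ dispatch-length actQ (l ∷ r ∷ q ∷ e) (lenQ l r q e) ∷ [] } }
    where
    len-tail² : ∀ w → length (tailW (tailW w)) ≤ length w
    len-tail² w = ≤-trans (length-tailW (tailW w)) (length-tailW w)
    4+ : ∀ {m} n → m ≤ 4 + n → m ≤ n + (4 + Q)
    4+ n le = ≤-trans le (≤-trans (≤-reflexive (+-comm 4 n)) (+-monoʳ-≤ n (m≤m+n 4 Q)))
    lenL : ∀ l r q e act → length (eval (actL act) (l ∷ r ∷ q ∷ e)) ≤ length l + (4 + Q)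
    lenL l r q e nothing = m≤m+n _ _
    lenL l r q e (just (_ , s , stay)) = m≤m+n _ _
    lenL l r q e (just (_ , s , right)) = 4+ (length l) (s≤s (s≤s (≤-trans (n≤1+n _) (n≤1+n _))))
    lenL l r q e (just (_ , s , left)) = ≤-trans (len-tail² l) (m≤m+n _ _)
    lenR : ∀ l r q e act → length (eval (actR act) (l ∷ r ∷ q ∷ e)) ≤ length r + (4 + Q)
    lenR l r q e nothing = m≤m+n _ _
    lenR l r q e (just (_ , s , stay)) = 4+ (length r) (s≤s (s≤s (≤-trans (len-tail² r) (≤-trans (n≤1+n _) (n≤1+n _)))))
    lenR l r q e (just (_ , s , right)) = iteW-length (tailW (tailW r)) (4+ (length r) (s≤s (s≤s z≤n)))
      (≤-trans (len-tail² r) (m≤m+n _ _)) (≤-trans (len-tail² r) (m≤m+n _ _))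
    lenR l r q e (just (_ , s , left)) = caseSym-length x₀ (λ a → consSym a (consSym s rest)) (l ∷ r ∷ q ∷ e) λ a →
      4+ (length r) (s≤s (s≤s (s≤s (s≤s (len-tail² r)))))
    lenQ : ∀ l r q e act → length (eval (actQ act) (l ∷ r ∷ q ∷ e)) ≤ length q + (4 + Q)
    lenQ l r q e nothing = m≤m+n _ _
    lenQ l r q e (just (q′ , _)) = ≤-trans (≤-reflexive (trans (cong length (eval-const (toℕ q′) (l ∷ r ∷ q ∷ e))) (length-replicate (toℕ q′))))
      (≤-trans (<⇒≤ (toℕ<n q′)) (≤-trans (m≤n+m Q 4) (m≤n+m _ (length q))))

  step-halt : ∀ {b q t} e → δM q (Tape.headSym t) ≡ nothing → evals (Loop.step simLoop b) (config q t Vec.++ e) ≡ config q t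
  step-halt {b} {q} {t@(tape l h r)} e eq =
    cong₂ _∷_ (comp= actL) (cong₂ _∷_ (comp= actR) (cong (_∷ []) (comp= actQ)))
    where
    comp= : ∀ k → eval (dispatch k) (config q t Vec.++ e) ≡ eval (k nothing) (config q t Vec.++ e)
    comp= k = trans (dispatch-ok k q t e) (cong (λ z → eval (k z) (config q t Vec.++ e)) eq)

  step-move : ∀ {b q t q′ s m} e → δM q (Tape.headSym t) ≡ just (q′ , s , m) →
              evals (Loop.step simLoop b) (config q t Vec.++ e) ≡ config q′ (moveT m (write s t))
  step-move {b} {q} {t@(tape l h r)} {q′} {s} {m} e eq =
    trans (cong₂ _∷_ (comp= actL) (cong₂ _∷_ (comp= actR) (cong (_∷ []) (trans (comp= actQ) (eval-const (toℕ q′) (config q t Vec.++ e)))))) (fin m l r)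
    where
    comp= : ∀ k → eval (dispatch k) (config q t Vec.++ e) ≡ eval (k (just (q′ , s , m))) (config q t Vec.++ e)
    comp= k = trans (dispatch-ok k q t e) (cong (λ z → eval (k z) (config q t Vec.++ e)) eq)
    fin : ∀ m l r → (eval (actL (just (q′ , s , m))) (config q (tape l h r) Vec.++ e) ∷
                     eval (actR (just (q′ , s , m))) (config q (tape l h r) Vec.++ e) ∷ codeQ q′ ∷ []) ≡ config q′ (moveT m (write s (tape l h r)))
    fin left [] r = refl
    fin left (blank ∷ l) r = refl
    fin left (zero₁ ∷ l) r = refl
    fin left (one₁ ∷ l) r = refl
    fin left (sep ∷ l) r = refl
    fin right l [] = refl
    fin right l (blank ∷ r) = refl
    fin right l (zero₁ ∷ r) = refl
    fin right l (one₁ ∷ r) = refl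
    fin right l (sep ∷ r) = refl
    fin stay l r = refl

  -- The loop cannot stop early, but a halted configuration is a fixed point of its step; surplus
  -- fuel is therefore harmless.
  sim-run : ∀ fuel q t {t′} e → run M (length fuel) q t ≡ just t′ →
            Σ (Fin Q) λ q′ → Loop.iter simLoop fuel (config q t) e ≡ config q′ t′
  sim-run [] q t e eq with δM q (Tape.headSym t)
  ... | nothing = q , cong (config q) (just-injective eq)
  ... | just _ with () ← eq
  sim-run (b ∷ fuel) q t {t′} e eq with δM q (Tape.headSym t) in d
  ... | nothing = proj₁ ih , trans (cong (λ z → Loop.iter simLoop fuel z e) (step-halt {b} {q} {t} e d)) (proj₂ ih)
    where
    ih = sim-run fuel q t e (trans (run-halted M {length fuel} d) eq)
  ... | just (q″ , s , m) = proj₁ ih , trans (cong (λ z → Loop.iter simLoop fuel z e) (step-move {b} {q} {t} e d)) (proj₂ ih)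
    where
    ih = sim-run fuel q″ (moveT m (write s t)) e eq

  run-mono : ∀ {f f′} q t {t′} → f ≤ f′ → run M f q t ≡ just t′ → run M f′ q t ≡ just t′
  run-mono {zero} q t le eq with δM q (Tape.headSym t)
  ... | nothing = eq
  ... | just _ with () ← eq
  run-mono {suc f} {suc f′} q t (s≤s le) eq with δM q (Tape.headSym t)
  ... | nothing = eq
  ... | just (q″ , s , m) = run-mono q″ (moveT m (write s t)) le eq

  -- The fuel is the time bound at the length of the coded tape, which is at least the length of the
  -- input encoding and is at hand as a word. An empty encoding is replaced by one explicit blank,
  -- in agreement with `initTape`.
  simPT : ∀ m → ℕ → ℕ → PT m
  simPT m c k = ptime (call (loopPT simLoop) (call (unary fuelExp) (tapeT ∷ []) ∷ tapeT ∷ []))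
    module SimPT where
    power : ℕ → PolyExp
    power zero    = K 1
    power (suc k) = X ⊗ power k
    fuelExp : PolyExp
    fuelExp = K c ⊗ power k ⊕ K c
    argsT tapeT : Tm m
    argsT = codeArgs (Vec.map var (Vec.allFin m))
    tapeT = ite argsT (consSym blank nil) argsT argsT

  power-^ : ∀ m c k j n → ⟦ SimPT.power m c k j ⟧ n ≡ n ^ j
  power-^ m c k zero n = refl
  power-^ m c k (suc j) n = cong (n *_) (power-^ m c k j n)

  tape-start : ∀ ws → Σ Sym λ h → Σ (List Sym) λ r → initTape ws ≡ tape [] h r ×
               iteW (codeS (encode ws)) (false ∷ false ∷ []) (codeS (encode ws)) (codeS (encode ws)) ≡ codeS (h ∷ r) ×
               length (encode ws) ≤ length (codeS (h ∷ r))
  tape-start ws with encode ws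
  ... | []        = blank , [] , refl , refl , z≤n
  ... | blank ∷ s = blank , s , refl , refl , length-codeS (blank ∷ s)
  ... | zero₁ ∷ s = zero₁ , s , refl , refl , length-codeS (zero₁ ∷ s)
  ... | one₁ ∷ s  = one₁ , s , refl , refl , length-codeS (one₁ ∷ s)
  ... | sep ∷ s   = sep , s , refl , refl , length-codeS (sep ∷ s)

  evals-vars : ∀ {m} (v : Vec Word m) → evals (Vec.map var (Vec.allFin m)) v ≡ v
  evals-vars v = trans (go (Vec.allFin _) v) (map-lookup-allFin v)
    where
    go : ∀ {m n} (is : Vec (Fin n) m) (v : Vec Word n) → evals (Vec.map var is) v ≡ Vec.map (lookup v) is
    go [] v = refl
    go (i ∷ is) v = cong (lookup v i ∷_) (go is v)

  result-tape : ∀ fuel ws {w} → result M fuel ws ≡ just w → Σ Tape λ t′ → run M fuel start (initTape ws) ≡ just t′ × w ≡ readOut t′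
  result-tape fuel ws eq with run M fuel start (initTape ws)
  ... | just t′ = t′ , refl , sym (just-injective eq)
  ... | nothing with () ← eq

  simPT-ok : ∀ m c k (v : Vec Word m) {w} → result M (timeBound c k (length (encode (toList v)))) (toList v) ≡ just w →
             PT.fn (simPT m c k) v ≡ w
  simPT-ok m c k v {w} eq = trans (cong simulate tape=) (trans (cong out (proj₂ final)) (trans (decode-codeS (Tape.headSym t′ ∷ Tape.rightPart t′)) (sym (proj₂ (proj₂ inv)))))
    where
    open SimPT m c k
    ws = toList v
    h = proj₁ (tape-start ws)
    r = proj₁ (proj₂ (tape-start ws))
    init= = proj₁ (proj₂ (proj₂ (tape-start ws)))
    args= : eval argsT v ≡ codeS (encode ws)
    args= = trans (codeArgs-ok (Vec.map var (Vec.allFin m)) v) (cong (λ z → codeS (encode (toList z))) (evals-vars v))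
    tape= : eval tapeT v ≡ codeS (h ∷ r)
    tape= = trans (cong (λ z → iteW z (false ∷ false ∷ []) z z) args=) (proj₁ (proj₂ (proj₂ (proj₂ (tape-start ws)))))
    fuelW : Word → Word
    fuelW u = ones (⟦ fuelExp ⟧ (length u))
    out : Vec Word 3 → Word
    out s = eval (Loop.out simLoop) (s Vec.++ (fuelW (codeS (h ∷ r)) ∷ codeS (h ∷ r) ∷ []))
    simulate : Word → Word
    simulate u = loopFn simLoop (fuelW u ∷ u ∷ [])
    inv = result-tape (timeBound c k (length (encode ws))) ws eq
    t′ = proj₁ inv
    u = codeS (h ∷ r)
    fuel≤ : timeBound c k (length (encode ws)) ≤ length (fuelW u)
    fuel≤ = ≤-trans (+-monoˡ-≤ c (*-monoʳ-≤ c (^-monoˡ-≤ k (proj₂ (proj₂ (proj₂ (proj₂ (tape-start ws))))))))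
      (≤-reflexive (sym (trans (length-replicate (⟦ fuelExp ⟧ (length u))) (cong (λ z → c * z + c) (power-^ m c k k (length u))))))
    final : Σ (Fin Q) λ q′ → Loop.iter simLoop (fuelW u) (evals (Loop.init simLoop) (fuelW u ∷ u ∷ [])) (fuelW u ∷ u ∷ []) ≡ config q′ t′
    final = proj₁ sim , trans (cong (λ z → Loop.iter simLoop (fuelW u) ([] ∷ u ∷ z ∷ []) (fuelW u ∷ u ∷ [])) (eval-const (toℕ start) (fuelW u ∷ u ∷ []))) (proj₂ sim)
      where
      sim = sim-run (fuelW u) start (tape [] h r) (fuelW u ∷ u ∷ [])
              (run-mono start (tape [] h r) fuel≤ (trans (cong (run M (timeBound c k (length (encode ws))) start) (sym init=)) (proj₁ (proj₂ inv))))

PolyTime⇒PT : ∀ {m} {A : Set} {args : A → List Word} {g : A → Word} → PolyTimeComputable args g → (v : Vec Word m → A) →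
              (∀ w → args (v w) ≡ toList w) → PT m
PolyTime⇒PT {m} {args = args} {g} (M , c , k , ok) v argsEq = respec (Simulation.simPT M m c k) (λ w → g (v w)) λ w →
  Simulation.simPT-ok M m c k w
    (subst (λ ws → result M (timeBound c k (length (encode ws))) ws ≡ just (g (v w))) (argsEq w) (ok (v w)))

-- Values of bit strings, most significant bit first

valM : ∀ {n} → Vec Bool n → ℕ
valM []                = 0
valM (false ∷ v)       = valM v
valM {suc n} (true ∷ v) = 2 ^ n + valM v

2^suc : ∀ n → 2 ^ suc n ≡ 2 ^ n + 2 ^ n
2^suc n = cong (2 ^ n +_) (+-identityʳ _)

valM< : ∀ {n} (v : Vec Bool n) → valM v < 2 ^ n
valM< [] = s≤s z≤n
valM< {suc n} (false ∷ v) = <-≤-trans (valM< v) (m≤m+n _ _)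
valM< {suc n} (true ∷ v) = subst (2 ^ n + valM v <_) (sym (2^suc n)) (+-monoʳ-< (2 ^ n) (valM< v))

ofVal : ∀ n → ℕ → Vec Bool n
ofVal zero r = []
ofVal (suc n) r with r <? 2 ^ n
... | yes _ = false ∷ ofVal n r
... | no  _ = true ∷ ofVal n (r ∸ 2 ^ n)

valM-ofVal : ∀ n {r} → r < 2 ^ n → valM (ofVal n r) ≡ r
valM-ofVal zero (s≤s z≤n) = refl
valM-ofVal (suc n) {r} lt with r <? 2 ^ n
... | yes l = valM-ofVal n l
... | no ¬l = trans (cong (2 ^ n +_) (valM-ofVal n (+-cancelˡ-< (2 ^ n) _ _
                (subst₂ _<_ (sym (m+[n∸m]≡n (≮⇒≥ ¬l))) (2^suc n) lt)))) (m+[n∸m]≡n (≮⇒≥ ¬l))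

valM-<lex : ∀ {n} {u v : Vec Bool n} → u <lex v → valM u < valM v
valM-<lex {suc n} (here {xs = xs}) = <-≤-trans (valM< xs) (m≤m+n _ _)
valM-<lex (there {b = false} l) = valM-<lex l
valM-<lex {suc n} (there {b = true} l) = +-monoʳ-< (2 ^ n) (valM-<lex l)

<lex-valM : ∀ {n} (u v : Vec Bool n) → valM u < valM v → u <lex v
<lex-valM (false ∷ u) (false ∷ v) lt = there (<lex-valM u v lt)
<lex-valM (false ∷ u) (true ∷ v) lt = here
<lex-valM {suc n} (true ∷ u) (false ∷ v) lt = ⊥-elim (<-irrefl refl (<-trans (<-≤-trans (valM< v) (m≤m+n _ (valM u))) lt))
<lex-valM {suc n} (true ∷ u) (true ∷ v) lt = there (<lex-valM u v (+-cancelˡ-< (2 ^ n) _ _ lt))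

valM-injective : ∀ {n} (u v : Vec Bool n) → valM u ≡ valM v → u ≡ v
valM-injective [] [] eq = refl
valM-injective (false ∷ u) (false ∷ v) eq = cong (false ∷_) (valM-injective u v eq)
valM-injective {suc n} (true ∷ u) (true ∷ v) eq = cong (true ∷_) (valM-injective u v (+-cancelˡ-≡ (2 ^ n) _ _ eq))
valM-injective {suc n} (false ∷ u) (true ∷ v) eq = ⊥-elim (<-irrefl eq (<-≤-trans (valM< u) (m≤m+n _ (valM v))))
valM-injective {suc n} (true ∷ u) (false ∷ v) eq = ⊥-elim (<-irrefl (sym eq) (<-≤-trans (valM< v) (m≤m+n _ (valM u))))

valM-≤lex : ∀ {n} {u v : Vec Bool n} → u ≤lex v → valM u ≤ valM v
valM-≤lex (inj₁ refl) = ≤-refl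
valM-≤lex (inj₂ l) = <⇒≤ (valM-<lex l)

≤lex-valM : ∀ {n} (u v : Vec Bool n) → valM u ≤ valM v → u ≤lex v
≤lex-valM u v le with m≤n⇒m<n∨m≡n le
... | inj₁ lt = inj₂ (<lex-valM u v lt)
... | inj₂ eq = inj₁ (valM-injective u v eq)

-- If the values differed by more than one, the vector of value `suc (valM u)` would lie strictly
-- between.
≺lex⇔suc : ∀ {n} (u v : Vec Bool n) → u ≺lex v ⇔ valM v ≡ suc (valM u)
≺lex⇔suc {n} u v = mk⇔ to′ from′
  where
  to′ : u ≺lex v → valM v ≡ suc (valM u)
  to′ (l , none) with m≤n⇒m<n∨m≡n (valM-<lex l)
  ... | inj₂ eq = sym eq
  ... | inj₁ lt = ⊥-elim (none m (<lex-valM u m (≤-reflexive (sym val-m)) , <lex-valM m v (subst (_< valM v) (sym val-m) lt)))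
    where
    m = ofVal n (suc (valM u))
    val-m : valM m ≡ suc (valM u)
    val-m = valM-ofVal n (<-trans lt (valM< v))
  from′ : valM v ≡ suc (valM u) → u ≺lex v
  from′ eq = <lex-valM u v (≤-reflexive (sym eq)) , λ c (p , q) →
    <-irrefl refl (<-≤-trans (<-≤-trans (valM-<lex p) (≤-pred (subst (valM c <_) eq (valM-<lex q)))) ≤-refl)

valM-zeros : ∀ n → valM (Vec.replicate n false) ≡ 0
valM-zeros zero = refl
valM-zeros (suc n) = valM-zeros n

valM-ones : ∀ n → suc (valM (Vec.replicate n true)) ≡ 2 ^ n
valM-ones zero = refl
valM-ones (suc n) = trans (sym (+-suc (2 ^ n) _)) (trans (cong (2 ^ n +_) (valM-ones n)) (sym (2^suc n)))

-- Words of a given length and vectors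

toVec : ∀ n → Word → Vec Bool n
toVec zero w          = []
toVec (suc n) []      = Vec.replicate (suc n) false
toVec (suc n) (b ∷ w) = b ∷ toVec n w

toVec-toList : ∀ {n} (v : Vec Bool n) → toVec n (toList v) ≡ v
toVec-toList [] = refl
toVec-toList (b ∷ v) = cong (b ∷_) (toVec-toList v)

toList-toVec : ∀ {n} w → length w ≡ n → toList (toVec n w) ≡ w
toList-toVec [] refl = refl
toList-toVec (b ∷ w) refl = cong (b ∷_) (toList-toVec w refl)

-- Pigeonhole: punching out a missed value would leave an injection into a smaller set.
injective⇒surjective : ∀ {N} (f : Fin N → Fin N) → (∀ {i j} → f i ≡ f j → i ≡ j) → ∀ j → Σ (Fin N) λ i → f i ≡ j
injective⇒surjective {suc N} f inj j with any? (λ i → f i ≟F j)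
... | yes p = p
... | no ¬p = ⊥-elim (1+n≰n (injective⇒≤ {f = λ i → punchOut {i = j} (λ eq → ¬p (i , sym eq))} λ {x} {y} eq → inj (punchOut-injective (λ e → ¬p (x , sym e)) (λ e → ¬p (y , sym e)) eq)))

-- Stands for the bijection `h_x`. An injective numbering below `2 ^ n` is easier to construct, and
-- by counting it is already onto; `permutation` reads the number as a bit string. This also frees
-- the constructions from the bit order underlying `_<lex_`.
record Ranking (n : ℕ) : Set where
  field
    rank     : Word → ℕ
    rank<    : ∀ {w} → length w ≡ n → rank w < 2 ^ n
    rank-inj : ∀ {u v} → length u ≡ n → length v ≡ n → rank u ≡ rank v → u ≡ v

  unrank : ∀ {r} → r < 2 ^ n → Σ Word λ w → length w ≡ n × rank w ≡ r
  unrank {r} lt = word i , len i , trans (sym (toℕ-fromℕ< (rank< (len i)))) (trans (cong toℕ fi) (toℕ-fromℕ< lt))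
    where
    word : Fin (2 ^ n) → Word
    word i = toList (ofVal n (toℕ i))
    len : ∀ i → length (word i) ≡ n
    len i = length-toList (ofVal n (toℕ i))
    f : Fin (2 ^ n) → Fin (2 ^ n)
    f i = fromℕ< (rank< (len i))
    f-inj : ∀ {i j} → f i ≡ f j → i ≡ j
    f-inj {i} {j} eq = toℕ-injective (trans (sym (valM-ofVal n (toℕ<n i))) (trans (cong valM vi≡vj) (valM-ofVal n (toℕ<n j))))
      where
      w= : word i ≡ word j
      w= = rank-inj (len i) (len j) (trans (sym (toℕ-fromℕ< (rank< (len i)))) (trans (cong toℕ eq) (toℕ-fromℕ< (rank< (len j)))))
      vi≡vj : ofVal n (toℕ i) ≡ ofVal n (toℕ j)
      vi≡vj = trans (sym (toVec-toList _)) (trans (cong (toVec n) w=) (toVec-toList _))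
    i = proj₁ (injective⇒surjective f f-inj (fromℕ< lt))
    fi = proj₂ (injective⇒surjective f f-inj (fromℕ< lt))

  permutation : Vec Bool n ⤖ Vec Bool n
  permutation = mk⤖ {to = to′} (inj′ , surj′)
    where
    to′ : Vec Bool n → Vec Bool n
    to′ v = ofVal n (rank (toList v))
    inj′ : ∀ {u v} → to′ u ≡ to′ v → u ≡ v
    inj′ {u} {v} eq = trans (sym (toVec-toList u)) (trans (cong (toVec n) (rank-inj (length-toList u) (length-toList v)
      (trans (sym (valM-ofVal n (rank< (length-toList u)))) (trans (cong valM eq) (valM-ofVal n (rank< (length-toList v))))))) (toVec-toList v))
    surj′ : ∀ v → Σ (Vec Bool n) λ u → ∀ {z} → z ≡ u → to′ z ≡ v
    surj′ v with unrank (valM< v)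
    ... | w , len , eq = toVec n w , λ { refl → valM-injective _ v (trans (valM-ofVal n (rank< (length-toList (toVec n w))))
                           (trans (cong rank (toList-toVec w len)) eq)) }

  valM-permutation : ∀ v → valM (Bijection.to permutation v) ≡ rank (toList v)
  valM-permutation v = valM-ofVal n (rank< (length-toList v))

ranking : ∀ {n} → Vec Bool n ⤖ Vec Bool n → Ranking n
ranking {n} h = record
  { rank = λ w → valM (Bijection.to h (toVec n w)) ; rank< = λ _ → valM< (Bijection.to h _)
  ; rank-inj = λ {u} {v} lu lv eq → trans (sym (toList-toVec u lu)) (trans (cong toList
      (Bijection.injective h (valM-injective _ _ eq))) (toList-toVec v lv)) }

-- Counting

countW : ℕ → (Word → Bool) → ℕ
countW zero P    = if P [] then 1 else 0
countW (suc n) P = countW n (λ w → P (false ∷ w)) + countW n (λ w → P (true ∷ w))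

countVec-countW : ∀ n P → countVec n (λ v → P (toList v)) ≡ countW n P
countVec-countW zero P = refl
countVec-countW (suc n) P = cong₂ _+_ (countVec-countW n (λ w → P (false ∷ w))) (countVec-countW n (λ w → P (true ∷ w)))

countW-cong : ∀ n {P Q} → (∀ w → length w ≡ n → P w ≡ Q w) → countW n P ≡ countW n Q
countW-cong zero eq = cong (λ b → if b then 1 else 0) (eq [] refl)
countW-cong (suc n) eq = cong₂ _+_ (countW-cong n (λ w l → eq (false ∷ w) (cong suc l))) (countW-cong n (λ w l → eq (true ∷ w) (cong suc l)))

Holds : ℕ → (Word → Bool) → Word → Set
Holds n P w = length w ≡ n × P w ≡ true

count≥1⇒∃ : ∀ n {P} → 1 ≤ countW n P → Σ Word (Holds n P)
count≥1⇒∃ zero {P} le with P [] in eq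
... | true = [] , refl , eq
count≥1⇒∃ (suc n) {P} le with countW n (λ w → P (false ∷ w)) in eq
... | suc _ = let w , l , p = count≥1⇒∃ n (subst (1 ≤_) (sym eq) (s≤s z≤n)) in false ∷ w , cong suc l , p
... | zero  = let w , l , p = count≥1⇒∃ n {λ w → P (true ∷ w)} le in true ∷ w , cong suc l , p

∃⇒count≥1 : ∀ n {P w} → Holds n P w → 1 ≤ countW n P
∃⇒count≥1 zero {w = []} (l , p) = ≤-reflexive (cong (λ b → if b then 1 else 0) (sym p))
∃⇒count≥1 (suc n) {w = false ∷ w} (l , p) = ≤-trans (∃⇒count≥1 n (suc-injective l , p)) (m≤m+n _ _)
∃⇒count≥1 (suc n) {w = true ∷ w} (l , p) = ≤-trans (∃⇒count≥1 n (suc-injective l , p)) (m≤n+m _ _)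

count≤1⇒unique : ∀ n {P} → countW n P ≤ 1 → ∀ {u v} → Holds n P u → Holds n P v → u ≡ v
count≤1⇒unique zero le {[]} {[]} hu hv = refl
count≤1⇒unique (suc n) le {false ∷ u} {false ∷ v} (lu , pu) (lv , pv) =
  cong (false ∷_) (count≤1⇒unique n (≤-trans (m≤m+n _ _) le) (suc-injective lu , pu) (suc-injective lv , pv))
count≤1⇒unique (suc n) le {true ∷ u} {true ∷ v} (lu , pu) (lv , pv) =
  cong (true ∷_) (count≤1⇒unique n (≤-trans (m≤n+m _ _) le) (suc-injective lu , pu) (suc-injective lv , pv))
count≤1⇒unique (suc n) le {false ∷ u} {true ∷ v} (lu , pu) (lv , pv) =
  ⊥-elim (1+n≰n (≤-trans (+-mono-≤ (∃⇒count≥1 n (suc-injective lu , pu)) (∃⇒count≥1 n (suc-injective lv , pv))) le))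
count≤1⇒unique (suc n) le {true ∷ u} {false ∷ v} (lu , pu) (lv , pv) =
  ⊥-elim (1+n≰n (≤-trans (+-mono-≤ (∃⇒count≥1 n (suc-injective lv , pv)) (∃⇒count≥1 n (suc-injective lu , pu))) le))

∄⇒count≡0 : ∀ n {P} → (∀ {w} → ¬ Holds n P w) → countW n P ≡ 0
∄⇒count≡0 n {P} none with countW n P in eq
... | zero = refl
... | suc _ = ⊥-elim (none (proj₂ (count≥1⇒∃ n (subst (1 ≤_) (sym eq) (s≤s z≤n)))))

unique⇒count≤1 : ∀ n {P} → (∀ {u v} → Holds n P u → Holds n P v → u ≡ v) → countW n P ≤ 1
unique⇒count≤1 zero {P} uniq with P []
... | true = ≤-refl
... | false = z≤n
unique⇒count≤1 (suc n) {P} uniq with countW n (λ w → P (false ∷ w)) in eq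
... | zero = unique⇒count≤1 n λ {u} {v} hu hv → ∷-injectiveʳ (uniq {true ∷ u} {true ∷ v} (∷-holds hu) (∷-holds hv))
  where
  ∷-holds : ∀ {b w} → Holds n (λ w → P (b ∷ w)) w → Holds (suc n) P (b ∷ w)
  ∷-holds (l , p) = cong suc l , p
... | suc k = subst₂ (λ a b → a + b ≤ 1) eq (sym (∄⇒count≡0 n none)) (≤-trans (≤-reflexive (+-identityʳ _))
      (unique⇒count≤1 n λ {u} {v} hu hv → ∷-injectiveʳ (uniq {false ∷ u} {false ∷ v} (∷-holds hu) (∷-holds hv))))
  where
  ∷-holds : ∀ {b w} → Holds n (λ w → P (b ∷ w)) w → Holds (suc n) P (b ∷ w)
  ∷-holds (l , p) = cong suc l , p
  w₀ = count≥1⇒∃ n {λ w → P (false ∷ w)} (subst (1 ≤_) (sym eq) (s≤s z≤n))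
  none : ∀ {w} → ¬ Holds n (λ w → P (true ∷ w)) w
  none {w} h with uniq {false ∷ proj₁ w₀} {true ∷ w} (∷-holds (proj₂ w₀)) (∷-holds h)
  ... | ()

-- Clusters, in terms of words and their ranks

RankAdj : Set₁
RankAdj = ℕ → ℕ → ℕ → Set

LinAdj CircAdj : RankAdj
LinAdj n i j  = j ≡ suc i
CircAdj n i j = j ≡ suc i ⊎ (suc i ≡ 2 ^ n × j ≡ 0)

record Clustered (Adj : RankAdj) (n : ℕ) (V : Word → Bool) (prec : Word → Word → Bool) (k : ℕ) : Set where
  field
    R : Ranking n
  open Ranking R public
  field
    adj     : ∀ {y z} → length y ≡ n → length z ≡ n → prec y z ≡ true ⇔ Adj n (rank y) (rank z)
    cluster : ¬ (k ≡ 0) → Σ Word λ ℓ → Σ Word λ u → length ℓ ≡ n × length u ≡ n ×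
                (∀ {w} → length w ≡ n → V w ≡ true ⇔ (rank ℓ ≤ rank w × rank w ≤ rank u))
    count   : k ≡ countW n V

-- Both adjacency relations depend on the values of the strings alone, which lets the linear and the
-- circular classes share one translation.
Represents : AdjRel → RankAdj → Set
Represents adj Adj = ∀ {n} (u v : Vec Bool n) → adj u v ⇔ Adj n (valM u) (valM v)

≺lex-represents : Represents _≺lex_ LinAdj
≺lex-represents = ≺lex⇔suc

valM-zeros-unique : ∀ {n} (v : Vec Bool n) → valM v ≡ 0 → v ≡ Vec.replicate n false
valM-zeros-unique {n} v eq = valM-injective v _ (trans eq (sym (valM-zeros n)))

valM-ones-unique : ∀ {n} (v : Vec Bool n) → suc (valM v) ≡ 2 ^ n → v ≡ Vec.replicate n true
valM-ones-unique {n} v eq = valM-injective v _ (suc-injective (trans eq (sym (valM-ones n))))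

circSucc-represents : Represents circSucc CircAdj
circSucc-represents {n} u v = mk⇔
  (λ { (inj₁ p) → inj₁ (fwd (≺lex⇔suc u v) p)
     ; (inj₂ (refl , refl)) → inj₂ (valM-ones n , valM-zeros n) })
  (λ { (inj₁ p) → inj₁ (bwd (≺lex⇔suc u v) p)
     ; (inj₂ (p , q)) → inj₂ (valM-ones-unique u p , valM-zeros-unique v q) })

module _ {adj : AdjRel} {Adj : RankAdj} (rep : Represents adj Adj) {f : Word → ℕ} {M : BalancedNPTM}
         {prec : Word → Word → Word → Bool} {x : Word} where
  private
    n = guessLen M x
    V = BalancedNPTM.V M x

  fromConds : ∀ h → ClusterConds adj f M prec x h → Clustered Adj n V (prec x) (f x)
  fromConds h (adj⇔ , cl , cnt) = record
    { R = ranking h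
    ; adj = λ {y} {z} ly lz → mk⇔
        (λ p → fwd (rep _ _) (fwd (adj⇔ (toVec n y) (toVec n z)) (trans (cong₂ (prec x) (toList-toVec y ly) (toList-toVec z lz)) p)))
        (λ p → trans (sym (cong₂ (prec x) (toList-toVec y ly) (toList-toVec z lz))) (bwd (adj⇔ (toVec n y) (toVec n z)) (bwd (rep _ _) p)))
    ; cluster = λ k≢0 → let ℓ , u , c = cl k≢0 in
        toList ℓ , toList u , length-toList ℓ , length-toList u , λ {w} lw → mk⇔
          (λ p → let q₁ , q₂ = fwd (c (toVec n w)) (trans (cong V (toList-toVec w lw)) p) in
             subst (λ z → valM (H z) ≤ valM (H (toVec n w))) (sym (toVec-toList ℓ)) (valM-≤lex q₁) ,
             subst (λ z → valM (H (toVec n w)) ≤ valM (H z)) (sym (toVec-toList u)) (valM-≤lex q₂))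
          (λ { (q₁ , q₂) → trans (cong V (sym (toList-toVec w lw))) (bwd (c (toVec n w))
             (≤lex-valM _ _ (subst (λ z → valM (H z) ≤ valM (H (toVec n w))) (toVec-toList ℓ) q₁) ,
              ≤lex-valM _ _ (subst (λ z → valM (H (toVec n w)) ≤ valM (H z)) (toVec-toList u) q₂))) })
    ; count = trans cnt (countVec-countW n V) }
    where
    H = Bijection.to h

  toConds : (C : Clustered Adj n V (prec x) (f x)) → ClusterConds adj f M prec x (Ranking.permutation (Clustered.R C))
  toConds C =
    (λ y z → mk⇔
      (λ p → bwd (rep _ _) (subst₂ (Adj n) (sym (valM-permutation y)) (sym (valM-permutation z)) (fwd (adj′ (length-toList y) (length-toList z)) p)))
      (λ p → bwd (adj′ (length-toList y) (length-toList z)) (subst₂ (Adj n) (valM-permutation y) (valM-permutation z) (fwd (rep _ _) p)))) ,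
    (λ k≢0 → let ℓ , u , lℓ , lu , c = cluster k≢0 in toVec n ℓ , toVec n u , λ w → mk⇔
      (λ p → let q₁ , q₂ = fwd (c (length-toList w)) p in
         ≤lex-valM _ _ (subst₂ _≤_ (sym (val ℓ lℓ)) (sym (valM-permutation w)) q₁) ,
         ≤lex-valM _ _ (subst₂ _≤_ (sym (valM-permutation w)) (sym (val u lu)) q₂))
      (λ { (q₁ , q₂) → bwd (c (length-toList w))
         (subst₂ _≤_ (val ℓ lℓ) (valM-permutation w) (valM-≤lex q₁) , subst₂ _≤_ (valM-permutation w) (val u lu) (valM-≤lex q₂)) })) ,
    trans count (sym (countVec-countW n V))
    where
    open Clustered C renaming (adj to adj′)
    val : ∀ w → length w ≡ n → valM (Bijection.to permutation (toVec n w)) ≡ rank w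
    val w l = trans (valM-permutation (toVec n w)) (cong rank (toList-toVec w l))

-- Values of words, least significant bit first

valL : Word → ℕ
valL []          = 0
valL (false ∷ w) = 2 * valL w
valL (true ∷ w)  = suc (2 * valL w)

valL< : ∀ w → valL w < 2 ^ length w
valL< [] = s≤s z≤n
valL< (false ∷ w) = *-monoʳ-< 2 (valL< w)
valL< (true ∷ w) = ≤-trans (≤-reflexive (sym (*-suc 2 (valL w)))) (*-monoʳ-≤ 2 (valL< w))

valL-injective : ∀ u v → length u ≡ length v → valL u ≡ valL v → u ≡ v
valL-injective [] [] l eq = refl
valL-injective (false ∷ u) (false ∷ v) l eq = cong (false ∷_) (valL-injective u v (suc-injective l) (*-cancelˡ-≡ (valL u) (valL v) 2 eq))
valL-injective (true ∷ u) (true ∷ v) l eq = cong (true ∷_) (valL-injective u v (suc-injective l) (*-cancelˡ-≡ (valL u) (valL v) 2 (suc-injective eq)))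
valL-injective (false ∷ u) (true ∷ v) l eq = ⊥-elim (even≢odd (valL u) (valL v) eq)
valL-injective (true ∷ u) (false ∷ v) l eq = ⊥-elim (even≢odd (valL v) (valL u) (sym eq))

length-inc : ∀ w → length (inc w) ≡ length w
length-inc [] = refl
length-inc (false ∷ w) = refl
length-inc (true ∷ w) = cong suc (length-inc w)

valL-inc : ∀ w → suc (valL w) < 2 ^ length w → valL (inc w) ≡ suc (valL w)
valL-inc [] (s≤s ())
valL-inc (false ∷ w) lt = refl
valL-inc (true ∷ w) lt = trans (cong (2 *_) (valL-inc w (*-cancelˡ-< 2 _ _ (subst (_< 2 ^ suc (length w)) (sym (*-suc 2 (valL w))) lt)))) (*-suc 2 (valL w))

eqW-refl : ∀ w → eqW w w ≡ true
eqW-refl [] = refl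
eqW-refl (false ∷ w) = eqW-refl w
eqW-refl (true ∷ w) = eqW-refl w

eqW⇒≡ : ∀ u v → eqW u v ≡ true → u ≡ v
eqW⇒≡ [] [] eq = refl
eqW⇒≡ (false ∷ u) (false ∷ v) eq = cong (false ∷_) (eqW⇒≡ u v eq)
eqW⇒≡ (true ∷ u) (true ∷ v) eq = cong (true ∷_) (eqW⇒≡ u v eq)

≡⊎≢ : ∀ (m n : ℕ) → m ≡ n ⊎ ¬ (m ≡ n)
≡⊎≢ m n with m ≟ n
... | yes p = inj₁ p
... | no ¬p = inj₂ ¬p

-- Moving position e of 0, …, B ∸ 1 to the end

rot : ℕ → ℕ → ℕ → ℕ
rot B e a with <-cmp a e
... | tri< _ _ _ = a
... | tri≈ _ _ _ = pred B
... | tri> _ _ _ = pred a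

rot-below : ∀ B {e a} → a < e → rot B e a ≡ a
rot-below B {e} {a} lt with <-cmp a e
... | tri< _ _ _ = refl
... | tri≈ ¬l _ _ = ⊥-elim (¬l lt)
... | tri> ¬l _ _ = ⊥-elim (¬l lt)

rot-at : ∀ B e → rot B e e ≡ pred B
rot-at B e with <-cmp e e
... | tri< _ ¬e _ = ⊥-elim (¬e refl)
... | tri≈ _ _ _ = refl
... | tri> _ ¬e _ = ⊥-elim (¬e refl)

rot-above : ∀ B {e a} → e < a → suc (rot B e a) ≡ a
rot-above B {e} {suc a} lt with <-cmp (suc a) e
... | tri< _ _ ¬g = ⊥-elim (¬g lt)
... | tri≈ _ _ ¬g = ⊥-elim (¬g lt)
... | tri> _ _ _ = refl

-- As `e` is not the last position, the moved element always comes to stand behind the element of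
-- value `pred B`, wherever it was taken from.
module _ {B e : ℕ} (e<B : suc e < B) where
  private
    suc-predB : suc (pred B) ≡ B
    suc-predB = suc-pred B {{>-nonZero (≤-trans (s≤s z≤n) e<B)}}

  rot-at-suc : suc (rot B e e) ≡ B
  rot-at-suc = trans (cong suc (rot-at B e)) suc-predB

  rot-≢ : ∀ {a} → a < B → ¬ (a ≡ e) → suc (rot B e a) < B
  rot-≢ {a} a<B a≢e with <-cmp a e
  ... | tri< l _ _ = <-trans (s≤s l) e<B
  ... | tri≈ _ eq _ = ⊥-elim (a≢e eq)
  rot-≢ {suc a} a<B a≢e | tri> _ _ _ = a<B

  rot< : ∀ {a} → a < B → rot B e a < B
  rot< {a} a<B with ≡⊎≢ a e
  ... | inj₁ p = ≤-reflexive (trans (cong (λ z → suc (rot B e z)) p) rot-at-suc)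
  ... | inj₂ ne = <-trans (n<1+n _) (rot-≢ a<B ne)

  -- Away from `e` the rotation creates only one new adjacency, that between the two former
  -- neighbours of `e`.
  rot-suc⇒ : ∀ {a b} → a < B → b < B → ¬ (a ≡ e) → ¬ (b ≡ e) → rot B e b ≡ suc (rot B e a) → b ≡ suc a ⊎ (suc a ≡ e × b ≡ suc e)
  rot-suc⇒ {a} {b} a<B b<B a≢e b≢e eq with <-cmp a e | <-cmp b e
  ... | tri≈ _ p _ | _ = ⊥-elim (a≢e p)
  ... | _ | tri≈ _ p _ = ⊥-elim (b≢e p)
  ... | tri< _ _ _ | tri< _ _ _ = inj₁ eq
  rot-suc⇒ {a} {suc b} a<B b<B a≢e b≢e refl | tri< a<e _ _ | tri> _ _ e<b = inj₂ (≤-antisym a<e (≤-pred e<b) , cong suc (≤-antisym a<e (≤-pred e<b)))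
  rot-suc⇒ {suc a} {b} a<B b<B a≢e b≢e refl | tri> _ _ e<a | tri< b<e _ _ = ⊥-elim (<-asym e<a b<e)
  rot-suc⇒ {suc a} {suc b} a<B b<B a≢e b≢e refl | tri> _ _ _ | tri> _ _ _ = inj₁ refl

  rot-suc⇐ : ∀ {a b} → ¬ (a ≡ e) → ¬ (b ≡ e) → b ≡ suc a ⊎ (suc a ≡ e × b ≡ suc e) → rot B e b ≡ suc (rot B e a)
  rot-suc⇐ {a} a≢e b≢e (inj₁ refl) with <-cmp a e
  ... | tri< a<e _ _ = rot-below B (≤∧≢⇒< a<e b≢e)
  ... | tri≈ _ p _ = ⊥-elim (a≢e p)
  rot-suc⇐ {suc a} a≢e b≢e (inj₁ refl) | tri> _ _ e<a = suc-injective (rot-above B (<-trans e<a (n<1+n _)))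
  rot-suc⇐ {a} a≢e b≢e (inj₂ (refl , refl)) = suc-injective (trans (rot-above B (n<1+n _)) (cong (λ z → suc (suc z)) (sym (rot-below B (n<1+n a)))))

  rot-≢-inj : ∀ {a b} → ¬ (a ≡ e) → ¬ (b ≡ e) → rot B e a ≡ rot B e b → a ≡ b
  rot-≢-inj {a} {b} a≢e b≢e eq with <-cmp a e | <-cmp b e
  ... | tri≈ _ p _ | _ = ⊥-elim (a≢e p)
  ... | _ | tri≈ _ p _ = ⊥-elim (b≢e p)
  ... | tri< _ _ _ | tri< _ _ _ = eq
  rot-≢-inj {a} {suc b} _ _ refl | tri< a<e _ _ | tri> _ _ e<b = ⊥-elim (<-irrefl refl (<-≤-trans a<e (≤-pred e<b)))
  rot-≢-inj {suc a} {b} _ _ refl | tri> _ _ e<a | tri< b<e _ _ = ⊥-elim (<-irrefl refl (<-≤-trans b<e (≤-pred e<a)))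
  rot-≢-inj {suc a} {suc b} _ _ refl | tri> _ _ _ | tri> _ _ _ = refl

  rot-inj : ∀ {a b} → a < B → b < B → rot B e a ≡ rot B e b → a ≡ b
  rot-inj {a} {b} a<B b<B eq with ≡⊎≢ a e | ≡⊎≢ b e
  ... | inj₁ p | inj₁ q = trans p (sym q)
  ... | inj₁ p | inj₂ ne = ⊥-elim (<-irrefl (trans (cong suc (trans (sym eq) (cong (rot B e) p))) rot-at-suc) (rot-≢ b<B ne))
  ... | inj₂ ne | inj₁ q = ⊥-elim (<-irrefl (trans (cong suc (trans eq (cong (rot B e) q))) rot-at-suc) (rot-≢ a<B ne))
  ... | inj₂ ne | inj₂ ne′ = rot-≢-inj ne ne′ eq

-- The order of the words of length n with value below B in which the valid word, if any, is moved to the end.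
rotAdj : (Word → Bool) → (Word → Bool) → Word → Word → Bool
rotAdj valid last s s′ =
  if valid s′ then last s else if valid s then false else
  not (last s) ∧ (eqW (inc s) s′ ∨ (valid (inc s) ∧ eqW (inc (inc s)) s′))

-- Whether a valid word exists may be hard to decide. The answer `Exists` enters only the rank `ρ`,
-- which need not be computable in polynomial time; the relation `rotAdj` never consults it.
module Rotation {n B : ℕ} {valid last : Word → Bool} (B≤ : B ≤ 2 ^ n)
  (last⇒ : ∀ {s} → length s ≡ n → last s ≡ true → suc (valL s) ≡ B)
  (last⇐ : ∀ {s} → length s ≡ n → suc (valL s) ≡ B → last s ≡ true)
  (valid< : ∀ {s} → Holds n valid s → suc (valL s) < B)
  (unique : ∀ {s t} → Holds n valid s → Holds n valid t → s ≡ t) where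

  Exists : Set
  Exists = Σ Word (Holds n valid) ⊎ (∀ {s} → ¬ Holds n valid s)

  ρ : Exists → Word → ℕ
  ρ (inj₁ (e , _)) s = rot B (valL e) (valL s)
  ρ (inj₂ _) s       = valL s

  private
    valL-inj : ∀ {s t} → length s ≡ n → length t ≡ n → valL s ≡ valL t → s ≡ t
    valL-inj ls lt eq = valL-injective _ _ (trans ls (sym lt)) eq

    len-inc : ∀ {s} → length s ≡ n → length (inc s) ≡ n
    len-inc {s} l = trans (length-inc s) l

    val-inc : ∀ {s} → length s ≡ n → suc (valL s) < B → valL (inc s) ≡ suc (valL s)
    val-inc {s} refl lt = valL-inc s (<-≤-trans lt B≤)

    not-last : ∀ {s} → length s ≡ n → valL s < B → last s ≡ false → suc (valL s) < B
    not-last l lt nl with m≤n⇒m<n∨m≡n lt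
    ... | inj₁ lt′ = lt′
    ... | inj₂ eq with () ← trans (sym nl) (last⇐ l eq)

  ρ< : ∀ E {s} → valL s < B → ρ E s < B
  ρ< (inj₁ (e , v)) lt = rot< (valid< v) lt
  ρ< (inj₂ _) lt       = lt

  ρ-inj : ∀ E {s t} → length s ≡ n → length t ≡ n → valL s < B → valL t < B → ρ E s ≡ ρ E t → s ≡ t
  ρ-inj (inj₁ (e , v)) ls lt s< t< eq = valL-inj ls lt (rot-inj (valid< v) s< t< eq)
  ρ-inj (inj₂ _) ls lt s< t< eq       = valL-inj ls lt eq

  ρ-valid : ∀ E {s} → Holds n valid s → suc (ρ E s) ≡ B
  ρ-valid (inj₁ (e , v)) h rewrite unique h v = rot-at-suc (valid< v)
  ρ-valid (inj₂ none) h                       = ⊥-elim (none h)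

  ρ-end⇒valid : ∀ E → Σ Word (Holds n valid) → ∀ {s} → length s ≡ n → valL s < B → suc (ρ E s) ≡ B → valid s ≡ true
  ρ-end⇒valid (inj₂ none) ex l lt eq = ⊥-elim (none (proj₂ ex))
  ρ-end⇒valid (inj₁ (e , v)) ex {s} l lt eq with ≡⊎≢ (valL s) (valL e)
  ... | inj₁ p = trans (cong valid (valL-inj l (proj₁ v) p)) (proj₂ v)
  ... | inj₂ p = ⊥-elim (<-irrefl eq (rot-≢ (valid< v) lt p))

  ρ-zero : ∀ E {s} → length s ≡ n → valL s ≡ 0 → valid s ≡ false → ρ E s ≡ 0
  ρ-zero (inj₂ _) l z nv = z
  ρ-zero (inj₁ (e , v)) {s} l z nv with valL e in eq
  ...   | zero with () ← trans (sym nv) (trans (cong valid (valL-inj l (proj₁ v) (trans z (sym eq)))) (proj₂ v))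
  ...   | suc k rewrite z = rot-below B {suc k} (s≤s z≤n)

  -- The moved word is entered from `last` and left by no link; elsewhere a link is one increment,
  -- or two across the gap. For non-valid targets `last s` is excluded, as its increment leaves the
  -- values below `B` or wraps around to 0...0.
  rotAdj⇔ : ∀ E {s t} → length s ≡ n → length t ≡ n → valL s < B → valL t < B →
            rotAdj valid last s t ≡ true ⇔ ρ E t ≡ suc (ρ E s)
  rotAdj⇔ E {s} {t} ls lt s< t< with valid t in vt
  ... | true = mk⇔ (λ p → suc-injective (trans (ρ-valid E (lt , vt)) (trans (sym (last⇒ ls p)) (cong suc (sym (ρ-last E p))))))
                   (λ eq → last⇐ ls (last-ρ E eq))
    where
    ρ-last : ∀ E → last s ≡ true → suc (ρ E s) ≡ valL s
    ρ-last (inj₂ none) p    = ⊥-elim (none (lt , vt))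
    ρ-last (inj₁ (e , v)) p = rot-above B (≤-pred (subst (suc (valL e) <_) (sym (last⇒ ls p)) (valid< v)))
    last-ρ : ∀ E → ρ E t ≡ suc (ρ E s) → suc (valL s) ≡ B
    last-ρ (inj₂ none) eq = ⊥-elim (none (lt , vt))
    last-ρ (inj₁ (e , v)) eq with <-cmp (valL s) (valL e) | unique (lt , vt) v
    ...   | tri< l _ _ | refl = ⊥-elim (<-irrefl (trans (cong suc (sym eq)) (rot-at-suc (valid< v))) (≤-trans (s≤s (s≤s l)) (valid< v)))
    ...   | tri≈ _ p _ | refl = ⊥-elim (1+n≢n (trans (sym eq) (rot-at B (valL e))))
    ...   | tri> _ _ g | refl = trans (cong suc (trans (sym (suc-pred (valL s) {{>-nonZero (≤-trans (s≤s z≤n) g)}})) (sym eq))) (rot-at-suc (valid< v))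
  ... | false with valid s in vs
  ...   | true = mk⇔ (λ ()) (λ eq → ⊥-elim (<-irrefl (trans eq (ρ-valid E (ls , vs))) (ρ< E {t} t<)))
  ...   | false with last s in la
  ...     | true = mk⇔ (λ ()) (λ eq → ⊥-elim (stuck E eq))
    where
    stuck : ∀ E → ¬ (ρ E t ≡ suc (ρ E s))
    stuck (inj₂ _) eq = <-irrefl (trans eq (last⇒ ls la)) t<
    stuck (inj₁ (e , v)) eq = <-irrefl (trans (cong suc eq) (trans (cong suc (rot-above B e<s)) (last⇒ ls la))) (rot-≢ (valid< v) t< λ p → t≢e (valL-inj lt (proj₁ v) p))
      where
      t≢e : ¬ (t ≡ e)
      t≢e refl with () ← trans (sym vt) (proj₂ v)
      e<s : valL e < valL s
      e<s = ≤-pred (subst (suc (valL e) <_) (sym (last⇒ ls la)) (valid< v))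
  ...     | false = mk⇔ (to′ E) (from′ E)
    where
    s<′ : suc (valL s) < B
    s<′ = not-last ls s< la
    next⇔ : ∀ {u} → length u ≡ n → suc (valL u) < B → eqW (inc u) t ≡ true ⇔ valL t ≡ suc (valL u)
    next⇔ {u} lu u< = mk⇔ (λ p → trans (cong valL (sym (eqW⇒≡ (inc u) t p))) (val-inc {u} lu u<))
                         (λ p → trans (cong (eqW (inc u)) (valL-inj lt (len-inc {u} lu) (trans p (sym (val-inc {u} lu u<))))) (eqW-refl (inc u)))
    to′ : ∀ E → eqW (inc s) t ∨ (valid (inc s) ∧ eqW (inc (inc s)) t) ≡ true → ρ E t ≡ suc (ρ E s)
    to′ E p with eqW (inc s) t in e₁
    to′ (inj₂ _) p | true = fwd (next⇔ {s} ls s<′) e₁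
    to′ (inj₁ (e , v)) p | true = rot-suc⇐ (valid< v) (λ q → s≢e (valL-inj ls (proj₁ v) q)) (λ q → t≢e (valL-inj lt (proj₁ v) q)) (inj₁ (fwd (next⇔ {s} ls s<′) e₁))
      where
      t≢e : ¬ (t ≡ e)
      t≢e refl with () ← trans (sym vt) (proj₂ v)
      s≢e : ¬ (s ≡ e)
      s≢e refl with () ← trans (sym vs) (proj₂ v)
    to′ E p | false with valid (inc s) in vi
    to′ (inj₂ none) p | false | true = ⊥-elim (none (len-inc {s} ls , vi))
    to′ (inj₁ (e , v)) p | false | true with unique (len-inc {s} ls , vi) v
    ...   | refl = rot-suc⇐ (valid< v) (λ q → s≢e (valL-inj ls (proj₁ v) q)) (λ q → t≢e (valL-inj lt (proj₁ v) q))
                     (inj₂ (sym (val-inc {s} ls s<′) , fwd (next⇔ {inc s} (len-inc {s} ls) (valid< v)) p))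
      where
      t≢e : ¬ (t ≡ inc s)
      t≢e refl with () ← trans (sym vt) (proj₂ v)
      s≢e : ¬ (s ≡ inc s)
      s≢e q with () ← trans (sym vs) (trans (cong valid q) (proj₂ v))
    from′ : ∀ E → ρ E t ≡ suc (ρ E s) → eqW (inc s) t ∨ (valid (inc s) ∧ eqW (inc (inc s)) t) ≡ true
    from′ (inj₂ _) eq rewrite bwd (next⇔ {s} ls s<′) eq = refl
    from′ (inj₁ (e , v)) eq with rot-suc⇒ (valid< v) s< t< (λ q → s≢e (valL-inj ls (proj₁ v) q)) (λ q → t≢e (valL-inj lt (proj₁ v) q)) eq
      where
      t≢e : ¬ (t ≡ e)
      t≢e refl with () ← trans (sym vt) (proj₂ v)
      s≢e : ¬ (s ≡ e)
      s≢e refl with () ← trans (sym vs) (proj₂ v)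
    ...   | inj₁ p rewrite bwd (next⇔ {s} ls s<′) p = refl
    ...   | inj₂ (p , q) with valL-inj {inc s} {e} (len-inc {s} ls) (proj₁ v) (trans (val-inc {s} ls s<′) p)
    ...     | refl rewrite proj₂ v | bwd (next⇔ {inc s} (len-inc {s} ls) (valid< v)) q = ∨-true (eqW (inc s) t)
      where
      ∨-true : ∀ b → b ∨ true ≡ true
      ∨-true false = refl
      ∨-true true = refl

-- Polynomials as coefficient lists and as expressions

_+ₚ_ _*ₚ_ _∘ₚ_ : Poly → Poly → Poly
[] +ₚ q             = q
(a ∷ p) +ₚ []       = a ∷ p
(a ∷ p) +ₚ (b ∷ q)  = a + b ∷ p +ₚ q

scale : ℕ → Poly → Poly
scale c []      = []
scale c (a ∷ p) = c * a ∷ scale c p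

[] *ₚ q      = []
(a ∷ p) *ₚ q = scale a q +ₚ (0 ∷ p *ₚ q)

[] ∘ₚ q      = []
(a ∷ p) ∘ₚ q = (a ∷ []) +ₚ (q *ₚ (p ∘ₚ q))

eval-+ₚ : ∀ p q n → evalPoly (p +ₚ q) n ≡ evalPoly p n + evalPoly q n
eval-+ₚ [] q n = refl
eval-+ₚ (a ∷ p) [] n = sym (+-identityʳ _)
eval-+ₚ (a ∷ p) (b ∷ q) n = trans (cong (λ z → a + b + n * z) (eval-+ₚ p q n))
  (solve 5 (λ a b n x y → a :+ b :+ n :* (x :+ y) := (a :+ n :* x) :+ (b :+ n :* y)) refl a b n (evalPoly p n) (evalPoly q n))

eval-scale : ∀ c p n → evalPoly (scale c p) n ≡ c * evalPoly p n
eval-scale c [] n = sym (*-zeroʳ c)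
eval-scale c (a ∷ p) n = trans (cong (λ z → c * a + n * z) (eval-scale c p n))
  (solve 4 (λ c a n x → c :* a :+ n :* (c :* x) := c :* (a :+ n :* x)) refl c a n (evalPoly p n))

eval-*ₚ : ∀ p q n → evalPoly (p *ₚ q) n ≡ evalPoly p n * evalPoly q n
eval-*ₚ [] q n = refl
eval-*ₚ (a ∷ p) q n = trans (eval-+ₚ (scale a q) (0 ∷ p *ₚ q) n)
  (trans (cong₂ _+_ (eval-scale a q n) (cong (n *_) (eval-*ₚ p q n)))
    (solve 4 (λ a n x y → a :* y :+ n :* (x :* y) := (a :+ n :* x) :* y) refl a n (evalPoly p n) (evalPoly q n)))

eval-∘ₚ : ∀ p q n → evalPoly (p ∘ₚ q) n ≡ evalPoly p (evalPoly q n)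
eval-∘ₚ [] q n = refl
eval-∘ₚ (a ∷ p) q n = trans (eval-+ₚ (a ∷ []) (q *ₚ (p ∘ₚ q)) n)
  (cong₂ _+_ (trans (cong (a +_) (*-zeroʳ n)) (+-identityʳ a)) (trans (eval-*ₚ q (p ∘ₚ q) n) (cong (evalPoly q n *_) (eval-∘ₚ p q n))))

toPoly : PolyExp → Poly
toPoly X       = 0 ∷ 1 ∷ []
toPoly (K c)   = c ∷ []
toPoly (d ⊕ e) = toPoly d +ₚ toPoly e
toPoly (d ⊗ e) = toPoly d *ₚ toPoly e
toPoly (d ⊚ e) = toPoly d ∘ₚ toPoly e

eval-toPoly : ∀ e n → evalPoly (toPoly e) n ≡ ⟦ e ⟧ n
eval-toPoly X n = solve 1 (λ n → n :* (con 1 :+ n :* con 0) := n) refl n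
eval-toPoly (K c) n = trans (cong (c +_) (*-zeroʳ n)) (+-identityʳ c)
eval-toPoly (d ⊕ e) n = trans (eval-+ₚ (toPoly d) (toPoly e) n) (cong₂ _+_ (eval-toPoly d n) (eval-toPoly e n))
eval-toPoly (d ⊗ e) n = trans (eval-*ₚ (toPoly d) (toPoly e) n) (cong₂ _*_ (eval-toPoly d n) (eval-toPoly e n))
eval-toPoly (d ⊚ e) n = trans (eval-∘ₚ (toPoly d) (toPoly e) n) (trans (eval-toPoly d _) (cong ⟦ d ⟧ (eval-toPoly e n)))

fromPoly : Poly → PolyExp
fromPoly []      = K 0
fromPoly (a ∷ p) = K a ⊕ X ⊗ fromPoly p

eval-fromPoly : ∀ p n → ⟦ fromPoly p ⟧ n ≡ evalPoly p n
eval-fromPoly [] n = refl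
eval-fromPoly (a ∷ p) n = cong (λ z → a + n * z) (eval-fromPoly p n)

-- Polynomial-time computable functions of a vector of words

record Computes {n} (F : Vec Word n → Word) : Set where
  constructor computes
  field
    term    : Tm n
    term-ok : ∀ e → eval term e ≡ F e

record Decides {n} (P : Vec Word n → Bool) : Set where
  constructor decides
  field
    term    : Tm n
    term-ok : ∀ e → eval term e ≡ boolWord (P e)

module _ {n : ℕ} where
  varC : ∀ i → Computes {n} (λ e → lookup e i)
  varC i = computes (var i) λ e → refl

  call₁ : ∀ {A : Vec Word n → Word} (F : PT 1) → Computes A → Computes (λ e → PT.fn F (A e ∷ []))
  call₁ F (computes s p) = computes (call F (s ∷ [])) λ e → cong (λ z → PT.fn F (z ∷ [])) (p e)

  call₂ : ∀ {A B : Vec Word n → Word} (F : PT 2) → Computes A → Computes B → Computes (λ e → PT.fn F (A e ∷ B e ∷ []))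
  call₂ F (computes s p) (computes t q) = computes (call F (s ∷ t ∷ [])) λ e → cong₂ (λ y z → PT.fn F (y ∷ z ∷ [])) (p e) (q e)

  call₃ : ∀ {A B C : Vec Word n → Word} (F : PT 3) → Computes A → Computes B → Computes C →
          Computes (λ e → PT.fn F (A e ∷ B e ∷ C e ∷ []))
  call₃ F (computes s p) (computes t q) (computes u r) = computes (call F (s ∷ t ∷ u ∷ []))
    λ e → trans (cong₂ (λ y z → PT.fn F (y ∷ z ∷ _ ∷ [])) (p e) (q e)) (cong (λ z → PT.fn F (_ ∷ _ ∷ z ∷ [])) (r e))

  fromBoolWord : ∀ {P : Vec Word n → Bool} → Computes (λ e → boolWord (P e)) → Decides P
  fromBoolWord (computes t p) = decides t p

  consC : ∀ {A : Vec Word n → Word} b → Computes A → Computes (λ e → b ∷ A e)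
  consC b (computes s p) = computes (cons b s) λ e → cong (b ∷_) (p e)

  tailC : ∀ {A : Vec Word n → Word} → Computes A → Computes (λ e → tailW (A e))
  tailC (computes s p) = computes (tail s) λ e → cong tailW (p e)

  appendC : ∀ {A B : Vec Word n → Word} → Computes A → Computes B → Computes (λ e → A e ++ B e)
  appendC = call₂ append

  incC : ∀ {A : Vec Word n → Word} → Computes A → Computes (λ e → inc (A e))
  incC = call₁ incPT

  onesC : ∀ {A : Vec Word n → Word} q → Computes A → Computes (λ e → ones (⟦ q ⟧ (length (A e))))
  onesC q = call₁ (unary q)

  castC : ∀ {A B : Vec Word n → Word} → (∀ e → A e ≡ B e) → Computes A → Computes B
  castC eq (computes s p) = computes s λ e → trans (p e) (eq e)

  takeC : ∀ {A B : Vec Word n → Word} q → Computes A → Computes B → Computes (λ e → take (⟦ q ⟧ (length (A e))) (B e))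
  takeC {A} {B} q a b = castC (λ e → cong (λ m → take m (B e)) (length-replicate (⟦ q ⟧ (length (A e))))) (call₂ takePT (onesC q a) b)

  dropC : ∀ {A B : Vec Word n → Word} q → Computes A → Computes B → Computes (λ e → drop (⟦ q ⟧ (length (A e))) (B e))
  dropC {A} {B} q a b = castC (λ e → cong (λ m → drop m (B e)) (length-replicate (⟦ q ⟧ (length (A e))))) (call₂ dropPT (onesC q a) b)

  ifD : ∀ {P Q R : Vec Word n → Bool} → Decides P → Decides Q → Decides R → Decides (λ e → if P e then Q e else R e)
  ifD {P} {Q} {R} (decides s p) (decides t q) (decides u r) = decides (ite s u u t) λ e →
    trans (cong (λ z → iteW z (eval u e) (eval u e) (eval t e)) (p e)) (lem (P e) (q e) (r e))
    where
    lem : ∀ b {x y c d} → x ≡ boolWord c → y ≡ boolWord d → iteW (boolWord b) y y x ≡ boolWord (if b then c else d)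
    lem false p q = q
    lem true p q  = p

  castD : ∀ {P Q : Vec Word n → Bool} → (∀ e → P e ≡ Q e) → Decides P → Decides Q
  castD eq (decides s p) = decides s λ e → trans (p e) (cong boolWord (eq e))

  falseD : Decides {n} (λ _ → false)
  falseD = decides falseT λ _ → refl

  trueD : Decides {n} (λ _ → true)
  trueD = decides trueT λ _ → refl

  infixr 6 _∧D_
  infixr 5 _∨D_

  _∧D_ : ∀ {P Q : Vec Word n → Bool} → Decides P → Decides Q → Decides (λ e → P e ∧ Q e)
  _∧D_ {P} {Q} p q = castD (λ e → lem (P e)) (ifD p q falseD)
    where
    lem : ∀ b {c} → (if b then c else false) ≡ b ∧ c
    lem false = refl
    lem true  = refl

  notD : ∀ {P : Vec Word n → Bool} → Decides P → Decides (λ e → not (P e))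
  notD {P} p = castD (λ e → lem (P e)) (ifD p falseD trueD)
    where
    lem : ∀ b → (if b then false else true) ≡ not b
    lem false = refl
    lem true  = refl

  _∨D_ : ∀ {P Q : Vec Word n → Bool} → Decides P → Decides Q → Decides (λ e → P e ∨ Q e)
  _∨D_ {P} {Q} p q = castD (λ e → lem (P e)) (ifD p trueD q)
    where
    lem : ∀ b {c} → (if b then true else c) ≡ b ∨ c
    lem false = refl
    lem true  = refl

  eqD : ∀ {A B : Vec Word n → Word} → Computes A → Computes B → Decides (λ e → eqW (A e) (B e))
  eqD a b = fromBoolWord (call₂ eqPT a b)

  allOnesD : ∀ {A : Vec Word n → Word} → Computes A → Decides (λ e → allOnes (A e))
  allOnesD a = fromBoolWord (call₁ allOnesPT a)

hd : Word → Bool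
hd []      = false
hd (b ∷ _) = b

hdD : ∀ {n} {A : Vec Word n → Word} → Computes A → Decides (λ e → hd (A e))
hdD {A = A} (computes s p) = decides (ite s falseT falseT trueT) λ e → trans (cong (λ z → iteW z _ _ _) (p e)) (lem (A e))
  where
  lem : ∀ w → iteW w (boolWord false) (boolWord false) (boolWord true) ≡ boolWord (hd w)
  lem [] = refl
  lem (false ∷ w) = refl
  lem (true ∷ w) = refl

zerosLoop : Loop 1 0
zerosLoop = record
  { init = nil ∷ [] ; step = λ b → cons false x₀ ∷ [] ; out = x₀ ; growth₁ = K 1
  ; growth₁-ok = λ { b (s ∷ []) e le → suc-≤ (length s) ∷ [] } }

zeros : ℕ → Word
zeros n = replicate n false

zerosC : ∀ {n} {A : Vec Word n → Word} q → Computes A → Computes (λ e → zeros (⟦ q ⟧ (length (A e))))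
zerosC {A = A} q a = castC (λ e → trans (go (ones (⟦ q ⟧ (length (A e)))) 0 (_ ∷ [])) (cong zeros (trans (+-identityʳ _) (length-replicate (⟦ q ⟧ (length (A e)))))))
                       (call₁ (loopPT zerosLoop) (onesC q a))
  where
  go : ∀ w k e → eval {2} x₀ (Loop.iter zerosLoop w (zeros k ∷ []) e Vec.++ e) ≡ zeros (length w + k)
  go [] k e = refl
  go (b ∷ w) k e = trans (go w (suc k) e) (cong zeros (+-suc (length w) k))

module _ {n : ℕ} where
  -- The machine of a given predicate becomes part of the language through its simulation, so that
  -- new predicates can be built upon it.
  pred₂D : ∀ {V} → PTimePred₂ V → ∀ {A B : Vec Word n → Word} → Computes A → Computes B → Decides (λ e → V (A e) (B e))
  pred₂D {V} pt a b = fromBoolWord (call₂ (PolyTime⇒PT {2} pt (λ { (x ∷ y ∷ []) → x , y }) (λ { (x ∷ y ∷ []) → refl })) a b)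

  pred₃D : ∀ {V} → PTimePred₃ V → ∀ {A B C : Vec Word n → Word} → Computes A → Computes B → Computes C →
           Decides (λ e → V (A e) (B e) (C e))
  pred₃D {V} pt a b c = fromBoolWord (call₃ (PolyTime⇒PT {3} pt (λ { (x ∷ y ∷ z ∷ []) → x , y , z }) (λ { (x ∷ y ∷ z ∷ []) → refl })) a b c)

  fpC : ∀ {f} → FPt f → ∀ {A : Vec Word n → Word} → Computes A → Computes (λ e → f (A e))
  fpC pt a = call₁ (PolyTime⇒PT {1} pt (λ { (x ∷ []) → x }) (λ { (x ∷ []) → refl })) a

toPred₂ : ∀ {V : Word → Word → Bool} → Decides {2} (λ e → V (lookup e zero) (lookup e (suc zero))) → PTimePred₂ V
toPred₂ (decides t p) = PT⇒PolyTime (ptime t) (λ { (x , y) → x ∷ y ∷ [] }) (λ { (x , y) → refl }) (λ { (x , y) → p (x ∷ y ∷ []) })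

toPred₃ : ∀ {V : Word → Word → Word → Bool} → Decides {3} (λ e → V (lookup e zero) (lookup e (suc zero)) (lookup e (suc (suc zero)))) → PTimePred₃ V
toPred₃ (decides t p) = PT⇒PolyTime (ptime t) (λ { (x , y , z) → x ∷ y ∷ z ∷ [] }) (λ { (x , y , z) → refl }) (λ { (x , y , z) → p (x ∷ y ∷ z ∷ []) })

toFPt : ∀ {f : Word → Word} → Computes {1} (λ e → f (lookup e zero)) → FPt f
toFPt (computes t p) = PT⇒PolyTime (ptime t) (λ x → x ∷ []) (λ x → refl) (λ x → p (x ∷ []))

v₀ : ∀ {n} → Computes {1 + n} (λ e → lookup e zero)
v₀ = varC zero
v₁ : ∀ {n} → Computes {2 + n} (λ e → lookup e (suc zero))
v₁ = varC (suc zero)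
v₂ : ∀ {n} → Computes {3 + n} (λ e → lookup e (suc (suc zero)))
v₂ = varC (suc (suc zero))

-- Pairing

pairW : Word → Word → Word
pairW x w = ones (length x) ++ false ∷ (x ++ w)

unpair fstW sndW : Word → Word
unpair z = tailW (drop (length (leadOnes z)) z)
fstW z = take (length (leadOnes z)) (unpair z)
sndW z = drop (length (leadOnes z)) (unpair z)

leadOnes-ones : ∀ n {w} → leadOnes (ones n ++ false ∷ w) ≡ ones n
leadOnes-ones zero = refl
leadOnes-ones (suc n) = cong (true ∷_) (leadOnes-ones n)

take-++ : ∀ (u : Word) {v} → take (length u) (u ++ v) ≡ u
take-++ [] = refl
take-++ (b ∷ u) = cong (b ∷_) (take-++ u)

drop-++ : ∀ (u : Word) {v} → drop (length u) (u ++ v) ≡ v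
drop-++ [] = refl
drop-++ (b ∷ u) = drop-++ u

lead-pair : ∀ x w → length (leadOnes (pairW x w)) ≡ length x
lead-pair x w = trans (cong length (leadOnes-ones (length x))) (length-replicate (length x))

unpair-pair : ∀ x w → unpair (pairW x w) ≡ x ++ w
unpair-pair x w = cong tailW (trans (cong (λ m → drop m (pairW x w)) (trans (lead-pair x w) (sym (length-replicate (length x))))) (drop-++ (ones (length x))))

fst-pair : ∀ x w → fstW (pairW x w) ≡ x
fst-pair x w = trans (cong₂ take (lead-pair x w) (unpair-pair x w)) (take-++ x)

snd-pair : ∀ x w → sndW (pairW x w) ≡ w
snd-pair x w = trans (cong₂ drop (lead-pair x w) (unpair-pair x w)) (drop-++ x)

-- The length of a pair depends on the lengths of its parts only; hence the certificates for all `w`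
-- of one length have a common length.
length-pair : ∀ x w → length (pairW x w) ≡ length x + suc (length x + length w)
length-pair x w = trans (length-++ (ones (length x))) (cong₂ (λ a b → a + suc b) (length-replicate (length x)) (length-++ x))

pairC : ∀ {n} {A B : Vec Word n → Word} → Computes A → Computes B → Computes (λ e → pairW (A e) (B e))
pairC a b = appendC (onesC X a) (consC false (appendC a b))

unpairC : ∀ {n} {A : Vec Word n → Word} → Computes A → Computes (λ e → unpair (A e))
unpairC a = tailC (call₂ dropPT (call₁ leadPT a) a)

fstC : ∀ {n} {A : Vec Word n → Word} → Computes A → Computes (λ e → fstW (A e))
fstC a = call₂ takePT (call₁ leadPT a) (unpairC a)

sndC : ∀ {n} {A : Vec Word n → Word} → Computes A → Computes (λ e → sndW (A e))
sndC a = call₂ dropPT (call₁ leadPT a) (unpairC a)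

-- Boolean tests, and machines with a prescribed guess length

∧-split : ∀ a {b} → a ∧ b ≡ true → a ≡ true × b ≡ true
∧-split true eq = refl , eq

∧-join : ∀ a {b} → a ≡ true → b ≡ true → a ∧ b ≡ true
∧-join true _ eq = eq

allOnes-ones : ∀ n → allOnes (ones n) ≡ true
allOnes-ones zero = refl
allOnes-ones (suc n) = allOnes-ones n

allOnes⇒ones : ∀ w → allOnes w ≡ true → w ≡ ones (length w)
allOnes⇒ones [] eq = refl
allOnes⇒ones (true ∷ w) eq = cong (true ∷_) (allOnes⇒ones w eq)

positive : ℕ → Bool
positive zero    = false
positive (suc _) = true

positive⇒ : ∀ {n} → positive n ≡ true → 1 ≤ n
positive⇒ {suc n} eq = s≤s z≤n

positive⇐ : ∀ {n} → 1 ≤ n → positive n ≡ true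
positive⇐ (s≤s _) = refl

not-positive : ∀ {n} → ¬ (1 ≤ n) → not (positive n) ≡ true
not-positive {zero} _  = refl
not-positive {suc n} p = ⊥-elim (p (s≤s z≤n))

machine : PolyExp → {V : Word → Word → Bool} → PTimePred₂ V → BalancedNPTM
machine e {V} pt = record { p = toPoly e ; V = V ; V-poly = pt }

guessLen-machine : ∀ e {V} (pt : PTimePred₂ V) x → guessLen (machine e pt) x ≡ ⟦ e ⟧ (length x)
guessLen-machine e pt x = eval-toPoly e (length x)

#acc-countW : ∀ M x → #acc M x ≡ countW (guessLen M x) (BalancedNPTM.V M x)
#acc-countW M x = countVec-countW (guessLen M x) (BalancedNPTM.V M x)

hasLength : PolyExp → Word → Word → Bool
hasLength p x w = eqW (ones (length w)) (ones (⟦ p ⟧ (length x)))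

hasLength⇒ : ∀ p x w → hasLength p x w ≡ true → length w ≡ ⟦ p ⟧ (length x)
hasLength⇒ p x w eq = trans (sym (length-replicate (length w))) (trans (cong length (eqW⇒≡ (ones (length w)) (ones (⟦ p ⟧ (length x))) eq)) (length-replicate _))

hasLength⇐ : ∀ p x w → length w ≡ ⟦ p ⟧ (length x) → hasLength p x w ≡ true
hasLength⇐ p x w eq = trans (cong (λ m → eqW (ones m) (ones (⟦ p ⟧ (length x)))) eq) (eqW-refl (ones (⟦ p ⟧ (length x))))

hasLengthD : ∀ {n} {A B : Vec Word n → Word} p → Computes A → Computes B → Decides (λ e → hasLength p (A e) (B e))
hasLengthD p a b = eqD (onesC X b) (onesC p a)

-- UP = coUP yields unique certificates for the absence of an r-predecessor y of w.
module Certificates (UP=coUP : UP≡coUP) (p : PolyExp) {r : Word → Word → Word → Bool} (r-poly : PTimePred₃ r)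
  (r-unique : ∀ x {w y y′} → length w ≡ ⟦ p ⟧ (length x) → length y ≡ ⟦ p ⟧ (length x) → length y′ ≡ ⟦ p ⟧ (length x) →
              r x y w ≡ true → r x y′ w ≡ true → y ≡ y′) where

  private
    guess pad : Word → Word → Word
    guess z g = take (⟦ p ⟧ (length (fstW z))) g
    pad z g   = drop (⟦ p ⟧ (length (fstW z))) g

    -- At most one path may accept on every input, including those that are no pairs of matching
    -- lengths; the length tests make `r-unique` applicable to all of them. The guess length is
    -- measured in `z` and exceeds what `y` needs, so the surplus is forced to be 1...1.
    V₀ : Word → Word → Bool
    V₀ z g = hasLength p (fstW z) (sndW z) ∧ hasLength p (fstW z) (guess z g) ∧ allOnes (pad z g) ∧ r (fstW z) (guess z g) (sndW z)

    abstract
     V₀-poly : PTimePred₂ V₀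
     V₀-poly = toPred₂ (hasLengthD p (fstC v₀) (sndC v₀) ∧D hasLengthD p (fstC v₀) guessC ∧D
                allOnesD (dropC p (fstC v₀) v₁) ∧D pred₃D r-poly (fstC v₀) guessC (sndC v₀))
       where
        guessC : Computes {2} (λ e → guess (lookup e zero) (lookup e (suc zero)))
        guessC = takeC p (fstC v₀) v₁

    M₀ : BalancedNPTM
    M₀ = machine p V₀-poly

    V₀-split : ∀ z g → V₀ z g ≡ true → hasLength p (fstW z) (sndW z) ≡ true × hasLength p (fstW z) (guess z g) ≡ true ×
                 allOnes (pad z g) ≡ true × r (fstW z) (guess z g) (sndW z) ≡ true
    V₀-split z g v =
      let w , v₁ = ∧-split (hasLength p (fstW z) (sndW z)) v
          y , v₂ = ∧-split (hasLength p (fstW z) (guess z g)) v₁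
          o , v₃ = ∧-split (allOnes (pad z g)) v₂
      in w , y , o , v₃

    V₀-unique : ∀ z {n g g′} → Holds n (V₀ z) g → Holds n (V₀ z) g′ → g ≡ g′
    V₀-unique z {n} {g} {g′} (l , v) (l′ , v′) =
      let w , y , o , v₃ = V₀-split z g v
          w′ , y′ , o′ , v₃′ = V₀-split z g′ v′
          m = ⟦ p ⟧ (length (fstW z))
      in trans (sym (take++drop≡id m g)) (trans (cong₂ _++_
           (r-unique (fstW z) (hasLength⇒ p (fstW z) (sndW z) w) (hasLength⇒ p (fstW z) (guess z g) y) (hasLength⇒ p (fstW z) (guess z g′) y′) v₃ v₃′)
           (trans (allOnes⇒ones (pad z g) o) (trans (cong ones (trans (length-drop m g) (trans (cong (_∸ m) (trans l (sym l′))) (sym (length-drop m g′)))))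
             (sym (allOnes⇒ones (pad z g′) o′)))))
         (take++drop≡id m g′))

    L : Language
    L z = positive (#acc M₀ z)

    L-UP : InUP L
    L-UP = M₀ , (λ z → ≤-trans (≤-reflexive (#acc-countW M₀ z)) (unique⇒count≤1 (guessLen M₀ z) (V₀-unique z))) ,
           λ z → mk⇔ positive⇒ positive⇐

    abstract
     coL : InCoUP L
     coL = fwd (UP=coUP L) L-UP

    M₁ : BalancedNPTM
    M₁ = proj₁ coL

  N : Word → Word → Word → Bool
  N x w c = BalancedNPTM.V M₁ (pairW x w) c

  -- The guess length of the complementary machine on `pairW x w`, rewritten as a polynomial in the
  -- length of `x` for `w` of length `p`.
  q : PolyExp
  q = fromPoly (BalancedNPTM.p M₁) ⊚ (X ⊕ (K 1 ⊕ (X ⊕ p)))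

  N-decides : ∀ {n} {A B C : Vec Word n → Word} → Computes A → Computes B → Computes C → Decides (λ e → N (A e) (B e) (C e))
  N-decides a b c = pred₂D (BalancedNPTM.V-poly M₁) (pairC a b) c

  module _ (x : Word) {w : Word} (lw : length w ≡ ⟦ p ⟧ (length x)) where
    private
      z = pairW x w

      guessLen-q : guessLen M₁ z ≡ ⟦ q ⟧ (length x)
      guessLen-q = trans (sym (eval-fromPoly (BalancedNPTM.p M₁) (length z))) (cong ⟦ fromPoly (BalancedNPTM.p M₁) ⟧
                     (trans (length-pair x w) (cong (λ m → length x + suc (length x + m)) lw)))

      count₁ : #acc M₁ z ≡ countW (⟦ q ⟧ (length x)) (N x w)
      count₁ = trans (#acc-countW M₁ z) (cong (λ m → countW m (N x w)) guessLen-q)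

      n₀ : ℕ
      n₀ = guessLen M₀ z

      m≤n₀ : ⟦ p ⟧ (length x) ≤ n₀
      m≤n₀ = ≤-trans (⟦⟧-mono p (≤-trans (m≤m+n (length x) _) (≤-reflexive (sym (length-pair x w))))) (≤-reflexive (sym (guessLen-machine p V₀-poly z)))

      r⇒acc : ∀ {y} → length y ≡ ⟦ p ⟧ (length x) → r x y w ≡ true → 1 ≤ #acc M₀ z
      r⇒acc {y} ly ry = ≤-trans (∃⇒count≥1 n₀ {V₀ z} {g} (lg , vg)) (≤-reflexive (sym (#acc-countW M₀ z)))
        where
        g = y ++ ones (n₀ ∸ length y)
        lg : length g ≡ n₀
        lg = trans (length-++ y) (trans (cong (length y +_) (length-replicate (n₀ ∸ length y))) (m+[n∸m]≡n (subst (_≤ n₀) (sym ly) m≤n₀)))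
        m= : ⟦ p ⟧ (length (fstW z)) ≡ length y
        m= = trans (cong (λ u → ⟦ p ⟧ (length u)) (fst-pair x w)) (sym ly)
        guess= : guess z g ≡ y
        guess= = trans (cong (λ m → take m g) m=) (take-++ y)
        vg₁ : hasLength p (fstW z) (sndW z) ≡ true
        vg₁ = hasLength⇐ p (fstW z) (sndW z) (trans (cong length (snd-pair x w)) (trans lw (cong (λ u → ⟦ p ⟧ (length u)) (sym (fst-pair x w)))))
        vg₂ : hasLength p (fstW z) (guess z g) ≡ true
        vg₂ = hasLength⇐ p (fstW z) (guess z g) (trans (cong length guess=) (sym m=))
        vg₃ : allOnes (pad z g) ≡ true
        vg₃ = trans (cong allOnes (trans (cong (λ m → drop m g) m=) (drop-++ y))) (allOnes-ones (n₀ ∸ length y))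
        vg₄ : r (fstW z) (guess z g) (sndW z) ≡ true
        vg₄ = trans (cong₂ (λ a b → r a b (sndW z)) (fst-pair x w) guess=) (trans (cong (r x y) (snd-pair x w)) ry)
        vg : V₀ z g ≡ true
        vg = ∧-join (hasLength p (fstW z) (sndW z)) vg₁ (∧-join (hasLength p (fstW z) (guess z g)) vg₂ (∧-join (allOnes (pad z g)) vg₃ vg₄))

      acc⇒r : 1 ≤ #acc M₀ z → Σ Word λ y → length y ≡ ⟦ p ⟧ (length x) × r x y w ≡ true
      acc⇒r le =
        let g , lg , v = count≥1⇒∃ n₀ {V₀ z} (≤-trans le (≤-reflexive (#acc-countW M₀ z)))
            _ , y , _ , v₃ = V₀-split z g v
        in guess z g , trans (hasLength⇒ p (fstW z) (guess z g) y) (cong (λ u → ⟦ p ⟧ (length u)) (fst-pair x w)) ,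
           trans (sym (cong₂ (λ a b → r a (guess z g) b) (fst-pair x w) (snd-pair x w))) v₃

    certificate-unique : ∀ {c c′} → Holds (⟦ q ⟧ (length x)) (N x w) c → Holds (⟦ q ⟧ (length x)) (N x w) c′ → c ≡ c′
    certificate-unique = count≤1⇒unique (⟦ q ⟧ (length x)) (≤-trans (≤-reflexive (sym count₁)) (proj₁ (proj₂ coL) z))

    certificate-sound : ∀ {c y} → Holds (⟦ q ⟧ (length x)) (N x w) c → length y ≡ ⟦ p ⟧ (length x) → ¬ (r x y w ≡ true)
    certificate-sound hc ly ry = contra (bwd (proj₂ (proj₂ coL) z) (≤-trans (∃⇒count≥1 (⟦ q ⟧ (length x)) hc) (≤-reflexive (sym count₁))))
                                  (bwd (proj₂ (proj₂ L-UP) z) (r⇒acc ly ry))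
      where
      contra : ∀ {b} → not b ≡ true → ¬ (b ≡ true)
      contra {true} ()

    certificate-complete : (∀ {y} → length y ≡ ⟦ p ⟧ (length x) → ¬ (r x y w ≡ true)) → Σ Word (Holds (⟦ q ⟧ (length x)) (N x w))
    certificate-complete none = count≥1⇒∃ (⟦ q ⟧ (length x)) (≤-trans (fwd (proj₂ (proj₂ coL) z) notL) (≤-reflexive count₁))
      where
      notL : not (L z) ≡ true
      notL = not-positive λ le → let y , ly , ry = acc⇒r le in none ly ry

-- Members of the classes as machines with ranked paths

record ClusterMachine (Adj : RankAdj) (f : Word → ℕ) : Set where
  field
    p         : PolyExp
    V         : Word → Word → Bool
    V-poly    : PTimePred₂ V
    prec      : Word → Word → Word → Bool
    prec-poly : PTimePred₃ prec
    clustered : ∀ x → Clustered Adj (⟦ p ⟧ (length x)) (V x) (prec x) (f x)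

  len : Word → ℕ
  len x = ⟦ p ⟧ (length x)

  open module R x = Clustered (clustered x) public using (rank; rank<; rank-inj; unrank; adj; cluster; count)

module _ {S : AdjRel} {Adj : RankAdj} (rep : Represents S Adj) {f : Word → ℕ} where
  toClusterMachine : ∀ M prec → PTimePred₃ prec →
                     (∀ x → Σ (Vec Bool (guessLen M x) ⤖ Vec Bool (guessLen M x)) λ h → ClusterConds S f M prec x h) → ClusterMachine Adj f
  toClusterMachine M prec pt h = record
    { p = fromPoly (BalancedNPTM.p M) ; V = BalancedNPTM.V M ; V-poly = BalancedNPTM.V-poly M ; prec = prec ; prec-poly = pt
    ; clustered = λ x → subst (λ n → Clustered Adj n (BalancedNPTM.V M x) (prec x) (f x)) (sym (eval-fromPoly (BalancedNPTM.p M) (length x)))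
        (fromConds rep {f} {M} {prec} {x} (proj₁ (h x)) (proj₂ (h x))) }

  module _ (C : ClusterMachine Adj f) where
    open ClusterMachine C
    balanced : BalancedNPTM
    balanced = machine p V-poly

    clustered′ : ∀ x → Clustered Adj (guessLen balanced x) (V x) (prec x) (f x)
    clustered′ x = subst (λ n → Clustered Adj n (V x) (prec x) (f x)) (sym (guessLen-machine p V-poly x)) (clustered x)

    conds : ∀ x → ClusterConds S f balanced prec x (Ranking.permutation (Clustered.R (clustered′ x)))
    conds x = toConds rep {f} {balanced} {prec} {x} (clustered′ x)

    rank-clustered′ : ∀ x w → Clustered.rank (clustered′ x) w ≡ rank x w
    rank-clustered′ x w = lem (sym (guessLen-machine p V-poly x)) (clustered x)
      where
      lem : ∀ {m n} (eq : m ≡ n) (c : Clustered Adj m (V x) (prec x) (f x)) →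
            Clustered.rank (subst (λ n → Clustered Adj n (V x) (prec x) (f x)) eq c) w ≡ Clustered.rank c w
      lem refl c = refl

record Ends {f} (C : ClusterMachine LinAdj f) : Set where
  open ClusterMachine C
  field
    bot top    : Word → Word
    bot-fp     : FPt bot
    top-fp     : FPt top
    bot-length : ∀ x → length (bot x) ≡ len x
    top-length : ∀ x → length (top x) ≡ len x
    rank-bot   : ∀ x → rank x (bot x) ≡ 0
    rank-top   : ∀ x → suc (rank x (top x)) ≡ 2 ^ len x

free⇒machine : ∀ {f} → CLU#P-free f → ClusterMachine LinAdj f
free⇒machine (M , prec , pt , h) = toClusterMachine ≺lex-represents M prec pt h

machine⇒free : ∀ {f} → ClusterMachine LinAdj f → CLU#P-free f
machine⇒free C = balanced ≺lex-represents C , ClusterMachine.prec C , ClusterMachine.prec-poly C , λ x → Ranking.permutation (Clustered.R (clustered′ ≺lex-represents C x)) , conds ≺lex-represents C x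

circular⇒machine : ∀ {f} → CLU#P-circular f → ClusterMachine CircAdj f
circular⇒machine (M , prec , pt , h) = toClusterMachine circSucc-represents M prec pt h

machine⇒CLU#P : ∀ {f} (C : ClusterMachine LinAdj f) → Ends C → CLU#P f
machine⇒CLU#P C E = balanced ≺lex-represents C , prec , prec-poly , bot , bot-fp , top , top-fp , λ x →
  let n = guessLen (balanced ≺lex-represents C) x
      C′ = clustered′ ≺lex-represents C x
      n= = guessLen-machine p V-poly x
      val : ∀ w → length w ≡ len x → valM (Bijection.to (Clustered.permutation C′) (toVec n w)) ≡ rank x w
      val w l = trans (Clustered.valM-permutation C′ (toVec n w)) (trans (cong (Clustered.rank C′) (toList-toVec w (trans l (sym n=)))) (rank-clustered′ ≺lex-represents C x w))
  in Clustered.permutation C′ ,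
     (toVec n (bot x) , toList-toVec (bot x) (trans (bot-length x) (sym n=)) ,
        valM-zeros-unique _ (trans (val (bot x) (bot-length x)) (rank-bot x))) ,
     (toVec n (top x) , toList-toVec (top x) (trans (top-length x) (sym n=)) ,
        valM-ones-unique _ (trans (cong suc (val (top x) (top-length x))) (trans (rank-top x) (cong (2 ^_) (sym n=))))) ,
     conds ≺lex-represents C x
  where
  open ClusterMachine C
  open Ends E

-- Reversing the order

m∸-suc : ∀ {m a b} → a ≤ m → b ≤ m → a ≡ suc b → m ∸ b ≡ suc (m ∸ a)
m∸-suc {m} {b = b} a≤m b≤m refl = +-∸-assoc 1 a≤m

∸-suc⁻ : ∀ {m a b} → a ≤ m → b ≤ m → m ∸ b ≡ suc (m ∸ a) → a ≡ suc b
∸-suc⁻ {m} {a} {b} a≤m b≤m eq = +-cancelˡ-≡ (m ∸ a) a (suc b)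
  (trans (m∸n+n≡m a≤m) (trans (sym (m∸n+n≡m b≤m)) (trans (cong (_+ b) eq) (sym (+-suc (m ∸ a) b)))))

∸-reflects-≤ : ∀ {m a b} → a ≤ m → b ≤ m → m ∸ b ≤ m ∸ a → a ≤ b
∸-reflects-≤ {m} a≤m b≤m le = subst₂ _≤_ (m∸[m∸n]≡n a≤m) (m∸[m∸n]≡n b≤m) (∸-monoʳ-≤ m le)

reversed : ∀ {f} → ClusterMachine LinAdj f → ClusterMachine LinAdj f
reversed {f} C = record
  { p = p ; V = V ; V-poly = V-poly ; prec = λ x y z → prec x z y ; prec-poly = toPred₃ (pred₃D prec-poly v₀ v₂ v₁)
  ; clustered = λ x → record
    { R = record { rank = λ w → last x ∸ rank x w
                 ; rank< = λ {w} l → ≤-<-trans (m∸n≤m (last x) (rank x w)) (≤-reflexive (suc-last x))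
                 ; rank-inj = λ {u} {v} lu lv eq → rank-inj x lu lv (∸-cancelˡ-≡ (rank≤ x lu) (rank≤ x lv) eq) }
    ; adj = λ {y} {z} ly lz → mk⇔ (λ eq → m∸-suc (rank≤ x ly) (rank≤ x lz) (fwd (adj x lz ly) eq))
                                   (λ eq → bwd (adj x lz ly) (∸-suc⁻ (rank≤ x ly) (rank≤ x lz) eq))
    ; cluster = λ ne → let ℓ , u , lℓ , lu , c = cluster x ne in u , ℓ , lu , lℓ , λ {w} lw → mk⇔
        (λ acc → let a , b = fwd (c lw) acc in ∸-monoʳ-≤ (last x) b , ∸-monoʳ-≤ (last x) a)
        (λ { (a , b) → bwd (c lw) (∸-reflects-≤ (rank≤ x lℓ) (rank≤ x lw) b , ∸-reflects-≤ (rank≤ x lw) (rank≤ x lu) a) })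
    ; count = count x } }
  where
  open ClusterMachine C
  last : Word → ℕ
  last x = pred (2 ^ len x)
  suc-last : ∀ x → suc (last x) ≡ 2 ^ len x
  suc-last x = suc-pred (2 ^ len x) {{m^n≢0 2 (len x)}}
  rank≤ : ∀ x {w} → length w ≡ len x → rank x w ≤ last x
  rank≤ x l = ≤-pred (≤-trans (rank< x l) (≤-reflexive (sym (suc-last x))))

-- Values and counts of words with an all-ones tag

valL-++ : ∀ u v → valL (u ++ v) ≡ valL u + 2 ^ length u * valL v
valL-++ [] v = sym (+-identityʳ _)
valL-++ (false ∷ u) v = trans (cong (2 *_) (valL-++ u v))
  (solve 3 (λ a b c → con 2 :* (a :+ b :* c) := con 2 :* a :+ con 2 :* b :* c) refl (valL u) (2 ^ length u) (valL v))
valL-++ (true ∷ u) v = trans (cong (λ z → suc (2 * z)) (valL-++ u v))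
  (solve 3 (λ a b c → con 1 :+ con 2 :* (a :+ b :* c) := con 1 :+ con 2 :* a :+ con 2 :* b :* c) refl (valL u) (2 ^ length u) (valL v))

valL-ones : ∀ n → suc (valL (ones n)) ≡ 2 ^ n
valL-ones zero = refl
valL-ones (suc n) = trans (sym (*-suc 2 (valL (ones n)))) (cong (2 *_) (valL-ones n))

valL-zeros : ∀ n → valL (zeros n) ≡ 0
valL-zeros zero = refl
valL-zeros (suc n) = cong (2 *_) (valL-zeros n)

allOnes⇒valL : ∀ w → allOnes w ≡ true → suc (valL w) ≡ 2 ^ length w
allOnes⇒valL w eq = trans (cong (λ z → suc (valL z)) (allOnes⇒ones w eq)) (valL-ones (length w))

¬allOnes⇒valL : ∀ w → allOnes w ≡ false → suc (valL w) < 2 ^ length w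
¬allOnes⇒valL w eq with m≤n⇒m<n∨m≡n (valL< w)
... | inj₁ lt = lt
... | inj₂ e with () ← trans (sym eq) (trans (cong allOnes (valL-injective w (ones (length w)) (sym (length-replicate (length w)))
                  (suc-injective (trans e (sym (valL-ones (length w))))))) (allOnes-ones (length w)))

countW-allOnes : ∀ k b → countW k (λ s → allOnes s ∧ b) ≡ (if b then 1 else 0)
countW-allOnes zero b = refl
countW-allOnes (suc k) b = cong₂ _+_ (∄⇒count≡0 k λ { (_ , ()) }) (countW-allOnes k b)

-- Exactly one tag of length `k` is all ones, so lengthening the paths in this way preserves the
-- number of accepting ones.
countW-block : ∀ n k (P : Word → Bool) → countW (n + k) (λ s → allOnes (drop n s) ∧ P (take n s)) ≡ countW n P
countW-block zero k P = countW-allOnes k (P [])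
countW-block (suc n) k P = cong₂ _+_ (countW-block n k (λ w → P (false ∷ w))) (countW-block n k (λ w → P (true ∷ w)))

-- The words w ++ u with |w| = n and |u| = k are split into base w and tag u; those with tag 1…1 have the values B, …, 2^m ∸ 1.
module Block (n k : ℕ) where
  m B : ℕ
  m = n + k
  B = 2 ^ n * pred (2 ^ k)

  base tag : Word → Word
  base s = take n s
  tag s  = drop n s

  -- `last` recognises the value `B ∸ 1` without computing `B`: the tag is not 1...1 but becomes so
  -- by one increment.
  chain last : Word → Bool
  chain s = allOnes (tag s)
  last s  = not (chain s) ∧ chain (inc s)

  suc-pred-2^k : suc (pred (2 ^ k)) ≡ 2 ^ k
  suc-pred-2^k = suc-pred (2 ^ k) {{m^n≢0 2 k}}

  B+2^n : B + 2 ^ n ≡ 2 ^ m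
  B+2^n = trans (trans (+-comm B (2 ^ n)) (sym (*-suc (2 ^ n) (pred (2 ^ k))))) (trans (cong (2 ^ n *_) suc-pred-2^k) (sym (^-distribˡ-+-* 2 n k)))

  B<2^m : B < 2 ^ m
  B<2^m = ≤-trans (≤-trans (≤-reflexive (+-comm 1 B)) (+-monoʳ-≤ B (m^n>0 2 n))) (≤-reflexive B+2^n)

  length-base : ∀ {s} → length s ≡ m → length (base s) ≡ n
  length-base {s} l = trans (length-take n s) (m≤n⇒m⊓n≡m (≤-trans (m≤m+n n k) (≤-reflexive (sym l))))

  length-tag : ∀ {s} → length s ≡ m → length (tag s) ≡ k
  length-tag {s} l = trans (length-drop n s) (trans (cong (_∸ n) l) (m+n∸m≡n n k))

  split : ∀ {s t} → base s ≡ base t → tag s ≡ tag t → s ≡ t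
  split {s} {t} b e = trans (sym (take++drop≡id n s)) (trans (cong₂ _++_ b e) (take++drop≡id n t))

  base-++ : ∀ w u → length w ≡ n → base (w ++ u) ≡ w
  base-++ w u lw = trans (cong (λ j → take j (w ++ u)) (sym lw)) (take-++ w)

  tag-++ : ∀ w u → length w ≡ n → tag (w ++ u) ≡ u
  tag-++ w u lw = trans (cong (λ j → drop j (w ++ u)) (sym lw)) (drop-++ w)

  length-join : ∀ (w u : Word) → length w ≡ n → length u ≡ k → length (w ++ u) ≡ m
  length-join w u lw lu = trans (length-++ w {u}) (cong₂ _+_ lw lu)

  valL-split : ∀ {s} → length s ≡ m → valL s ≡ valL (base s) + 2 ^ n * valL (tag s)
  valL-split {s} l = trans (cong valL (sym (take++drop≡id n s))) (trans (valL-++ (base s) (tag s))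
    (cong (λ j → valL (base s) + 2 ^ j * valL (tag s)) (length-base {s} l)))

  suc-valL≤ : ∀ {s} → length s ≡ m → suc (valL s) ≤ 2 ^ n * suc (valL (tag s))
  suc-valL≤ {s} l = ≤-trans (≤-reflexive (cong suc (valL-split {s} l))) (≤-trans (+-monoˡ-≤ _ (subst (λ j → valL (base s) < 2 ^ j) (length-base {s} l) (valL< (base s))))
    (≤-reflexive (sym (*-suc (2 ^ n) (valL (tag s))))))

  chain⇒≥B : ∀ {s} → length s ≡ m → chain s ≡ true → B ≤ valL s
  chain⇒≥B {s} l c = ≤-trans (≤-reflexive (cong (2 ^ n *_) (suc-injective (trans suc-pred-2^k (trans (cong (2 ^_) (sym (length-tag {s} l))) (sym (allOnes⇒valL (tag s) c)))))))
    (≤-trans (m≤n+m (2 ^ n * valL (tag s)) (valL (base s))) (≤-reflexive (sym (valL-split {s} l))))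

  ¬chain⇒<B : ∀ {s} → length s ≡ m → chain s ≡ false → valL s < B
  ¬chain⇒<B {s} l c = ≤-trans (suc-valL≤ {s} l) (*-monoʳ-≤ (2 ^ n) (≤-pred (≤-trans (¬allOnes⇒valL (tag s) c)
    (≤-reflexive (trans (cong (2 ^_) (length-tag {s} l)) (sym suc-pred-2^k))))))

  valL-inc-<B : ∀ {s} → length s ≡ m → valL s < B → valL (inc s) ≡ suc (valL s)
  valL-inc-<B {s} l lt = valL-inc s (subst (λ j → suc (valL s) < 2 ^ j) (sym l) (≤-<-trans lt B<2^m))

  length-inc′ : ∀ {s} → length s ≡ m → length (inc s) ≡ m
  length-inc′ {s} l = trans (length-inc s) l

  last⇒ : ∀ {s} → length s ≡ m → last s ≡ true → suc (valL s) ≡ B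
  last⇒ {s} l e with chain s in c
  ... | false = ≤-antisym (¬chain⇒<B {s} l c) (≤-trans (chain⇒≥B {inc s} (length-inc′ {s} l) e) (≤-reflexive (valL-inc-<B {s} l (¬chain⇒<B {s} l c))))

  last⇐ : ∀ {s} → length s ≡ m → suc (valL s) ≡ B → last s ≡ true
  last⇐ {s} l e with chain s in c
  ... | true = ⊥-elim (<-irrefl refl (<-≤-trans (≤-reflexive e) (chain⇒≥B {s} l c)))
  ... | false with chain (inc s) in c′
  ...   | true = refl
  ...   | false = ⊥-elim (<-irrefl (trans (valL-inc-<B {s} l (¬chain⇒<B {s} l c)) e) (¬chain⇒<B {inc s} (length-inc′ {s} l) c′))

-- The words w ++ 1…1 carry the order of C. The word w₀ ++ 1 0 c₀ with w₀ the least element and c₀ its certificate is put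
-- directly before them, all other words come first in the order of their values.
module Extend (UP=coUP : UP≡coUP) {f : Word → ℕ} (C : ClusterMachine LinAdj f) where
  open ClusterMachine C

  private
    predecessor-unique : ∀ x {w y y′} → length w ≡ len x → length y ≡ len x → length y′ ≡ len x →
                         prec x y w ≡ true → prec x y′ w ≡ true → y ≡ y′
    predecessor-unique x lw ly ly′ e e′ = rank-inj x ly ly′ (suc-injective (trans (sym (fwd (adj x ly lw) e)) (fwd (adj x ly′ lw) e′)))

  open Certificates UP=coUP p prec-poly predecessor-unique using (N; q; N-decides; certificate-unique; certificate-sound; certificate-complete)

  -- Two marker bits and a certificate. The marker 1 0 has a double purpose: its 1 keeps the word
  -- 0...0 from being the auxiliary word, so that it can be the bottom, and its 0 keeps the
  -- auxiliary word away from the tag 1...1.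
  tagExp P : PolyExp
  tagExp = K 2 ⊕ q
  P      = p ⊕ tagExp

  base tag : Word → Word → Word
  base x s = take (len x) s
  tag x s  = drop (len x) s

  chain valid last V′ : Word → Word → Bool
  chain x s = allOnes (tag x s)
  valid x s = hd (tag x s) ∧ not (hd (tailW (tag x s))) ∧ N x (base x s) (tailW (tailW (tag x s)))
  last x s  = not (chain x s) ∧ chain x (inc s)
  V′ x s    = chain x s ∧ V x (base x s)

  -- No link leads from the old order back to the other words. The only entrance is from the
  -- auxiliary word to its own base, which its certificate shows to be the least element.
  precIf : Bool → Bool → Word → Word → Word → Bool
  precIf cs ct x s t = if cs then ct ∧ prec x (base x s) (base x t) else
    (if ct then valid x s ∧ eqW (base x s) (base x t) else rotAdj (valid x) (last x) s t)

  prec′ : Word → Word → Word → Bool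
  prec′ x s t = precIf (chain x s) (chain x t) x s t

  abstract
   V′-poly : PTimePred₂ V′
   V′-poly = toPred₂ (allOnesD (dropC p v₀ v₁) ∧D pred₂D V-poly v₀ (takeC p v₀ v₁))

   prec′-poly : PTimePred₃ prec′
   prec′-poly = toPred₃ (ifD (chainD v₁) (chainD v₂ ∧D pred₃D prec-poly v₀ (takeC p v₀ v₁) (takeC p v₀ v₂))
     (ifD (chainD v₂) (validD v₁ ∧D eqD (takeC p v₀ v₁) (takeC p v₀ v₂))
       (ifD (validD v₂) (lastD v₁) (ifD (validD v₁) falseD
         (notD (lastD v₁) ∧D (eqD (incC v₁) v₂ ∨D (validD (incC v₁) ∧D eqD (incC (incC v₁)) v₂)))))))
     where
     chainD : ∀ {S : Vec Word 3 → Word} → Computes S → Decides (λ e → chain (lookup e zero) (S e))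
     chainD s = allOnesD (dropC p v₀ s)
     validD : ∀ {S : Vec Word 3 → Word} → Computes S → Decides (λ e → valid (lookup e zero) (S e))
     validD s = hdD (dropC p v₀ s) ∧D notD (hdD (tailC (dropC p v₀ s))) ∧D N-decides v₀ (takeC p v₀ s) (tailC (tailC (dropC p v₀ s)))
     lastD : ∀ {S : Vec Word 3 → Word} → Computes S → Decides (λ e → last (lookup e zero) (S e))
     lastD s = notD (chainD s) ∧D chainD (incC s)

  module At (x : Word) where
    n k : ℕ
    n = len x
    k = ⟦ tagExp ⟧ (length x)

    open Block n k hiding (base; tag; chain; last)

    record Valid (s : Word) : Set where
      field
        cert    : Word
        tag≡    : tag x s ≡ true ∷ false ∷ cert
        holds   : Holds (⟦ q ⟧ (length x)) (N x (base x s)) cert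

    valid⇒ : ∀ {s} → Holds m (valid x) s → Valid s
    valid⇒ {s} (l , v) with tag x s in eq | length-tag {s} l
    ... | true ∷ false ∷ c | lt = record { cert = c ; tag≡ = eq ; holds = suc-injective (suc-injective lt) , v }

    valid⇐ : ∀ {s} → Valid s → valid x s ≡ true
    valid⇐ {s} v rewrite Valid.tag≡ v = proj₂ (Valid.holds v)

    -- The tag 1 0 c has value `1 + 4 * valL c`, at most `2 ^ k ∸ 3`, and the tag 1...1 has value
    -- `2 ^ k ∸ 1`. The tag value in between gives the strict inequality demanded by the rotation.
    valid< : ∀ {s} → Holds m (valid x) s → suc (valL s) < B
    valid< {s} h@(l , _) = ≤-<-trans (suc-valL≤ {s} l) (*-monoʳ-< (2 ^ n) {{m^n≢0 2 n}} tag<)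
      where
      open Valid (valid⇒ {s} h)
      tag< : suc (valL (tag x s)) < pred (2 ^ k)
      tag< = ≤-pred (begin
        3 + valL (tag x s)                    ≡⟨ cong (λ z → 3 + valL z) tag≡ ⟩
        4 + 2 * (2 * valL cert)               ≡⟨ solve 1 (λ a → con 4 :+ con 2 :* (con 2 :* a) := con 2 :* (con 2 :* (con 1 :+ a))) refl (valL cert) ⟩
        2 * (2 * suc (valL cert))             ≤⟨ *-monoʳ-≤ 2 (*-monoʳ-≤ 2 (valL< cert)) ⟩
        2 * (2 * 2 ^ length cert)             ≡⟨ cong (λ j → 2 ^ suc (suc j)) (proj₁ holds) ⟩
        2 ^ k                                 ≡⟨ suc-pred-2^k ⟨
        suc (pred (2 ^ k))                    ∎)
        where open ≤-Reasoning

    -- A base of positive rank would have a predecessor, supplied by `unrank`, against the soundness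
    -- of the certificate.
    valid⇒rank-base : ∀ {s} → Holds m (valid x) s → rank x (base x s) ≡ 0
    valid⇒rank-base {s} h@(l , _) with rank x (base x s) in e
    ... | zero = refl
    ... | suc r = let y , ly , ry = unrank x {r} (<-trans (n<1+n r) (subst (_< 2 ^ n) e (rank< x (length-base {s} l)))) in
      ⊥-elim (certificate-sound x (length-base {s} l) (Valid.holds (valid⇒ {s} h)) ly
        (bwd (adj x ly (length-base {s} l)) (trans e (cong suc (sym ry)))))

    unique : ∀ {s t} → Holds m (valid x) s → Holds m (valid x) t → s ≡ t
    unique {s} {t} hs ht = split base≡ (trans (Valid.tag≡ vs) (trans (cong (λ c → true ∷ false ∷ c) cert≡) (sym (Valid.tag≡ vt))))
      where
      vs = valid⇒ {s} hs
      vt = valid⇒ {t} ht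
      base≡ : base x s ≡ base x t
      base≡ = rank-inj x (length-base {s} (proj₁ hs)) (length-base {t} (proj₁ ht)) (trans (valid⇒rank-base {s} hs) (sym (valid⇒rank-base {t} ht)))
      cert≡ : Valid.cert vs ≡ Valid.cert vt
      cert≡ = certificate-unique x (length-base {s} (proj₁ hs)) (Valid.holds vs)
                (subst (λ w → Holds (⟦ q ⟧ (length x)) (N x w) (Valid.cert vt)) (sym base≡) (Valid.holds vt))

    exists : Σ Word (Holds m (valid x))
    exists = s , length-join w (true ∷ false ∷ c) lw (cong (λ j → suc (suc j)) (proj₁ hc)) ,
      valid⇐ {s} (record
        { cert  = c
        ; tag≡  = tag-++ w (true ∷ false ∷ c) lw
        ; holds = proj₁ hc , trans (cong (λ z → N x z c) (base-++ w (true ∷ false ∷ c) lw)) (proj₂ hc) })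
      where
      least : Σ Word λ w → length w ≡ n × rank x w ≡ 0
      least = unrank x {0} (m^n>0 2 n)
      w  = proj₁ least
      lw = proj₁ (proj₂ least)
      certificate : Σ Word (Holds (⟦ q ⟧ (length x)) (N x w))
      certificate = certificate-complete x {w} lw (λ {y} ly e → 0≢1+n (trans (sym (proj₂ (proj₂ least))) (fwd (adj x {y} {w} ly lw) e)))
      c  = proj₁ certificate
      hc = proj₂ certificate
      s  = w ++ true ∷ false ∷ c

    open Rotation {m} {B} {valid x} {last x} (<⇒≤ B<2^m) (λ {s} → last⇒ {s}) (λ {s} → last⇐ {s}) (λ {s} → valid< {s}) (λ {s} {t} → unique {s} {t})

    E : Exists
    E = inj₁ exists

    rankIf : Bool → Word → ℕ
    rankIf true s  = B + rank x (base x s)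
    rankIf false s = ρ E s

    rank′ : Word → ℕ
    rank′ s = rankIf (chain x s) s

    rank′< : ∀ {s} → length s ≡ m → rank′ s < 2 ^ m
    rank′< {s} l with chain x s in c
    ... | true  = <-≤-trans (+-monoʳ-< B (rank< x (length-base {s} l))) (≤-reflexive B+2^n)
    ... | false = <-trans (ρ< E {s} (¬chain⇒<B {s} l c)) B<2^m

    tag-chain : ∀ {s t} → length s ≡ m → length t ≡ m → chain x s ≡ true → chain x t ≡ true → tag x s ≡ tag x t
    tag-chain {s} {t} ls lt cs ct = trans (allOnes⇒ones (tag x s) cs) (trans (cong ones (trans (length-tag {s} ls) (sym (length-tag {t} lt)))) (sym (allOnes⇒ones (tag x t) ct)))

    rank′-inj : ∀ {s t} → length s ≡ m → length t ≡ m → rank′ s ≡ rank′ t → s ≡ t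
    rank′-inj {s} {t} ls lt eq with chain x s in cs | chain x t in ct
    ... | true  | true  = split (rank-inj x (length-base {s} ls) (length-base {t} lt) (+-cancelˡ-≡ B _ _ eq)) (tag-chain {s} {t} ls lt cs ct)
    ... | true  | false = ⊥-elim (<-irrefl refl (<-≤-trans (ρ< E {t} (¬chain⇒<B {t} lt ct)) (≤-trans (m≤m+n B _) (≤-reflexive eq))))
    ... | false | true  = ⊥-elim (<-irrefl refl (<-≤-trans (ρ< E {s} (¬chain⇒<B {s} ls cs)) (≤-trans (m≤m+n B _) (≤-reflexive (sym eq)))))
    ... | false | false = ρ-inj E ls lt (¬chain⇒<B {s} ls cs) (¬chain⇒<B {t} lt ct) eq

    adj′ : ∀ {s t} → length s ≡ m → length t ≡ m → prec′ x s t ≡ true ⇔ rank′ t ≡ suc (rank′ s)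
    adj′ {s} {t} ls lt = go (chain x s) (chain x t) refl refl
      where
      lbs = length-base {s} ls
      lbt = length-base {t} lt
      to′ : valid x s ∧ eqW (base x s) (base x t) ≡ true → B + rank x (base x t) ≡ suc (ρ E s)
      to′ e = let v , b = ∧-split (valid x s) e in
        trans (cong (B +_) (trans (cong (rank x) (sym (eqW⇒≡ (base x s) (base x t) b))) (valid⇒rank-base {s} (ls , v))))
              (trans (+-identityʳ B) (sym (ρ-valid E {s} (ls , v))))
      from′ : chain x s ≡ false → B + rank x (base x t) ≡ suc (ρ E s) → valid x s ∧ eqW (base x s) (base x t) ≡ true
      from′ cs e = ∧-join (valid x s) v (trans (cong (eqW (base x s)) (sym base≡)) (eqW-refl (base x s)))
        where
        -- The left side of `e` is at least `B` and the right side at most `B`. Equality forces `s`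
        -- to be the end of the first part and the base of `t` to have rank 0.
        suc-ρ : suc (ρ E s) ≡ B
        suc-ρ = ≤-antisym (ρ< E {s} (¬chain⇒<B {s} ls cs)) (≤-trans (m≤m+n B _) (≤-reflexive e))
        v : valid x s ≡ true
        v = ρ-end⇒valid E exists {s} ls (¬chain⇒<B {s} ls cs) suc-ρ
        rank-t : rank x (base x t) ≡ 0
        rank-t = +-cancelˡ-≡ B _ _ (trans e (trans suc-ρ (sym (+-identityʳ B))))
        base≡ : base x s ≡ base x t
        base≡ = rank-inj x lbs lbt (trans (valid⇒rank-base {s} (ls , v)) (sym rank-t))
      go : ∀ b c → chain x s ≡ b → chain x t ≡ c → precIf b c x s t ≡ true ⇔ rankIf c t ≡ suc (rankIf b s)
      go true true cs ct = mk⇔ (λ e → trans (cong (B +_) (fwd (adj x lbs lbt) e)) (+-suc B _))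
                              (λ e → bwd (adj x lbs lbt) (+-cancelˡ-≡ B _ _ (trans e (sym (+-suc B _)))))
      go true false cs ct = mk⇔ (λ ()) (λ e → ⊥-elim (<-irrefl refl (<-≤-trans (ρ< E {t} (¬chain⇒<B {t} lt ct)) (≤-trans (m≤m+n B _) (≤-trans (n≤1+n _) (≤-reflexive (sym e)))))))
      go false false cs ct = rotAdj⇔ E {s} {t} ls lt (¬chain⇒<B {s} ls cs) (¬chain⇒<B {t} lt ct)
      go false true cs ct = mk⇔ to′ (from′ cs)

    chain-++ : ∀ {w} → length w ≡ n → chain x (w ++ ones k) ≡ true
    chain-++ {w} lw = trans (cong allOnes (tag-++ w (ones k) lw)) (allOnes-ones k)

    rank′-++ : ∀ {w} → length w ≡ n → rank′ (w ++ ones k) ≡ B + rank x w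
    rank′-++ {w} lw = trans (cong (λ b → rankIf b (w ++ ones k)) (chain-++ {w} lw)) (cong (λ z → B + rank x z) (base-++ w (ones k) lw))

    length-++ones : ∀ {w} → length w ≡ n → length (w ++ ones k) ≡ m
    length-++ones {w} lw = length-join w (ones k) lw (length-replicate k)

    cluster′ : ¬ (f x ≡ 0) → Σ Word λ ℓ → Σ Word λ u → length ℓ ≡ m × length u ≡ m ×
                 (∀ {s} → length s ≡ m → V′ x s ≡ true ⇔ (rank′ ℓ ≤ rank′ s × rank′ s ≤ rank′ u))
    cluster′ ne = let ℓ , u , lℓ , lu , c = cluster x ne in
      ℓ ++ ones k , u ++ ones k , length-++ones {ℓ} lℓ , length-++ones {u} lu , λ {s} ls →
        subst₂ (λ a b → V′ x s ≡ true ⇔ (a ≤ rank′ s × rank′ s ≤ b)) (sym (rank′-++ {ℓ} lℓ)) (sym (rank′-++ {u} lu)) (lem {s} ls (c (length-base {s} ls)))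
      where
      lem : ∀ {s a b} → length s ≡ m → V x (base x s) ≡ true ⇔ (a ≤ rank x (base x s) × rank x (base x s) ≤ b) →
            V′ x s ≡ true ⇔ (B + a ≤ rank′ s × rank′ s ≤ B + b)
      lem {s} ls c with chain x s in cs
      ... | true = mk⇔ (λ v → let p₁ , p₂ = fwd c v in +-monoʳ-≤ B p₁ , +-monoʳ-≤ B p₂)
                       (λ { (p₁ , p₂) → bwd c (+-cancelˡ-≤ B _ _ p₁ , +-cancelˡ-≤ B _ _ p₂) })
      ... | false = mk⇔ (λ ()) (λ { (p₁ , _) → ⊥-elim (<-irrefl refl (<-≤-trans (ρ< E {s} (¬chain⇒<B {s} ls cs)) (≤-trans (m≤m+n B _) p₁))) })

    zeros-tag : tag x (zeros m) ≡ zeros k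
    zeros-tag = go n
      where
      go : ∀ n → drop n (zeros (n + k)) ≡ zeros k
      go zero = refl
      go (suc n) = go n

    -- The tag of 0...0 is neither 1...1 nor of the form 1 0 c, so the word belongs to the first
    -- part and the rotation leaves it at its value.
    rank′-zeros : rank′ (zeros m) ≡ 0
    rank′-zeros = trans (cong (λ b → rankIf b (zeros m)) (cong allOnes zeros-tag))
      (ρ-zero E (length-replicate m) (valL-zeros m) (cong (λ z → hd z ∧ not (hd (tailW z)) ∧ N x (base x (zeros m)) (tailW (tailW z))) zeros-tag))

    rank′-top : ∀ {w} → length w ≡ n → suc (rank x w) ≡ 2 ^ n → suc (rank′ (w ++ ones k)) ≡ 2 ^ m
    rank′-top {w} lw e = trans (cong suc (rank′-++ {w} lw)) (trans (sym (+-suc B _)) (trans (cong (B +_) e) B+2^n))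

  extended : ClusterMachine LinAdj f
  extended = record
    { p = P ; V = V′ ; V-poly = V′-poly ; prec = prec′ ; prec-poly = prec′-poly
    ; clustered = λ x → let open At x in record
      { R = record { rank = rank′ ; rank< = λ {s} → rank′< {s} ; rank-inj = λ {s} {t} → rank′-inj {s} {t} }
      ; adj = λ {s} {t} → adj′ {s} {t}
      ; cluster = cluster′
      ; count = trans (count x) (sym (countW-block n k (V x))) } }

-- The known bottom of the first extension is the top of the reversed order, and the second
-- extension keeps it as top under the tag 1...1. The final order runs against that of `C`; clusters
-- and counts are insensitive to this.
module Bounded (UP=coUP : UP≡coUP) {f : Word → ℕ} (C : ClusterMachine LinAdj f) where
  module E₁ = Extend UP=coUP C
  module E₂ = Extend UP=coUP (reversed E₁.extended)

  private
    bot₁ : Word → Word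
    bot₁ x = zeros (⟦ E₁.P ⟧ (length x))

    length-bot₁ : ∀ x → length (bot₁ x) ≡ ⟦ E₁.P ⟧ (length x)
    length-bot₁ x = length-replicate (⟦ E₁.P ⟧ (length x))

    rank-bot₁ : ∀ x → suc (ClusterMachine.rank (reversed E₁.extended) x (bot₁ x)) ≡ 2 ^ ⟦ E₁.P ⟧ (length x)
    rank-bot₁ x = trans (cong (λ r → suc (pred (2 ^ ⟦ E₁.P ⟧ (length x)) ∸ r)) (E₁.At.rank′-zeros x))
                        (suc-pred (2 ^ ⟦ E₁.P ⟧ (length x)) {{m^n≢0 2 (⟦ E₁.P ⟧ (length x))}})

  ends : Ends E₂.extended
  ends = record
    { bot        = λ x → zeros (⟦ E₂.P ⟧ (length x))
    ; top        = λ x → bot₁ x ++ ones (⟦ E₂.tagExp ⟧ (length x))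
    ; bot-fp     = toFPt (zerosC E₂.P v₀)
    ; top-fp     = toFPt (appendC (zerosC E₁.P v₀) (onesC E₂.tagExp v₀))
    ; bot-length = λ x → length-replicate (⟦ E₂.P ⟧ (length x))
    ; top-length = λ x → E₂.At.length-++ones x {bot₁ x} (length-bot₁ x)
    ; rank-bot   = λ x → E₂.At.rank′-zeros x
    ; rank-top   = λ x → E₂.At.rank′-top x {bot₁ x} (length-bot₁ x) (rank-bot₁ x)
    }

UP=coUP⇒free⊆CLU#P : UP≡coUP → ∀ f → CLU#P-free f → CLU#P f
UP=coUP⇒free⊆CLU#P UP=coUP f free = machine⇒CLU#P (Bounded.E₂.extended UP=coUP (free⇒machine free)) (Bounded.ends UP=coUP (free⇒machine free))

-- From known ends to a circle

∨-split : ∀ a {b} → a ∨ b ≡ true → a ≡ true ⊎ b ≡ true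
∨-split true  eq = inj₁ eq
∨-split false eq = inj₂ eq

∨-joinˡ : ∀ {a b} → a ≡ true → a ∨ b ≡ true
∨-joinˡ refl = refl

∨-joinʳ : ∀ a {b} → b ≡ true → a ∨ b ≡ true
∨-joinʳ true  eq = refl
∨-joinʳ false eq = eq

not-true⇒false : ∀ {b} → not b ≡ true → b ≡ false
not-true⇒false {false} _ = refl

CLU#P⇒free : ∀ {f} → CLU#P f → CLU#P-free f
CLU#P⇒free (M , prec , pt , b , bf , t , tf , h) = M , prec , pt , λ x → proj₁ (h x) , proj₂ (proj₂ (proj₂ (h x)))

CLU#P⇒circular : ∀ {f} → CLU#P f → CLU#P-circular f
CLU#P⇒circular {f} (M , prec , pt , b , bf , t , tf , h) = M , prec° , prec°-poly , λ x →
  proj₁ (h x) , adj° x , proj₂ (proj₂ (proj₂ (proj₂ (h x))))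
  where
  prec° : Word → Word → Word → Bool
  prec° x y z = prec x y z ∨ (eqW y (t x) ∧ eqW z (b x))
  prec°-poly : PTimePred₃ prec°
  prec°-poly = toPred₃ (pred₃D pt v₀ v₁ v₂ ∨D (eqD v₁ (fpC tf v₀) ∧D eqD v₂ (fpC bf v₀)))
  adj° : ∀ x (y z : Vec Bool (guessLen M x)) → prec° x (toList y) (toList z) ≡ true ⇔
         circSucc (Bijection.to (proj₁ (h x)) y) (Bijection.to (proj₁ (h x)) z)
  adj° x y z with h x
  ... | H , (bv , b= , Hb) , (tv , t= , Ht) , adj⇔ , _ = mk⇔ to′ from′
    where
    toList-injective : ∀ {n} {u v : Vec Bool n} → toList u ≡ toList v → u ≡ v
    toList-injective {n} {u} {v} eq = trans (sym (toVec-toList u)) (trans (cong (toVec n) eq) (toVec-toList v))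
    to′ : prec° x (toList y) (toList z) ≡ true → circSucc (Bijection.to H y) (Bijection.to H z)
    to′ e with ∨-split (prec x (toList y) (toList z)) e
    ... | inj₁ p = inj₁ (fwd (adj⇔ y z) p)
    ... | inj₂ q = let q₁ , q₂ = ∧-split (eqW (toList y) (t x)) q in inj₂
      (trans (cong (Bijection.to H) (toList-injective (trans (eqW⇒≡ (toList y) (t x) q₁) (sym t=)))) Ht ,
       trans (cong (Bijection.to H) (toList-injective (trans (eqW⇒≡ (toList z) (b x) q₂) (sym b=)))) Hb)
    from′ : circSucc (Bijection.to H y) (Bijection.to H z) → prec° x (toList y) (toList z) ≡ true
    from′ (inj₁ p) = ∨-joinˡ (bwd (adj⇔ y z) p)
    from′ (inj₂ (p , q)) = ∨-joinʳ (prec x (toList y) (toList z)) (∧-join (eqW (toList y) (t x))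
      (trans (cong (eqW (toList y)) (trans (sym t=) (cong toList (Bijection.injective H (trans Ht (sym p)))))) (eqW-refl (toList y)))
      (trans (cong (eqW (toList z)) (trans (sym b=) (cong toList (Bijection.injective H (trans Hb (sym q)))))) (eqW-refl (toList z))))

-- For an unambiguous machine with the accepting path a, the function 1 + #acc is in CLU#P-free: the words other than 0a are
-- ordered by value, up to the accepted word 1…1, and 0a comes last.
module OnePlus {M : BalancedNPTM} (#acc≤1 : ∀ x → #acc M x ≤ 1) where
  open BalancedNPTM M using () renaming (p to pM; V to VM; V-poly to VM-poly)

  p : PolyExp
  p = K 1 ⊕ fromPoly pM

  -- The leading bit distinguishes a copy of an accepting path from the additional path 1...1, also
  -- when the machine makes no guesses at all.
  valid V : Word → Word → Bool
  valid x s = not (hd s) ∧ VM x (tailW s)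
  V x s     = valid x s ∨ allOnes s

  prec : Word → Word → Word → Bool
  prec x = rotAdj (valid x) allOnes

  abstract
    V-poly : PTimePred₂ V
    V-poly = toPred₂ ((notD (hdD v₁) ∧D pred₂D VM-poly v₀ (tailC v₁)) ∨D allOnesD v₁)

    prec-poly : PTimePred₃ prec
    prec-poly = toPred₃ (ifD (validD v₂) (allOnesD v₁) (ifD (validD v₁) falseD
      (notD (allOnesD v₁) ∧D (eqD (incC v₁) v₂ ∨D (validD (incC v₁) ∧D eqD (incC (incC v₁)) v₂)))))
      where
      validD : ∀ {S : Vec Word 3 → Word} → Computes S → Decides (λ e → valid (lookup e zero) (S e))
      validD s = notD (hdD s) ∧D pred₂D VM-poly v₀ (tailC s)

  module At (x : Word) where
    n m : ℕ
    n = ⟦ fromPoly pM ⟧ (length x)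
    m = suc n

    count-M : #acc M x ≡ countW n (VM x)
    count-M = trans (#acc-countW M x) (cong (λ j → countW j (VM x)) (sym (eval-fromPoly pM (length x))))

    last⇒ : ∀ {s} → length s ≡ m → allOnes s ≡ true → suc (valL s) ≡ 2 ^ m
    last⇒ {s} l e = trans (allOnes⇒valL s e) (cong (2 ^_) l)

    last⇐ : ∀ {s} → length s ≡ m → suc (valL s) ≡ 2 ^ m → allOnes s ≡ true
    last⇐ {s} l e with allOnes s in o
    ... | true  = refl
    ... | false = ⊥-elim (<-irrefl (trans e (cong (2 ^_) (sym l))) (¬allOnes⇒valL s o))

    valid< : ∀ {s} → Holds m (valid x) s → suc (valL s) < 2 ^ m
    valid< {false ∷ w} (l , v) = subst (λ j → suc (valL (false ∷ w)) < 2 ^ j) l (¬allOnes⇒valL (false ∷ w) refl)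

    holds-M : ∀ {w} → Holds m (valid x) (false ∷ w) → Holds n (VM x) w
    holds-M (l , v) = suc-injective l , v

    unique : ∀ {s t} → Holds m (valid x) s → Holds m (valid x) t → s ≡ t
    unique {false ∷ w} {false ∷ u} hs ht =
      cong (false ∷_) (count≤1⇒unique n (≤-trans (≤-reflexive (sym count-M)) (#acc≤1 x)) (holds-M {w} hs) (holds-M {u} ht))

    val< : ∀ {s} → length s ≡ m → valL s < 2 ^ m
    val< {s} l = subst (λ j → valL s < 2 ^ j) l (valL< s)

    open Rotation {m} {2 ^ m} {valid x} {allOnes} ≤-refl (λ {s} → last⇒ {s}) (λ {s} → last⇐ {s}) (λ {s} → valid< {s}) (λ {s} {t} → unique {s} {t}) public

    exists? : Exists
    exists? with 1 ≤? countW n (VM x)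
    ... | yes le = let w , l , v = count≥1⇒∃ n le in inj₁ (false ∷ w , cong suc l , v)
    ... | no ¬le = inj₂ λ {s} → none {s}
      where
      none : ∀ {s} → ¬ Holds m (valid x) s
      none {false ∷ w} h = ¬le (∃⇒count≥1 n (holds-M {w} h))

    allOnes-unique : ∀ {s} → length s ≡ m → allOnes s ≡ true → s ≡ ones m
    allOnes-unique {s} l o = trans (allOnes⇒ones s o) (cong ones l)

    length-ones : length (ones m) ≡ m
    length-ones = length-replicate m

    cluster-of : ∀ E → Σ Word λ ℓ → Σ Word λ u → length ℓ ≡ m × length u ≡ m ×
                 (∀ {s} → length s ≡ m → V x s ≡ true ⇔ (ρ E ℓ ≤ ρ E s × ρ E s ≤ ρ E u))
    cluster-of E@(inj₂ none) = ones m , ones m , length-ones , length-ones , λ {s} l → mk⇔ (to′ {s} l) (from′ {s} l)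
      where
      to′ : ∀ {s} → length s ≡ m → V x s ≡ true → ρ E (ones m) ≤ ρ E s × ρ E s ≤ ρ E (ones m)
      to′ {s} l e with ∨-split (valid x s) e
      ... | inj₁ v = ⊥-elim (none {s} (l , v))
      ... | inj₂ o rewrite allOnes-unique {s} l o = ≤-refl , ≤-refl
      from′ : ∀ {s} → length s ≡ m → ρ E (ones m) ≤ ρ E s × ρ E s ≤ ρ E (ones m) → V x s ≡ true
      from′ {s} l (a , b) = ∨-joinʳ (valid x s) (trans (cong allOnes (ρ-inj E {s} {ones m} l length-ones (val< {s} l) (val< {ones m} length-ones) (≤-antisym b a))) (allOnes-ones m))
    cluster-of E@(inj₁ (e , le , ve)) = ones m , e , length-ones , le , λ {s} l → mk⇔ (to′ {s} l) (from′ {s} l)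
      where
      ρ-e : ρ E e ≡ suc (ρ E (ones m))
      -- Validity of `e` selects the branch of `rotAdj` that only asks whether the first word is
      -- 1...1.
      ρ-e = fwd (rotAdj⇔ E {ones m} {e} length-ones le (val< {ones m} length-ones) (val< {e} le))
              (trans (cong (λ b → if b then allOnes (ones m) else
                (if valid x (ones m) then false else not (allOnes (ones m)) ∧ (eqW (inc (ones m)) e ∨ (valid x (inc (ones m)) ∧ eqW (inc (inc (ones m))) e)))) ve) (allOnes-ones m))
      ρ-max : suc (ρ E e) ≡ 2 ^ m
      ρ-max = ρ-valid E {e} (le , ve)
      to′ : ∀ {s} → length s ≡ m → V x s ≡ true → ρ E (ones m) ≤ ρ E s × ρ E s ≤ ρ E e
      to′ {s} l h with ∨-split (valid x s) h
      ... | inj₁ v rewrite unique {s} {e} (l , v) (le , ve) = ≤-trans (n≤1+n _) (≤-reflexive (sym ρ-e)) , ≤-refl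
      ... | inj₂ o rewrite allOnes-unique {s} l o = ≤-refl , ≤-trans (n≤1+n _) (≤-reflexive (sym ρ-e))
      from′ : ∀ {s} → length s ≡ m → ρ E (ones m) ≤ ρ E s × ρ E s ≤ ρ E e → V x s ≡ true
      from′ {s} l (a , b) with m≤n⇒m<n∨m≡n a
      -- No rank lies strictly between those of 1...1 and `e`, so `s` has the final rank and is the
      -- valid word.
      ... | inj₁ lt = ∨-joinˡ (ρ-end⇒valid E (e , le , ve) {s} l (val< {s} l)
                        (trans (cong suc (≤-antisym b (≤-trans (≤-reflexive ρ-e) lt))) ρ-max))
      ... | inj₂ eq = ∨-joinʳ (valid x s) (trans (cong allOnes (sym (ρ-inj E {ones m} {s} length-ones l (val< {ones m} length-ones) (val< {s} l) eq))) (allOnes-ones m))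

    -- The split by the first bit: words starting with 0 contribute the accepting paths of `M`,
    -- words starting with 1 only 1...1.
    count : 1 + #acc M x ≡ countW m (V x)
    count = trans (+-comm 1 (#acc M x)) (cong₂ _+_
      (trans count-M (countW-cong n λ w _ → sym (∨-identityʳ (VM x w))))
      (sym (trans (countW-cong n λ w _ → sym (∧-identityʳ (allOnes w))) (countW-allOnes n true))))

  onePlus : ClusterMachine LinAdj (λ x → 1 + #acc M x)
  onePlus = record
    { p = p ; V = V ; V-poly = V-poly ; prec = prec ; prec-poly = prec-poly
    ; clustered = λ x → let open At x in record
      { R = record
          { rank     = ρ exists?
          ; rank<    = λ {s} l → ρ< exists? {s} (val< {s} l)
          ; rank-inj = λ {s} {t} ls lt → ρ-inj exists? {s} {t} ls lt (val< {s} ls) (val< {t} lt) }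
      ; adj = λ {s} {t} ls lt → rotAdj⇔ exists? {s} {t} ls lt (val< {s} ls) (val< {t} lt)
      ; cluster = λ _ → cluster-of exists?
      ; count = count } }

-- In a circular order a cluster is a singleton {w} iff each neighbour of w is rejected or equal to w. The guess consists of
-- w and its two neighbours.
module Singleton {f : Word → ℕ} (C : ClusterMachine CircAdj f) where
  open ClusterMachine C

  first second third : Word → Word → Word
  first x g  = take (len x) g
  second x g = take (len x) (drop (len x) g)
  third x g  = drop (len x) (drop (len x) g)

  quiet : Word → Word → Word → Bool
  quiet x w y = not (V x y) ∨ eqW y w

  single : Word → Word → Word → Word → Bool
  single x y w z = prec x y w ∧ prec x w z ∧ V x w ∧ quiet x w y ∧ quiet x w z

  V₁ : Word → Word → Bool
  V₁ x g = single x (first x g) (second x g) (third x g)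

  abstract
    V₁-poly : PTimePred₂ V₁
    V₁-poly = toPred₂ (pred₃D prec-poly v₀ firstC secondC ∧D pred₃D prec-poly v₀ secondC thirdC ∧D pred₂D V-poly v₀ secondC ∧D
                quietD firstC ∧D quietD thirdC)
      where
      firstC : Computes {2} (λ e → first (lookup e zero) (lookup e (suc zero)))
      firstC = takeC p v₀ v₁
      secondC : Computes {2} (λ e → second (lookup e zero) (lookup e (suc zero)))
      secondC = takeC p v₀ (dropC p v₀ v₁)
      thirdC : Computes {2} (λ e → third (lookup e zero) (lookup e (suc zero)))
      thirdC = dropC p v₀ (dropC p v₀ v₁)
      quietD : ∀ {Y : Vec Word 2 → Word} → Computes Y → Decides (λ e → quiet (lookup e zero) (second (lookup e zero) (lookup e (suc zero))) (Y e))
      quietD y = notD (pred₂D V-poly v₀ y) ∨D eqD y secondC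

  p₁ : PolyExp
  p₁ = p ⊕ (p ⊕ p)

  M₁ : BalancedNPTM
  M₁ = machine p₁ V₁-poly

  module At (x : Word) where
    n : ℕ
    n = len x

    record Single (y w z : Word) : Set where
      field
        ly : length y ≡ n
        lw : length w ≡ n
        lz : length z ≡ n
        yw : prec x y w ≡ true
        wz : prec x w z ≡ true
        vw : V x w ≡ true
        qy : quiet x w y ≡ true
        qz : quiet x w z ≡ true

    single⇒ : ∀ {y w z} → length y ≡ n → length w ≡ n → length z ≡ n → single x y w z ≡ true → Single y w z
    single⇒ {y} {w} {z} ly lw lz e =
      let yw , e₁ = ∧-split (prec x y w) e ; wz , e₂ = ∧-split (prec x w z) e₁
          vw , e₃ = ∧-split (V x w) e₂ ; qy , qz = ∧-split (quiet x w y) e₃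
      in record { ly = ly ; lw = lw ; lz = lz ; yw = yw ; wz = wz ; vw = vw ; qy = qy ; qz = qz }

    single⇐ : ∀ {y w z} → Single y w z → single x y w z ≡ true
    single⇐ {y} {w} {z} S = ∧-join (prec x y w) yw (∧-join (prec x w z) wz (∧-join (V x w) vw (∧-join (quiet x w y) qy qz)))
      where open Single S

    quiet⇒ : ∀ {w y} → quiet x w y ≡ true → V x y ≡ true → y ≡ w
    quiet⇒ {w} {y} q v with ∨-split (not (V x y)) q
    ... | inj₂ e = eqW⇒≡ y w e
    ... | inj₁ e with () ← trans (sym v) (not-true⇒false e)

    quiet⇐ : ∀ {w y} → (V x y ≡ true → y ≡ w) → quiet x w y ≡ true
    quiet⇐ {w} {y} h with V x y
    ... | false = refl
    ... | true = trans (cong (λ u → eqW u w) (h refl)) (eqW-refl w)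

    -- A cluster with a second element contains a neighbour of `w` on the side of that element,
    -- which `quiet` forbids. The closing link of the circle does not interfere: an element above
    -- `w` shows that `w` is not the top, one below that it is not the bottom.
    sole : ∀ {y w z} → Single y w z → ∀ {w′} → Holds n (V x) w′ → w′ ≡ w
    sole {y} {w} {z} S {w′} (lw′ , vw′) with <-cmp (rank x w) (rank x w′)
      where open Single S
    ... | tri≈ _ eq _ = rank-inj x lw′ (Single.lw S) (sym eq)
    ... | tri< lt _ _ = ⊥-elim (bad (fwd (adj x (Single.lw S) (Single.lz S)) (Single.wz S)))
      where
      open Single S
      nz : ¬ (f x ≡ 0)
      nz e = <-irrefl (sym (trans (sym (count x)) e)) (∃⇒count≥1 n (lw , vw))
      bad : ¬ CircAdj n (rank x w) (rank x z)
      bad (inj₂ (e , _)) = <-irrefl refl (<-≤-trans (rank< x lw′) (≤-trans (≤-reflexive (sym e)) lt))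
      bad (inj₁ e) = let ℓ , u , _ , _ , c = cluster x nz ; a , _ = fwd (c lw) vw ; _ , b = fwd (c lw′) vw′ in
        1+n≢n (trans (sym e) (cong (rank x) (quiet⇒ {w} {z} qz (bwd (c lz)
          (≤-trans a (≤-trans (n≤1+n _) (≤-reflexive (sym e))) , ≤-trans (≤-reflexive e) (≤-trans lt b))))))
    ... | tri> _ _ gt = ⊥-elim (bad (fwd (adj x (Single.ly S) (Single.lw S)) (Single.yw S)))
      where
      open Single S
      nz : ¬ (f x ≡ 0)
      nz e = <-irrefl (sym (trans (sym (count x)) e)) (∃⇒count≥1 n (lw , vw))
      bad : ¬ CircAdj n (rank x y) (rank x w)
      bad (inj₂ (_ , e)) = n≮0 (subst (rank x w′ <_) e gt)
      bad (inj₁ e) = let ℓ , u , _ , _ , c = cluster x nz ; _ , b = fwd (c lw) vw ; a , _ = fwd (c lw′) vw′ in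
        1+n≢n (trans (sym e) (cong (rank x) (sym (quiet⇒ {w} {y} qy (bwd (c ly)
          (≤-trans a (≤-pred (subst (rank x w′ <_) e gt)) , ≤-trans (n≤1+n _) (≤-trans (≤-reflexive (sym e)) b)))))))

    pred-unique : ∀ {y y′ w} → length y ≡ n → length y′ ≡ n → length w ≡ n → prec x y w ≡ true → prec x y′ w ≡ true → y ≡ y′
    pred-unique ly ly′ lw e e′ = rank-inj x ly ly′ (lem (fwd (adj x ly lw) e) (fwd (adj x ly′ lw) e′))
      where
      lem : ∀ {a b c} → CircAdj n a c → CircAdj n b c → a ≡ b
      lem (inj₁ p) (inj₁ q) = suc-injective (trans (sym p) q)
      lem (inj₁ p) (inj₂ (_ , q)) with () ← trans (sym p) q
      lem (inj₂ (_ , p)) (inj₁ q) with () ← trans (sym p) q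
      lem (inj₂ (p , _)) (inj₂ (q , _)) = suc-injective (trans p (sym q))

    succ-unique : ∀ {w z z′} → length w ≡ n → length z ≡ n → length z′ ≡ n → prec x w z ≡ true → prec x w z′ ≡ true → z ≡ z′
    succ-unique lw lz lz′ e e′ = rank-inj x lz lz′ (lem (rank< x lz) (rank< x lz′) (fwd (adj x lw lz) e) (fwd (adj x lw lz′) e′))
      where
      lem : ∀ {a b c} → b < 2 ^ n → c < 2 ^ n → CircAdj n a b → CircAdj n a c → b ≡ c
      lem b< c< (inj₁ p) (inj₁ q) = trans p (sym q)
      lem b< c< (inj₁ p) (inj₂ (q , _)) = ⊥-elim (<-irrefl (trans p q) b<)
      lem b< c< (inj₂ (p , _)) (inj₁ q) = ⊥-elim (<-irrefl (trans q p) c<)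
      lem b< c< (inj₂ (_ , p)) (inj₂ (_ , q)) = trans p (sym q)

    single-unique : ∀ {y w z y′ w′ z′} → Single y w z → Single y′ w′ z′ → y ≡ y′ × w ≡ w′ × z ≡ z′
    single-unique {w = w} {w′ = w′} S T with sole T {w} (Single.lw S , Single.vw S)
    ... | refl = pred-unique (Single.ly S) (Single.ly T) (Single.lw S) (Single.yw S) (Single.yw T) , refl ,
                 succ-unique (Single.lw S) (Single.lz S) (Single.lz T) (Single.wz S) (Single.wz T)

    single-exists : countW n (V x) ≡ 1 → Σ Word λ y → Σ Word λ w → Σ Word λ z → Single y w z
    single-exists c = let w , lw , vw = count≥1⇒∃ n (≤-reflexive (sym c))
                          y , ly , py = before w lw ; z , lz , pz = after w lw in
      y , w , z , record
        { ly = ly ; lw = lw ; lz = lz ; yw = bwd (adj x ly lw) py ; wz = bwd (adj x lw lz) pz ; vw = vw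
        ; qy = quiet⇐ {w} {y} λ v → count≤1⇒unique n (≤-reflexive c) (ly , v) (lw , vw)
        ; qz = quiet⇐ {w} {z} λ v → count≤1⇒unique n (≤-reflexive c) (lz , v) (lw , vw) }
      where
      suc-max : suc (pred (2 ^ n)) ≡ 2 ^ n
      suc-max = suc-pred (2 ^ n) {{m^n≢0 2 n}}
      before : ∀ w → length w ≡ n → Σ Word λ y → length y ≡ n × CircAdj n (rank x y) (rank x w)
      before w lw with rank x w in e
      -- The bottom takes the top as predecessor; a linear order would leave nothing to guess here.
      ... | zero  = let y , ly , ry = unrank x (≤-reflexive suc-max) in y , ly , inj₂ (trans (cong suc ry) suc-max , refl)
      ... | suc r = let y , ly , ry = unrank x {r} (<-trans (n<1+n r) (subst (_< 2 ^ n) e (rank< x lw))) in y , ly , inj₁ (cong suc (sym ry))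
      after : ∀ w → length w ≡ n → Σ Word λ z → length z ≡ n × CircAdj n (rank x w) (rank x z)
      after w lw with m≤n⇒m<n∨m≡n (rank< x lw)
      ... | inj₁ lt = let z , lz , rz = unrank x lt in z , lz , inj₁ rz
      ... | inj₂ e  = let z , lz , rz = unrank x (m^n>0 2 n) in z , lz , inj₂ (e , rz)

    m : ℕ
    m = n + (n + n)

    count-M₁ : #acc M₁ x ≡ countW m (V₁ x)
    count-M₁ = trans (#acc-countW M₁ x) (cong (λ j → countW j (V₁ x)) (guessLen-machine p₁ V₁-poly x))

    length-drop′ : ∀ {g : Word} {j} → length g ≡ n + j → length (drop n g) ≡ j
    length-drop′ {g} {j} l = trans (length-drop n g) (trans (cong (_∸ n) l) (m+n∸m≡n n j))

    length-take′ : ∀ {g : Word} {j} → length g ≡ n + j → length (take n g) ≡ n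
    length-take′ {g} {j} l = trans (length-take n g) (m≤n⇒m⊓n≡m (≤-trans (m≤m+n n j) (≤-reflexive (sym l))))

    holds⇒single : ∀ {g} → Holds m (V₁ x) g → Single (first x g) (second x g) (third x g)
    holds⇒single {g} (l , v) = single⇒ (length-take′ {g} l) (length-take′ {drop n g} (length-drop′ {g} l)) (length-drop′ {drop n g} (length-drop′ {g} l)) v

    #acc≤1 : #acc M₁ x ≤ 1
    #acc≤1 = ≤-trans (≤-reflexive count-M₁) (unique⇒count≤1 m λ {g} {g′} h h′ →
      let y , w , z = single-unique (holds⇒single {g} h) (holds⇒single {g′} h′) in
      trans (sym (take++drop≡id n g)) (trans (cong₂ _++_ y
        (trans (sym (take++drop≡id n (drop n g))) (trans (cong₂ _++_ w z) (take++drop≡id n (drop n g′))))) (take++drop≡id n g′)))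

    accepts⇒ : 1 ≤ #acc M₁ x → f x ≤ 1
    accepts⇒ le = let g , h = count≥1⇒∃ m (≤-trans le (≤-reflexive count-M₁)) ; S = holds⇒single {g} h in
      ≤-trans (≤-reflexive (count x)) (unique⇒count≤1 n λ hu hv → trans (sole S hu) (sym (sole S hv)))

    accepts⇐ : f x ≡ 1 → 1 ≤ #acc M₁ x
    accepts⇐ e = let y , w , z , S = single-exists (trans (sym (count x)) e) in accept y w z S
      where
      accept : ∀ y w z → Single y w z → 1 ≤ #acc M₁ x
      accept y w z S = ≤-trans (∃⇒count≥1 m {V₁ x} {g} (lg , vg)) (≤-reflexive (sym count-M₁))
        where
        open Single S
        g = y ++ (w ++ z)
        lg : length g ≡ m
        lg = trans (length-++ y) (cong₂ _+_ ly (trans (length-++ w) (cong₂ _+_ lw lz)))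
        take= : ∀ (u v : Word) → length u ≡ n → take n (u ++ v) ≡ u
        take= u v l = trans (cong (λ j → take j (u ++ v)) (sym l)) (take-++ u)
        drop= : ∀ (u v : Word) → length u ≡ n → drop n (u ++ v) ≡ v
        drop= u v l = trans (cong (λ j → drop j (u ++ v)) (sym l)) (drop-++ u)
        g₁ : first x g ≡ y
        g₁ = take= y (w ++ z) ly
        g₂ : second x g ≡ w
        g₂ = trans (cong (take n) (drop= y (w ++ z) ly)) (take= w z lw)
        g₃ : third x g ≡ z
        g₃ = trans (cong (drop n) (drop= y (w ++ z) ly)) (drop= w z lw)
        vg : V₁ x g ≡ true
        vg = trans (cong₂ (λ a b → single x a b (third x g)) g₁ g₂) (trans (cong (single x y w) g₃) (single⇐ S))

-- Complements from circular clusters, and the equivalences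

InUP-cong : ∀ {L L′ : Language} → (∀ x → L x ≡ L′ x) → InUP L → InUP L′
InUP-cong eq (M , le , iff) = M , le , λ x → mk⇔ (λ e → fwd (iff x) (trans (eq x) e)) (λ le → trans (sym (eq x)) (bwd (iff x) le))

module _ (free⊆circular : CLU#P-free⊆CLU#P-circular) where
  UP⇒coUP : ∀ L → InUP L → InCoUP L
  UP⇒coUP L (M , le , iff) = Singleton.M₁ C , (λ x → Singleton.At.#acc≤1 C x) , λ x → mk⇔
    (λ e → Singleton.At.accepts⇐ C x (cong suc (n<1⇒n≡0 (≰⇒> λ acc → case-not (bwd (iff x) acc) e))))
    (λ acc → not-L x (≤-pred (Singleton.At.accepts⇒ C x acc)))
    where
    C : ClusterMachine CircAdj (λ x → 1 + #acc M x)
    C = circular⇒machine (free⊆circular (λ x → 1 + #acc M x) (machine⇒free (OnePlus.onePlus {M} le)))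
    case-not : ∀ {b} → b ≡ true → ¬ (not b ≡ true)
    case-not refl ()
    not-L : ∀ x → #acc M x ≤ 0 → not (L x) ≡ true
    not-L x le with L x in e
    ... | false = refl
    ... | true  = ⊥-elim (n≮0 (≤-trans (fwd (iff x) e) le))

  free⊆circular⇒UP=coUP : UP≡coUP
  -- For the converse, the same implication is applied to the complement of `L`.
  free⊆circular⇒UP=coUP L = mk⇔ (UP⇒coUP L) (λ h → InUP-cong (λ x → not-involutive (L x)) (UP⇒coUP (λ x → not (L x)) h))

theorem5p2 : (UP≡coUP ⇔ CLU#P-free≡CLU#P) × (UP≡coUP ⇔ CLU#P-free⊆CLU#P-circular)
theorem5p2 =
  mk⇔ (λ eq f → mk⇔ (UP=coUP⇒free⊆CLU#P eq f) CLU#P⇒free)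
      -- The return from (2) to (1) passes through (3).
      (λ eq → free⊆circular⇒UP=coUP λ f free → CLU#P⇒circular (fwd (eq f) free)) ,
  mk⇔ (λ eq f free → CLU#P⇒circular (UP=coUP⇒free⊆CLU#P eq f free))
      free⊆circular⇒UP=coUP
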